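{- Let $n \ge 10^9$ be an odd integer and let $k$ be an even integer with $\frac{2n}{5} < k < \frac{n}{2}$. Then $$t(n,k) = \frac{k}{4}(3k-n-1).$$ Moreover, every $n$-vertex $k$-regular graph with exactly $t(n,k)$ triangles belongs to the family $\mathcal{G}(n,k)$.
   Context: For positive integers $n,k$, $t(n,k)$ denotes the minimum number of triangles over all $k$-regular graphs on $n$ vertices. For odd $n$ and even $k$ with $\frac{2n}{5}<k<\frac n2$, the family $\mathcal{G}(n,k)$ is defined as follows. Let $G_0$ be a complete bipartite graph with parts $X, Y$, each of size $\frac{n-1}{2}$, and let $A \subseteq X$, $B \subseteq Y$ be subsets of size $\frac{k}{2}$. $\mathcal{G}(n,k)$ consists of all $n$-vertex graphs obtained from $G_0$ (over all such choices) by: adding a new vertex $v$ and joining $v$ to all vertices of $A \cup B$; removing the edges of a $\frac{n-2k+1}{2}$-factor (spanning $\frac{n-2k+1}{2}$-regular subgraph) of the induced subgraph $G_0[A\cup B]$; and removing the edges of a $\frac{n-2k-1}{2}$-factor of the induced subgraph $G_0[(X\setminus A)\cup(Y\setminus B)]$. -}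

module Defs where

open import Data.Nat using (ℕ; zero; suc; _+_; _*_; _∸_; _^_; _≤_; _<_; _/_; _%_)
open import Data.Bool using (Bool; true; false; _∧_; _∨_; not; if_then_else_)
open import Data.Fin using (Fin; _<?_; _≟_)
open import Data.List using (List; map; allFin)
open import Data.Nat.ListAction using (sum)
open import Data.Empty using (⊥)
open import Data.Product using (Σ; ∃; _×_; _,_)
open import Relation.Nullary.Decidable using (⌊_⌋)
open import Relation.Binary.PropositionalEquality using (_≡_)

record Graph (n : ℕ) : Set where
  field
    adj   : Fin n → Fin n → Bool
    sym   : ∀ i j → adj i j ≡ adj j i
    irrefl : ∀ i → adj i i ≡ false
open Graph public

count : {n : ℕ} → (Fin n → Bool) → ℕ
count {n} p = sum (map (λ i → if p i then 1 else 0) (allFin n))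

degree : {n : ℕ} → Graph n → Fin n → ℕ
degree G i = count (adj G i)

Regular : {n : ℕ} → ℕ → Graph n → Set
Regular k G = ∀ i → degree G i ≡ k

triangles : {n : ℕ} → Graph n → ℕ
triangles {n} G =
  sum (map (λ i → sum (map (λ j → sum (map (λ l →
    if ⌊ i <? j ⌋ ∧ ⌊ j <? l ⌋ ∧ adj G i j ∧ adj G j l ∧ adj G i l
    then 1 else 0) (allFin n))) (allFin n))) (allFin n))

IsMinTriangles : ℕ → ℕ → ℕ → Set
IsMinTriangles n k m =
  (Σ (Graph n) λ G → Regular k G × triangles G ≡ m)
  × (∀ (G : Graph n) → Regular k G → m ≤ triangles G)

-- H is a spanning r-regular subgraph (r-factor) of G0[S ∪ T], where G0 is the
-- complete bipartite graph between the disjoint sets S and T (so H uses only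
-- edges between S and T), with every vertex of S ∪ T having H-degree r.
IsBipFactor : {n : ℕ} → (S T : Fin n → Bool) → ℕ → Graph n → Set
IsBipFactor S T r H =
  (∀ i j → adj H i j ≡ true → (S i ∧ T j) ∨ (T i ∧ S j) ≡ true)
  × (∀ i → S i ∨ T i ≡ true → degree H i ≡ r)

builtAdj : {n : ℕ} → Fin n → (X Y A B : Fin n → Bool) → (H1 H2 : Graph n)
         → Fin n → Fin n → Bool
builtAdj v X Y A B H1 H2 i j =
  if ⌊ i ≟ v ⌋ then A j ∨ B j
  else if ⌊ j ≟ v ⌋ then A i ∨ B i
  else ((X i ∧ Y j) ∨ (Y i ∧ X j)) ∧ not (adj H1 i j) ∧ not (adj H2 i j)

InFamily : (n k : ℕ) → Graph n → Set
InFamily n k G =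
  Σ (Fin n) λ v →
  Σ (Fin n → Bool) λ X → Σ (Fin n → Bool) λ Y →
  Σ (Fin n → Bool) λ A → Σ (Fin n → Bool) λ B →
  Σ (Graph n) λ H1 → Σ (Graph n) λ H2 →
    (X v ≡ false) × (Y v ≡ false)
    × (∀ i → (i ≡ v → ⊥) → (X i ∨ Y i ≡ true) × (X i ∧ Y i ≡ false))
    × (count X ≡ (n ∸ 1) / 2) × (count Y ≡ (n ∸ 1) / 2)
    × (∀ i → A i ≡ true → X i ≡ true) × (∀ i → B i ≡ true → Y i ≡ true)
    × (count A ≡ k / 2) × (count B ≡ k / 2)
    × IsBipFactor A B (((n ∸ 2 * k) + 1) / 2) H1
    × IsBipFactor (λ i → X i ∧ not (A i)) (λ i → Y i ∧ not (B i))
                  ((n ∸ 2 * k ∸ 1) / 2) H2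
    × (∀ i j → adj G i j ≡ builtAdj v X Y A B H1 H2 i j)

{-# OPTIONS --safe #-}
module Submission where

-- Write n = 2q + 1, k = 2h and 3h = q + 1 + e, so that the claimed minimum is h e = O(n²), and let G
-- be k-regular with at most h e triangles. All but O(n) edges are light, that is, lie in at most
-- n / 1000 triangles; an edge is good if it is light and neither end has many heavy edges.
--
-- Suppose there is a closed walk v₀ … v₄ of good edges. The common neighbourhoods of cyclically
-- consecutive members of any five vertices have total size at least 5k - 2n ≥ 2. Together with
-- lightness this shows that k is close to 2n/5 and that G is close to a balanced blow-up of the
-- 5-cycle. Averaging the bound over the 5-cycles of the blow-up gives about 2n²/75 triangles, but
-- h e is only about n²/50.
--
-- Otherwise, for a good edge u₀v₀, putting w on one side or the other according to whether it has a
-- good path of length 2 to u₀ makes all good edges cross, since the ends of a good edge inside a side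
-- would have at least 3k - n - o(n) common neighbours. Pass to a locally maximal cut (X , Y) with
-- |X| > |Y|; inner degrees are then at most h. By regularity X spans m ≥ h edges, and an edge xx′
-- inside X has at least 4h - q - d(x) - d(x′) common neighbours in Y, where d is the degree in X.
-- First this bounds m by about 10h/7, and then, estimating Σ d² by d(v)² + d(v) + s² + 5s for v of
-- maximal degree with s inner edges missing v, it forces the inner edges to form a star with h edges.
-- Tightness of the count of common neighbours yields the structure of the family.

-- A triangle-free graph with all degrees above 2n/5 is bipartite (Andrásfai), and a bipartite
-- regular graph of positive degree has an even number of vertices; the proof makes this
-- quantitative. The obstacle is `k` just above 2n/5, where graphs close to a blow-up of the 5-cycle
-- compete with nearly bipartite ones and 5k - 2n may be as small as 2. As this 2 is forced for
-- every quintuple, it can be averaged, and the gap between 2n²/75 and n²/50 absorbs the errors of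
-- the blow-up.
--
-- In the nearly bipartite case the count of common neighbours is useless for an edge whose ends
-- both have large inner degree. Such edges are few because such vertices are few, and this needs a
-- large `n`: at first their number is only known to be at most 12512500, which has to be small
-- against 3e/10, and 3e/10 is at least 3 · 10⁷. The bound 10h/7 on the number of inner edges has
-- one purpose: their excess over `h`, at most about 3h/7, stays below h/2 and hence below `e`, so
-- that in the inequality for the degree squares the quadratic error terms cannot outweigh the main
-- ones.

open import Defs renaming (sym to adj-sym; irrefl to adj-irrefl)
open import Algebra.Properties.CommutativeSemigroup using (x∙yz≈y∙xz; interchange)
open import Data.Bool using (Bool; true; false; _∧_; _∨_; not; if_then_else_; T)
open import Data.Bool.Properties using (∧-comm; ∨-comm; ∨-identityʳ) renaming (_≟_ to _≟ᴮ_)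
open import Data.Empty using (⊥; ⊥-elim)
open import Data.Fin using (Fin; zero; suc; _≟_; _<?_; toℕ; _↑ˡ_; _↑ʳ_; splitAt)
open import Data.Fin.Properties using (<-cmp; any?; toℕ<n; splitAt-↑ˡ; splitAt-↑ʳ)
open import Data.List using (List; []; _∷_; map; allFin)
open import Data.List.Properties using (map-tabulate)
open import Data.Maybe using (Maybe; just; nothing)
open import Data.Nat using (ℕ; zero; suc; _+_; _*_; _∸_; _^_; _/_; _%_; _≤_; _<_; z≤n; s≤s; _≤ᵇ_; _<ᵇ_; _≡ᵇ_; NonZero; >-nonZero) renaming (_<?_ to _<ᴺ?_)
open import Data.Nat.DivMod using (m≡m%n+[m/n]*n; m*n/n≡m; m<n⇒m%n≡m; [m+n]%n≡m%n)
open import Data.Nat.ListAction using () renaming (sum to sumᴸ)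
open import Data.Nat.Properties hiding (_≟_; _<?_; <-cmp)
open import Data.Product using (Σ; ∃; _×_; _,_; proj₁; proj₂)
open import Data.Sum using (_⊎_; inj₁; inj₂; [_,_]′)
open import Data.Unit using (⊤; tt)
open import Data.Vec using (Vec; []; _∷_)
open import Function using (_∘_)
open import Relation.Binary using (tri<; tri≈; tri>)
open import Relation.Binary.PropositionalEquality
open import Relation.Nullary using (yes; no; ¬_)
open import Relation.Nullary.Decidable using (⌊_⌋)

-- Polynomial inequalities over ℕ

-- To derive a ≤ b from hypotheses lᵢ ≤ rᵢ it is enough to give multipliers qᵢ and N ≥ 1 such that
-- N a + Σ qᵢ rᵢ is coefficientwise at most N b + Σ qᵢ lᵢ; the comparison of coefficients is decided
-- by evaluation.

infixl 6 _⊕_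
infixl 7 _⊗_
infix 8 #_

data Expr : Set where
  #_  : ℕ → Expr
  con : ℕ → Expr
  _⊕_ _⊗_ : Expr → Expr → Expr

Env : Set
Env = List ℕ

_!_ : Env → ℕ → ℕ
[]      ! _     = 0
(x ∷ ρ) ! zero  = x
(x ∷ ρ) ! suc i = ρ ! i

⟦_⟧ : Expr → Env → ℕ
⟦ # i ⟧   ρ = ρ ! i
⟦ con c ⟧ ρ = c
⟦ a ⊕ b ⟧ ρ = ⟦ a ⟧ ρ + ⟦ b ⟧ ρ
⟦ a ⊗ b ⟧ ρ = ⟦ a ⟧ ρ * ⟦ b ⟧ ρ

Mono Poly : Set
Mono = List ℕ
Poly = List (Mono × ℕ)

evalM : Mono → Env → ℕ
evalM []      ρ = 1
evalM (i ∷ m) ρ = (ρ ! i) * evalM m ρ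

evalP : Poly → Env → ℕ
evalP []            ρ = 0
evalP ((m , c) ∷ p) ρ = c * evalM m ρ + evalP p ρ

_≡ᴹ_ : Mono → Mono → Bool
[]      ≡ᴹ []      = true
(i ∷ m) ≡ᴹ (j ∷ l) = (i ≡ᵇ j) ∧ (m ≡ᴹ l)
_       ≡ᴹ _       = false

≡ᴹ-sound : ∀ m l → (m ≡ᴹ l) ≡ true → m ≡ l
≡ᴹ-sound []      []      _ = refl
≡ᴹ-sound (i ∷ m) (j ∷ l) e with i ≡ᵇ j in eq
... | true = cong₂ _∷_ (≡ᵇ⇒≡ i j (subst T (sym eq) tt)) (≡ᴹ-sound m l e)

insertM : ℕ → Mono → Mono
insertM i []      = i ∷ []
insertM i (j ∷ m) = if i ≤ᵇ j then i ∷ j ∷ m else j ∷ insertM i m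

evalM-insert : ∀ ρ i m → evalM (insertM i m) ρ ≡ (ρ ! i) * evalM m ρ
evalM-insert ρ i []      = refl
evalM-insert ρ i (j ∷ m) with i ≤ᵇ j
... | true  = refl
... | false = trans (cong ((ρ ! j) *_) (evalM-insert ρ i m)) (x∙yz≈y∙xz *-commutativeSemigroup (ρ ! j) (ρ ! i) _)

mulM : Mono → Mono → Mono
mulM []      l = l
mulM (i ∷ m) l = insertM i (mulM m l)

evalM-mul : ∀ ρ m l → evalM (mulM m l) ρ ≡ evalM m ρ * evalM l ρ
evalM-mul ρ []      l = sym (*-identityˡ _)
evalM-mul ρ (i ∷ m) l =
  trans (evalM-insert ρ i (mulM m l))
        (trans (cong ((ρ ! i) *_) (evalM-mul ρ m l)) (sym (*-assoc (ρ ! i) _ _)))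

addT : Mono → ℕ → Poly → Poly
addT m c []            = (m , c) ∷ []
addT m c ((l , d) ∷ p) = if m ≡ᴹ l then (l , c + d) ∷ p else (l , d) ∷ addT m c p

evalP-addT : ∀ ρ m c p → evalP (addT m c p) ρ ≡ c * evalM m ρ + evalP p ρ
evalP-addT ρ m c []            = refl
evalP-addT ρ m c ((l , d) ∷ p) with m ≡ᴹ l in eq
... | true  rewrite ≡ᴹ-sound m l eq =
  trans (cong (_+ evalP p ρ) (*-distribʳ-+ (evalM l ρ) c d)) (+-assoc (c * evalM l ρ) _ _)
... | false =
  trans (cong (d * evalM l ρ +_) (evalP-addT ρ m c p)) (x∙yz≈y∙xz +-commutativeSemigroup (d * evalM l ρ) (c * evalM m ρ) _)

addP : Poly → Poly → Poly
addP []            q = q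
addP ((m , c) ∷ p) q = addT m c (addP p q)

evalP-add : ∀ ρ p q → evalP (addP p q) ρ ≡ evalP p ρ + evalP q ρ
evalP-add ρ []            q = refl
evalP-add ρ ((m , c) ∷ p) q =
  trans (evalP-addT ρ m c (addP p q))
        (trans (cong (c * evalM m ρ +_) (evalP-add ρ p q)) (sym (+-assoc (c * evalM m ρ) _ _)))

scale : Mono → ℕ → Poly → Poly
scale m c []            = []
scale m c ((l , d) ∷ p) = addT (mulM m l) (c * d) (scale m c p)

evalP-scale : ∀ ρ m c p → evalP (scale m c p) ρ ≡ c * evalM m ρ * evalP p ρ
evalP-scale ρ m c []            = sym (*-zeroʳ (c * evalM m ρ))
evalP-scale ρ m c ((l , d) ∷ p) =
  trans (evalP-addT ρ (mulM m l) (c * d) (scale m c p))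
        (trans (cong₂ _+_ (trans (cong (c * d *_) (evalM-mul ρ m l))
                                 ([m*n]*[o*p]≡[m*o]*[n*p] c d (evalM m ρ) (evalM l ρ)))
                          (evalP-scale ρ m c p))
               (sym (*-distribˡ-+ (c * evalM m ρ) (d * evalM l ρ) _)))

mulP : Poly → Poly → Poly
mulP []            q = []
mulP ((m , c) ∷ p) q = addP (scale m c q) (mulP p q)

evalP-mul : ∀ ρ p q → evalP (mulP p q) ρ ≡ evalP p ρ * evalP q ρ
evalP-mul ρ []            q = refl
evalP-mul ρ ((m , c) ∷ p) q =
  trans (evalP-add ρ (scale m c q) (mulP p q))
        (trans (cong₂ _+_ (evalP-scale ρ m c q) (evalP-mul ρ p q))
               (sym (*-distribʳ-+ (evalP q ρ) (c * evalM m ρ) _)))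

norm : Expr → Poly
norm (# i)         = (i ∷ [] , 1) ∷ []
norm (con zero)    = []
norm (con (suc c)) = ([] , suc c) ∷ []
norm (a ⊕ b)       = addP (norm a) (norm b)
norm (a ⊗ b)       = mulP (norm a) (norm b)

norm-sound : ∀ ρ a → evalP (norm a) ρ ≡ ⟦ a ⟧ ρ
norm-sound ρ (# i) = trans (+-identityʳ _) (trans (*-identityˡ _) (*-identityʳ _))
norm-sound ρ (con zero) = refl
norm-sound ρ (con (suc c)) = trans (+-identityʳ _) (*-identityʳ _)
norm-sound ρ (a ⊕ b) = trans (evalP-add ρ (norm a) (norm b)) (cong₂ _+_ (norm-sound ρ a) (norm-sound ρ b))
norm-sound ρ (a ⊗ b) = trans (evalP-mul ρ (norm a) (norm b)) (cong₂ _*_ (norm-sound ρ a) (norm-sound ρ b))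

take-out : Mono → ℕ → Poly → Maybe Poly
take-out m c [] = nothing
take-out m c ((l , d) ∷ p) with m ≡ᴹ l
... | true = if c ≤ᵇ d then just ((l , d ∸ c) ∷ p) else nothing
... | false with take-out m c p
...   | just p′ = just ((l , d) ∷ p′)
...   | nothing = nothing

take-out-sound : ∀ ρ m c p p′ → take-out m c p ≡ just p′ → evalP p ρ ≡ c * evalM m ρ + evalP p′ ρ
take-out-sound ρ m c ((l , d) ∷ p) p′ e with m ≡ᴹ l in eq
take-out-sound ρ m c ((l , d) ∷ p) p′ e | true with c ≤ᵇ d in le
take-out-sound ρ m c ((l , d) ∷ p) _ refl | true | true rewrite ≡ᴹ-sound m l eq =
  trans (cong (λ x → x * evalM l ρ + evalP p ρ) (sym (m+[n∸m]≡n (≤ᵇ⇒≤ c d (subst T (sym le) tt)))))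
        (trans (cong (_+ evalP p ρ) (*-distribʳ-+ (evalM l ρ) c (d ∸ c))) (+-assoc (c * evalM l ρ) _ _))
take-out-sound ρ m c ((l , d) ∷ p) p′ e | false with take-out m c p in eq′
take-out-sound ρ m c ((l , d) ∷ p) _ refl | false | just p″ =
  trans (cong (d * evalM l ρ +_) (take-out-sound ρ m c p p″ eq′)) (x∙yz≈y∙xz +-commutativeSemigroup (d * evalM l ρ) (c * evalM m ρ) _)

_≤ᴾ_ : Poly → Poly → Bool
[]            ≤ᴾ q = true
((m , c) ∷ p) ≤ᴾ q with take-out m c q
... | just q′ = p ≤ᴾ q′
... | nothing = false

≤ᴾ-sound : ∀ ρ p q → T (p ≤ᴾ q) → evalP p ρ ≤ evalP q ρ
≤ᴾ-sound ρ []            q _ = z≤n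
≤ᴾ-sound ρ ((m , c) ∷ p) q t with take-out m c q in eq
... | just q′ rewrite take-out-sound ρ m c q q′ eq = +-monoʳ-≤ (c * evalM m ρ) (≤ᴾ-sound ρ p q′ t)

infix 5 _·_≼_

record Scaled : Set where
  constructor _·_≼_
  field
    multiplier lower upper : Expr

Holds : Env → List Scaled → Set
Holds ρ []               = ⊤
Holds ρ ((q · l ≼ r) ∷ hs) = (⟦ l ⟧ ρ ≤ ⟦ r ⟧ ρ) × Holds ρ hs

lowers uppers : List Scaled → Expr
lowers []               = con 0
lowers ((q · l ≼ r) ∷ hs) = q ⊗ l ⊕ lowers hs
uppers []               = con 0
uppers ((q · l ≼ r) ∷ hs) = q ⊗ r ⊕ uppers hs

lowers≤uppers : ∀ ρ hs → Holds ρ hs → ⟦ lowers hs ⟧ ρ ≤ ⟦ uppers hs ⟧ ρ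
lowers≤uppers ρ []               _        = z≤n
lowers≤uppers ρ ((q · l ≼ r) ∷ hs) (p , ps) = +-mono-≤ (*-monoʳ-≤ (⟦ q ⟧ ρ) p) (lowers≤uppers ρ hs ps)

Certifies : List Scaled → ℕ → Expr → Expr → Bool
Certifies hs N a b = norm (con (suc N) ⊗ a ⊕ uppers hs) ≤ᴾ norm (con (suc N) ⊗ b ⊕ lowers hs)

opaque
  -- The second argument is N - 1.
  certify : ∀ ρ N a b hs → {T (Certifies hs N a b)} → Holds ρ hs → ⟦ a ⟧ ρ ≤ ⟦ b ⟧ ρ
  certify ρ N a b hs {t} ps = *-cancelˡ-≤ (suc N) (+-cancelʳ-≤ (⟦ lowers hs ⟧ ρ) _ _ (begin
    suc N * ⟦ a ⟧ ρ + ⟦ lowers hs ⟧ ρ  ≤⟨ +-monoʳ-≤ (suc N * ⟦ a ⟧ ρ) (lowers≤uppers ρ hs ps) ⟩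
    suc N * ⟦ a ⟧ ρ + ⟦ uppers hs ⟧ ρ  ≡⟨ norm-sound ρ (con (suc N) ⊗ a ⊕ uppers hs) ⟨
    evalP (norm (con (suc N) ⊗ a ⊕ uppers hs)) ρ ≤⟨ ≤ᴾ-sound ρ (norm (con (suc N) ⊗ a ⊕ uppers hs)) (norm (con (suc N) ⊗ b ⊕ lowers hs)) t ⟩
    evalP (norm (con (suc N) ⊗ b ⊕ lowers hs)) ρ ≡⟨ norm-sound ρ (con (suc N) ⊗ b ⊕ lowers hs) ⟩
    suc N * ⟦ b ⟧ ρ + ⟦ lowers hs ⟧ ρ  ∎))
    where open ≤-Reasoning

-- Finite sums and 0/1-valued functions

𝟙 : Bool → ℕ
𝟙 b = if b then 1 else 0

opaque
  ∑ : ∀ {n} → (Fin n → ℕ) → ℕ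
  ∑ {n} f = sumᴸ (map f (allFin n))

  ∑-nil : ∀ (f : Fin 0 → ℕ) → ∑ f ≡ 0
  ∑-nil f = refl

  ∑-suc : ∀ {n} (f : Fin (suc n) → ℕ) → ∑ f ≡ f zero + ∑ (f ∘ suc)
  ∑-suc {n} f = cong (λ xs → f zero + sumᴸ xs)
    (trans (map-tabulate suc f) (sym (map-tabulate (λ i → i) (f ∘ suc))))

  count≡∑ : ∀ {n} (p : Fin n → Bool) → count p ≡ ∑ (𝟙 ∘ p)
  count≡∑ p = refl

  triangles≡∑ : ∀ {n} (G : Graph n) → triangles G ≡
    ∑ (λ i → ∑ (λ j → ∑ (λ l → 𝟙 (⌊ i <? j ⌋ ∧ ⌊ j <? l ⌋ ∧ adj G i j ∧ adj G j l ∧ adj G i l))))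
  triangles≡∑ G = refl

∑-cong : ∀ {n} {f g : Fin n → ℕ} → (∀ i → f i ≡ g i) → ∑ f ≡ ∑ g
∑-cong {zero}  {f} {g} e = trans (∑-nil f) (sym (∑-nil g))
∑-cong {suc n} {f} {g} e = trans (∑-suc f) (trans (cong₂ _+_ (e zero) (∑-cong (e ∘ suc))) (sym (∑-suc g)))

∑-mono : ∀ {n} {f g : Fin n → ℕ} → (∀ i → f i ≤ g i) → ∑ f ≤ ∑ g
∑-mono {zero}  {f} {g} e = ≤-reflexive (trans (∑-nil f) (sym (∑-nil g)))
∑-mono {suc n} {f} {g} e rewrite ∑-suc f | ∑-suc g = +-mono-≤ (e zero) (∑-mono (e ∘ suc))

∑-+ : ∀ {n} (f g : Fin n → ℕ) → ∑ (λ i → f i + g i) ≡ ∑ f + ∑ g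
∑-+ {zero}  f g rewrite ∑-nil f | ∑-nil g = ∑-nil _
∑-+ {suc n} f g rewrite ∑-suc f | ∑-suc g | ∑-suc (λ i → f i + g i) | ∑-+ (f ∘ suc) (g ∘ suc) =
  interchange +-commutativeSemigroup (f zero) (g zero) _ _

∑-0 : ∀ n → ∑ {n} (λ _ → 0) ≡ 0
∑-0 zero    = ∑-nil _
∑-0 (suc n) = trans (∑-suc {n} (λ _ → 0)) (∑-0 n)

∑-*ˡ : ∀ {n} c (f : Fin n → ℕ) → ∑ (λ i → c * f i) ≡ c * ∑ f
∑-*ˡ {zero}  c f rewrite ∑-nil f = trans (∑-nil _) (sym (*-zeroʳ c))
∑-*ˡ {suc n} c f rewrite ∑-suc f | ∑-suc (λ i → c * f i) | ∑-*ˡ c (f ∘ suc) = sym (*-distribˡ-+ c (f zero) _)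

∑-*ʳ : ∀ {n} c (f : Fin n → ℕ) → ∑ (λ i → f i * c) ≡ ∑ f * c
∑-*ʳ c f = trans (∑-cong (λ i → *-comm (f i) c)) (trans (∑-*ˡ c f) (*-comm c _))

∑-const : ∀ n c → ∑ {n} (λ _ → c) ≡ n * c
∑-const zero    c = ∑-nil _
∑-const (suc n) c = trans (∑-suc {n} (λ _ → c)) (cong (c +_) (∑-const n c))

∑-swap : ∀ {m n} (f : Fin m → Fin n → ℕ) → ∑ (λ i → ∑ (f i)) ≡ ∑ (λ j → ∑ (λ i → f i j))
∑-swap {zero}  {n} f = trans (∑-nil _) (sym (trans (∑-cong (λ j → ∑-nil (λ i → f i j))) (∑-0 n)))
∑-swap {suc m} {n} f rewrite ∑-suc (λ i → ∑ (f i)) | ∑-swap (f ∘ suc) =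
  trans (sym (∑-+ (f zero) _)) (∑-cong (λ j → sym (∑-suc (λ i → f i j))))

term≤∑ : ∀ {n} (f : Fin n → ℕ) i → f i ≤ ∑ f
term≤∑ {suc n} f zero    rewrite ∑-suc f = m≤m+n _ _
term≤∑ {suc n} f (suc i) rewrite ∑-suc f = ≤-trans (term≤∑ (f ∘ suc) i) (m≤n+m _ _)

∑≡0 : ∀ {n} (f : Fin n → ℕ) → ∑ f ≡ 0 → ∀ i → f i ≡ 0
∑≡0 f e i = n≤0⇒n≡0 (≤-trans (term≤∑ f i) (≤-reflexive e))

∑-single : ∀ {n} v (f : Fin n → ℕ) → ∑ (λ i → 𝟙 ⌊ i ≟ v ⌋ * f i) ≡ f v
∑-single {suc n} zero    f rewrite ∑-suc (λ i → 𝟙 ⌊ i ≟ zero ⌋ * f i) | ∑-0 n =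
  trans (+-identityʳ _) (+-identityʳ _)
∑-single {suc n} (suc v) f rewrite ∑-suc (λ i → 𝟙 ⌊ i ≟ suc v ⌋ * f i) =
  trans (∑-cong same) (∑-single v (f ∘ suc))
  where
  same : ∀ i → 𝟙 ⌊ suc i ≟ suc v ⌋ * f (suc i) ≡ 𝟙 ⌊ i ≟ v ⌋ * f (suc i)
  same i with i ≟ v
  ... | yes _ = refl
  ... | no  _ = refl

-- Turns equality in a summed estimate into equality in every term; the structure of the extremal
-- graphs is extracted this way.
∑-tight : ∀ {n} (f g : Fin n → ℕ) → (∀ i → g i ≤ f i) → ∑ f ≤ ∑ g → ∀ i → f i ≡ g i
∑-tight {suc n} f g g≤f f≤g rewrite ∑-suc f | ∑-suc g = λ where
    zero    → ≤-antisym (+-cancelʳ-≤ (∑ (f ∘ suc)) (f zero) (g zero)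
                (≤-trans f≤g (+-monoʳ-≤ (g zero) (∑-mono (g≤f ∘ suc))))) (g≤f zero)
    (suc i) → ∑-tight (f ∘ suc) (g ∘ suc) (g≤f ∘ suc)
                (+-cancelˡ-≤ (f zero) _ _ (≤-trans f≤g (+-monoˡ-≤ _ (g≤f zero)))) i

∑∑-mono : ∀ {m n} {f g : Fin m → Fin n → ℕ} → (∀ i j → f i j ≤ g i j) → ∑ (λ i → ∑ (f i)) ≤ ∑ (λ i → ∑ (g i))
∑∑-mono e = ∑-mono (λ i → ∑-mono (e i))

∑∑-cong : ∀ {m n} {f g : Fin m → Fin n → ℕ} → (∀ i j → f i j ≡ g i j) → ∑ (λ i → ∑ (f i)) ≡ ∑ (λ i → ∑ (g i))
∑∑-cong e = ∑-cong (λ i → ∑-cong (e i))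

∑∑-+ : ∀ {m n} (f g : Fin m → Fin n → ℕ) →
       ∑ (λ i → ∑ (λ j → f i j + g i j)) ≡ ∑ (λ i → ∑ (f i)) + ∑ (λ i → ∑ (g i))
∑∑-+ f g = trans (∑-cong (λ i → ∑-+ (f i) (g i))) (∑-+ (λ i → ∑ (f i)) _)

-- Inequalities between functions of Booleans, decided by evaluating all cases

allB : ∀ m → (Vec Bool m → Bool) → Bool
allB zero    f = f []
allB (suc m) f = allB m (λ v → f (true ∷ v)) ∧ allB m (λ v → f (false ∷ v))

T-∧ : ∀ {a b} → T (a ∧ b) → T a × T b
T-∧ {true} t = tt , t

allB-sound : ∀ m f → T (allB m f) → ∀ v → T (f v)
allB-sound zero    f t []          = t
allB-sound (suc m) f t (true ∷ v)  = allB-sound m _ (proj₁ (T-∧ t)) v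
allB-sound (suc m) f t (false ∷ v) = allB-sound m _ (proj₂ (T-∧ {allB m (λ v → f (true ∷ v))} t)) v

bool-≤ : ∀ m (f g : Vec Bool m → ℕ) → {T (allB m (λ v → f v ≤ᵇ g v))} → ∀ v → f v ≤ g v
bool-≤ m f g {t} v = ≤ᵇ⇒≤ _ _ (allB-sound m _ t v)

bool-≡ : ∀ m (f g : Vec Bool m → ℕ) → {T (allB m (λ v → f v ≡ᵇ g v))} → ∀ v → f v ≡ g v
bool-≡ m f g {t} v = ≡ᵇ⇒≡ _ _ (allB-sound m _ t v)

𝟙-∧ : ∀ b c → 𝟙 (b ∧ c) ≡ 𝟙 b * 𝟙 c
𝟙-∧ true  true  = refl
𝟙-∧ true  false = refl
𝟙-∧ false _     = refl

𝟙≡1 : ∀ b → 𝟙 b ≡ 1 → b ≡ true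
𝟙≡1 true _ = refl

𝟙≤1 : ∀ b → 𝟙 b ≤ 1
𝟙≤1 true  = s≤s z≤n
𝟙≤1 false = z≤n

𝟙-*≤ : ∀ b {x y} → (b ≡ true → x ≤ y) → 𝟙 b * x ≤ 𝟙 b * y
𝟙-*≤ true  p = *-monoʳ-≤ 1 (p refl)
𝟙-*≤ false _ = z≤n

𝟙-*≤′ : ∀ b {x y} → (b ≡ true → x ≤ y) → 𝟙 b * x ≤ y
𝟙-*≤′ true {x} p = ≤-trans (≤-reflexive (*-identityˡ x)) (p refl)
𝟙-*≤′ false _ = z≤n

∑𝟙+∑𝟙not : ∀ {n} (p : Fin n → Bool) → ∑ (𝟙 ∘ p) + ∑ (𝟙 ∘ not ∘ p) ≡ n
∑𝟙+∑𝟙not {n} p = trans (sym (∑-+ (𝟙 ∘ p) (𝟙 ∘ not ∘ p)))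
  (trans (∑-cong (λ i → bool-≡ 1 (λ { (b ∷ []) → 𝟙 b + 𝟙 (not b) }) (λ _ → 1) (p i ∷ [])))
         (trans (∑-const n 1) (*-identityʳ n)))

∑𝟙-positive : ∀ {n} (p : Fin n → Bool) → 1 ≤ ∑ (𝟙 ∘ p) → ∃ λ i → p i ≡ true
∑𝟙-positive {zero}  p le with subst (1 ≤_) (∑-nil (𝟙 ∘ p)) le
... | ()
∑𝟙-positive {suc n} p le with p zero in eq | subst (1 ≤_) (∑-suc (𝟙 ∘ p)) le
... | true  | _   = zero , eq
... | false | le′ with ∑𝟙-positive (p ∘ suc) le′
...   | i , e = suc i , e

-- ∑-pick expresses that pick is injective.
record Selection {n} (p : Fin n → Bool) (m : ℕ) : Set where
  field
    pick     : Fin m → Fin n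
    pick-∈   : ∀ x → p (pick x) ≡ true
    ∑-pick   : ∀ (f : Fin n → ℕ) → ∑ (f ∘ pick) ≤ ∑ (λ i → 𝟙 (p i) * f i)

select : ∀ {n} (p : Fin n → Bool) m → m ≤ ∑ (𝟙 ∘ p) → Selection p m
select {n} p zero le = record { pick = λ () ; pick-∈ = λ () ; ∑-pick = λ f → ≤-trans (≤-reflexive (∑-nil _)) z≤n }
select {zero}  p (suc m) le with subst (suc m ≤_) (∑-nil (𝟙 ∘ p)) le
... | ()
select {suc n} p (suc m) le with p zero in eq | subst (suc m ≤_) (∑-suc (𝟙 ∘ p)) le
... | true | s≤s le′ = record { pick = pick′ ; pick-∈ = mem ; ∑-pick = bound }
  where
  open Selection (select (p ∘ suc) m le′)
  pick′ : Fin (suc m) → Fin (suc n)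
  pick′ zero    = zero
  pick′ (suc x) = suc (pick x)
  mem : ∀ x → p (pick′ x) ≡ true
  mem zero    = eq
  mem (suc x) = pick-∈ x
  bound : ∀ f → ∑ (f ∘ pick′) ≤ ∑ (λ i → 𝟙 (p i) * f i)
  bound f rewrite ∑-suc (f ∘ pick′) | ∑-suc (λ i → 𝟙 (p i) * f i) | eq =
    +-mono-≤ (≤-reflexive (sym (+-identityʳ _))) (∑-pick (f ∘ suc))
... | false | le′ = record { pick = suc ∘ pick ; pick-∈ = pick-∈ ; ∑-pick = bound }
  where
  open Selection (select (p ∘ suc) (suc m) le′)
  bound : ∀ f → ∑ (f ∘ suc ∘ pick) ≤ ∑ (λ i → 𝟙 (p i) * f i)
  bound f rewrite ∑-suc (λ i → 𝟙 (p i) * f i) | eq = ∑-pick (f ∘ suc)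

-- Counting triangles by ordered triples

lt : ∀ {n} → Fin n → Fin n → Bool
lt i j = ⌊ i <? j ⌋

lt-swap : ∀ {n} (i j : Fin n) → ¬ (i ≡ j) → lt j i ≡ not (lt i j)
lt-swap i j i≢j with <-cmp i j | i <? j | j <? i
... | tri< p _ q | yes _ | yes r = ⊥-elim (q r)
... | tri< p _ q | yes _ | no _  = refl
... | tri< p _ q | no r  | _     = ⊥-elim (r p)
... | tri≈ _ e _ | _     | _     = ⊥-elim (i≢j e)
... | tri> q _ p | yes r | _     = ⊥-elim (q r)
... | tri> q _ p | no _  | yes _ = refl
... | tri> q _ p | no _  | no r  = ⊥-elim (r p)

lt-trans : ∀ {n} (i j l : Fin n) → lt i j ≡ true → lt j l ≡ true → lt i l ≡ true
lt-trans i j l p q with i <? j | j <? l | i <? l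
... | yes a | yes b | yes _ = refl
... | yes a | yes b | no c  = ⊥-elim (c (<-trans a b))

absurd : ∀ {A : Set} → false ≡ true → A
absurd ()

-- The comparisons of the three pairs give eight rows. Two of them are cyclic and contradict
-- transitivity; in each of the other six exactly one summand is 1.
six-orders : ∀ {n} (i j l : Fin n) → ¬ (i ≡ j) → ¬ (j ≡ l) → ¬ (i ≡ l) →
  𝟙 (lt i j ∧ lt j l) + 𝟙 (lt i l ∧ lt l j) + 𝟙 (lt j i ∧ lt i l)
  + 𝟙 (lt j l ∧ lt l i) + 𝟙 (lt l i ∧ lt i j) + 𝟙 (lt l j ∧ lt j i) ≡ 1
six-orders i j l ij jl il
  with lt i j | lt j l | lt i l | lt j i | lt l j | lt l i
     | lt-swap i j ij | lt-swap j l jl | lt-swap i l il | lt-trans i j l | lt-trans l j i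
... | true  | true  | true  | _ | _ | _ | refl | refl | refl | _ | _ = refl
... | true  | true  | false | _ | _ | _ | refl | refl | refl | t | _ = absurd (t refl refl)
... | true  | false | true  | _ | _ | _ | refl | refl | refl | _ | _ = refl
... | true  | false | false | _ | _ | _ | refl | refl | refl | _ | _ = refl
... | false | true  | true  | _ | _ | _ | refl | refl | refl | _ | _ = refl
... | false | true  | false | _ | _ | _ | refl | refl | refl | _ | _ = refl
... | false | false | true  | _ | _ | _ | refl | refl | refl | _ | t = absurd (t refl refl)
... | false | false | false | _ | _ | _ | refl | refl | refl | _ | _ = refl

∑³ : ∀ {n} → (Fin n → Fin n → Fin n → ℕ) → ℕ
∑³ f = ∑ (λ i → ∑ (λ j → ∑ (λ l → f i j l)))

∑³-cong : ∀ {n} {f g : Fin n → Fin n → Fin n → ℕ} → (∀ i j l → f i j l ≡ g i j l) → ∑³ f ≡ ∑³ g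
∑³-cong e = ∑-cong (λ i → ∑∑-cong (e i))

∑³-mono : ∀ {n} {f g : Fin n → Fin n → Fin n → ℕ} → (∀ i j l → f i j l ≤ g i j l) → ∑³ f ≤ ∑³ g
∑³-mono e = ∑-mono (λ i → ∑∑-mono (e i))

∑³-+ : ∀ {n} (f g : Fin n → Fin n → Fin n → ℕ) → ∑³ (λ i j l → f i j l + g i j l) ≡ ∑³ f + ∑³ g
∑³-+ f g = trans (∑-cong (λ i → ∑∑-+ (f i) (g i))) (∑-+ _ _)

∑³-swap₁₂ : ∀ {n} (f : Fin n → Fin n → Fin n → ℕ) → ∑³ (λ i j l → f j i l) ≡ ∑³ f
∑³-swap₁₂ f = ∑-swap (λ i j → ∑ (f j i))

∑³-swap₂₃ : ∀ {n} (f : Fin n → Fin n → Fin n → ℕ) → ∑³ (λ i j l → f i l j) ≡ ∑³ f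
∑³-swap₂₃ f = ∑-cong (λ i → ∑-swap (λ j l → f i l j))

module Triangles {n} (G : Graph n) where

  a : Fin n → Fin n → ℕ
  a i j = 𝟙 (adj G i j)

  a-sym : ∀ i j → a i j ≡ a j i
  a-sym i j = cong 𝟙 (adj-sym G i j)

  a-irrefl : ∀ i → a i i ≡ 0
  a-irrefl i = cong 𝟙 (adj-irrefl G i)

  codeg : Fin n → Fin n → ℕ
  codeg i j = ∑ (λ l → a i l * a j l)

  codeg-sym : ∀ i j → codeg i j ≡ codeg j i
  codeg-sym i j = ∑-cong (λ l → *-comm (a i l) (a j l))

  codeg≤degree : ∀ i j → codeg i j ≤ ∑ (a i)
  codeg≤degree i j = ∑-mono (λ l → ≤-trans (*-monoʳ-≤ (a i l) (𝟙≤1 (adj G j l))) (≤-reflexive (*-identityʳ (a i l))))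

  tri : Fin n → Fin n → Fin n → ℕ
  tri i j l = a i j * (a i l * a j l)

  tri-swap₁₂ : ∀ i j l → tri i j l ≡ tri j i l
  tri-swap₁₂ i j l = cong₂ _*_ (a-sym i j) (*-comm (a i l) (a j l))

  tri-swap₂₃ : ∀ i j l → tri i j l ≡ tri i l j
  tri-swap₂₃ i j l rewrite a-sym l j =
    bool-≡ 3 (λ { (x ∷ y ∷ z ∷ []) → 𝟙 x * (𝟙 y * 𝟙 z) }) (λ { (x ∷ y ∷ z ∷ []) → 𝟙 y * (𝟙 x * 𝟙 z) })
      (adj G i j ∷ adj G i l ∷ adj G j l ∷ [])

  ∑tri≡∑codeg : ∑³ tri ≡ ∑ (λ i → ∑ (λ j → a i j * codeg i j))
  ∑tri≡∑codeg = ∑∑-cong (λ i j → ∑-*ˡ (a i j) (λ l → a i l * a j l))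

  private
    o F : Fin n → Fin n → Fin n → ℕ
    o i j l = 𝟙 (lt i j ∧ lt j l)
    F i j l = o i j l * tri i j l

    triangles≡∑F : triangles G ≡ ∑³ F
    triangles≡∑F = trans (triangles≡∑ G) (∑³-cong (λ i j l →
      bool-≡ 5 (λ { (x ∷ y ∷ u ∷ v ∷ w ∷ []) → 𝟙 (x ∧ y ∧ u ∧ v ∧ w) })
               (λ { (x ∷ y ∷ u ∷ v ∷ w ∷ []) → 𝟙 (x ∧ y) * (𝟙 u * (𝟙 w * 𝟙 v)) })
        (lt i j ∷ lt j l ∷ adj G i j ∷ adj G j l ∷ adj G i l ∷ [])))

    scale-out : ∀ x₁ x₂ x₃ x₄ x₅ x₆ c →
      x₁ * c + x₂ * c + x₃ * c + x₄ * c + x₅ * c + x₆ * c ≡ (x₁ + x₂ + x₃ + x₄ + x₅ + x₆) * c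
    scale-out x₁ x₂ x₃ x₄ x₅ x₆ c
      rewrite *-distribʳ-+ c (x₁ + x₂ + x₃ + x₄ + x₅) x₆ | *-distribʳ-+ c (x₁ + x₂ + x₃ + x₄) x₅
            | *-distribʳ-+ c (x₁ + x₂ + x₃) x₄ | *-distribʳ-+ c (x₁ + x₂) x₃ | *-distribʳ-+ c x₁ x₂ = refl

    -- For triples with a repetition no order is strict, but `tri` vanishes there because the graph
    -- has no loops.
    orders*tri : ∀ i j l → (o i j l + o i l j + o j i l + o j l i + o l i j + o l j i) * tri i j l ≡ tri i j l
    orders*tri i j l with i ≟ j
    ... | yes refl rewrite a-irrefl i = *-zeroʳ (o i i l + o i l i + o i i l + o i l i + o l i i + o l i i)
    ... | no ij with j ≟ l
    ...   | yes refl rewrite a-irrefl j | *-zeroʳ (a i j) | *-zeroʳ (a i j) = *-zeroʳ (o i j j + o i j j + o j i j + o j j i + o j i j + o j j i)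
    ...   | no jl with i ≟ l
    ...     | yes refl rewrite a-irrefl i | *-zeroʳ (a i j) = *-zeroʳ (o i j i + o i i j + o j i i + o j i i + o i i j + o i j i)
    ...     | no il rewrite six-orders i j l ij jl il = *-identityˡ _

    tri-split : ∀ i j l → F i j l + F i l j + F j i l + F j l i + F l i j + F l j i ≡ tri i j l
    tri-split i j l
      rewrite sym (tri-swap₂₃ i j l) | sym (tri-swap₁₂ i j l)
            | trans (tri-swap₂₃ j l i) (sym (tri-swap₁₂ i j l))
            | trans (tri-swap₁₂ l i j) (sym (tri-swap₂₃ i j l))
            | trans (tri-swap₁₂ l j i) (trans (tri-swap₂₃ j l i) (sym (tri-swap₁₂ i j l)))
      = trans (scale-out (o i j l) (o i l j) (o j i l) (o j l i) (o l i j) (o l j i) (tri i j l)) (orders*tri i j l)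

    F₁ F₂ F₃ F₄ F₅ : Fin n → Fin n → Fin n → ℕ
    F₁ i j l = F i l j
    F₂ i j l = F j i l
    F₃ i j l = F j l i
    F₄ i j l = F l i j
    F₅ i j l = F l j i

  ∑tri≡6*triangles : ∑³ tri ≡ 6 * triangles G
  ∑tri≡6*triangles = begin
    ∑³ tri
      ≡⟨ ∑³-cong (λ i j l → sym (tri-split i j l)) ⟩
    ∑³ (λ i j l → F i j l + F₁ i j l + F₂ i j l + F₃ i j l + F₄ i j l + F₅ i j l)
      ≡⟨ trans (∑³-+ _ F₅) (cong (_+ ∑³ F₅) (trans (∑³-+ _ F₄) (cong (_+ ∑³ F₄)
           (trans (∑³-+ _ F₃) (cong (_+ ∑³ F₃) (trans (∑³-+ _ F₂) (cong (_+ ∑³ F₂) (∑³-+ F F₁)))))))) ⟩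
    ∑³ F + ∑³ F₁ + ∑³ F₂ + ∑³ F₃ + ∑³ F₄ + ∑³ F₅
      ≡⟨ cong₂ _+_ (cong₂ _+_ (cong₂ _+_ (cong₂ _+_ (cong (∑³ F +_) e₁) e₂) e₃) e₄) e₅ ⟩
    ∑³ F + ∑³ F + ∑³ F + ∑³ F + ∑³ F + ∑³ F
      ≡⟨ six (∑³ F) ⟩
    6 * ∑³ F
      ≡⟨ cong (6 *_) (sym triangles≡∑F) ⟩
    6 * triangles G ∎
    where
    open ≡-Reasoning
    e₁ : ∑³ F₁ ≡ ∑³ F
    e₁ = ∑³-swap₂₃ F
    e₂ : ∑³ F₂ ≡ ∑³ F
    e₂ = ∑³-swap₁₂ F
    e₃ : ∑³ F₃ ≡ ∑³ F
    e₃ = trans (∑³-swap₁₂ F₁) e₁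
    e₄ : ∑³ F₄ ≡ ∑³ F
    e₄ = trans (∑³-swap₂₃ F₂) e₂
    e₅ : ∑³ F₅ ≡ ∑³ F
    e₅ = trans (∑³-swap₂₃ F₃) e₃
    six : ∀ x → x + x + x + x + x + x ≡ 6 * x
    six x = ≤-antisym
      (certify (x ∷ []) 0 (# 0 ⊕ # 0 ⊕ # 0 ⊕ # 0 ⊕ # 0 ⊕ # 0) (con 6 ⊗ # 0) [] tt)
      (certify (x ∷ []) 0 (con 6 ⊗ # 0) (# 0 ⊕ # 0 ⊕ # 0 ⊕ # 0 ⊕ # 0 ⊕ # 0) [] tt)

-- Parameters, light edges and good edges.

1≰0 : 1 ≤ 0 → ⊥
1≰0 ()

≤ᵇ-true : ∀ {x y} → (x ≤ᵇ y) ≡ true → x ≤ y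
≤ᵇ-true {x} {y} e = ≤ᵇ⇒≤ x y (subst T (sym e) tt)

≤ᵇ-false : ∀ {x y} → not (x ≤ᵇ y) ≡ true → y ≤ x
≤ᵇ-false {x} {y} e with x ≤ᵇ y in eq
... | false = <⇒≤ (≰⇒> λ p → subst T eq (≤⇒≤ᵇ p))

∧-true : ∀ {b c} → b ∧ c ≡ true → b ≡ true × c ≡ true
∧-true {true} {true} _ = refl , refl

not-true : ∀ {b} → not b ≡ true → b ≡ false
not-true {false} _ = refl

-- n = 2q + 1 and k = 2h; the extremal number of triangles is then h e.
record Range (n k q h e : ℕ) : Set where
  field
    n≡   : n ≡ 1 + 2 * q
    k≡   : k ≡ 2 * h
    e≡   : 3 * h ≡ q + 1 + e
    2h≤q : 2 * h ≤ q
    -- Parity sharpens 2n < 5k to this form, which says 5k - 2n ≥ 2.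
    2q<5h : 2 * q + 2 ≤ 5 * h
    large : 1000000000 ≤ n

-- Both factors are at most n/4: `h` because `2h ≤ q`, and `e = 3h - q - 1` because it is then less
-- than `h`. Hence `6he` is at most 3n²/8, and 375 is 3/8 of 1000.
he-bound : ∀ n q h e → n ≡ 1 + 2 * q → 3 * h ≡ q + 1 + e → 2 * h ≤ q →
  6 * (h * e) * 1000 ≤ n * 375 * n
he-bound n q h e p₁ p₂ p₃ =
  certify (n ∷ q ∷ h ∷ e ∷ []) 0
  (con 6 ⊗ (# 2 ⊗ # 3) ⊗ con 1000) (# 0 ⊗ con 375 ⊗ # 0)
   ((con 375 ⊗ # 0 ⊕ con 1500 ⊗ # 3 · con 1 ⊕ con 2 ⊗ # 1 ≼ # 0)
  ∷ (con 1500 ⊗ # 0 · # 1 ⊕ con 1 ⊕ # 3 ≼ con 3 ⊗ # 2)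
  ∷ (con 2250 ⊗ # 0 ⊕ con 3000 ⊗ # 3 · con 2 ⊗ # 2 ≼ # 1) ∷ [])
  (≤-reflexive (sym p₁) , ≤-reflexive (sym p₂) , p₃ , tt)
few-exceptional : ∀ H n → H ≤ n * 375 → H * 1000 ≤ 375000 * n
few-exceptional H n p₁ =
  certify (H ∷ n ∷ []) 0
  (# 0 ⊗ con 1000) (con 375000 ⊗ # 1)
   ((con 1000 · # 0 ≼ # 1 ⊗ con 375) ∷ [])
  (p₁ , tt)

n-nonZero : ∀ {n} → 1000000000 ≤ n → NonZero n
n-nonZero p = >-nonZero (≤-trans (s≤s z≤n) p)

module Good {n k q h e} (G : Graph n) (rg : Range n k q h e) (reg : ∀ i → ∑ (Triangles.a G i) ≡ k)
            (few : ∑³ (Triangles.tri G) ≤ 6 * (h * e)) where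
  open Triangles G
  open Range rg

  light heavy : Fin n → Fin n → Bool
  light u v = codeg u v * 1000 ≤ᵇ n
  heavy u v = adj G u v ∧ not (light u v)

  heavy-degree : Fin n → ℕ
  heavy-degree u = ∑ (λ v → 𝟙 (heavy u v))

  exceptional : Fin n → Bool
  exceptional u = not (heavy-degree u * 1000 ≤ᵇ n)

  good : Fin n → Fin n → Bool
  good u v = adj G u v ∧ light u v ∧ not (exceptional u) ∧ not (exceptional v)

  good-degree : Fin n → ℕ
  good-degree u = ∑ (λ v → 𝟙 (good u v))

  light-sym : ∀ u v → light u v ≡ light v u
  light-sym u v = cong (λ x → x * 1000 ≤ᵇ n) (codeg-sym u v)

  good-sym : ∀ u v → good u v ≡ good v u
  good-sym u v = cong₂ _∧_ (adj-sym G u v) (cong₂ _∧_ (light-sym u v) (∧-comm (not (exceptional u)) (not (exceptional v))))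

  good-adj : ∀ {u v} → good u v ≡ true → adj G u v ≡ true
  good-adj p = proj₁ (∧-true p)

  good-light : ∀ {u v} → good u v ≡ true → codeg u v * 1000 ≤ n
  good-light {u} {v} p = ≤ᵇ-true (proj₁ (∧-true {light u v} (proj₂ (∧-true {adj G u v} p))))

  good-left : ∀ {u v} → good u v ≡ true → exceptional u ≡ false
  good-left {u} {v} p = not-true (proj₁ (∧-true {not (exceptional u)} (proj₂ (∧-true {light u v} (proj₂ (∧-true {adj G u v} p))))))

  unexceptional : ∀ {u} → exceptional u ≡ false → heavy-degree u * 1000 ≤ n
  unexceptional {u} p with heavy-degree u * 1000 ≤ᵇ n in eq
  ... | true = ≤ᵇ-true eq

  -- Every heavy ordered pair carries at least n/1000 ordered triangles, and there are at most `6he`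
  -- of these.
  heavies : ∑ heavy-degree ≤ n * 375
  heavies = *-cancelʳ-≤ _ _ n {{n-nonZero large}} (begin
    ∑ heavy-degree * n
      ≡⟨ ∑-*ʳ n heavy-degree ⟨
    ∑ (λ u → heavy-degree u * n)
      ≡⟨ ∑-cong (λ u → ∑-*ʳ n (λ v → 𝟙 (heavy u v))) ⟨
    ∑ (λ u → ∑ (λ v → 𝟙 (heavy u v) * n))
      ≤⟨ ∑∑-mono bound ⟩
    ∑ (λ u → ∑ (λ v → (a u v * codeg u v) * 1000))
      ≡⟨ trans (∑-cong (λ u → ∑-*ʳ 1000 (λ v → a u v * codeg u v))) (∑-*ʳ 1000 (λ u → ∑ (λ v → a u v * codeg u v))) ⟩
    ∑ (λ u → ∑ (λ v → a u v * codeg u v)) * 1000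
      ≡⟨ cong (_* 1000) ∑tri≡∑codeg ⟨
    ∑³ tri * 1000
      ≤⟨ *-monoˡ-≤ 1000 few ⟩
    6 * (h * e) * 1000
      ≤⟨ he-bound n q h e n≡ e≡ 2h≤q ⟩
    n * 375 * n ∎)
    where
    open ≤-Reasoning
    bound : ∀ u v → 𝟙 (heavy u v) * n ≤ (a u v * codeg u v) * 1000
    bound u v with adj G u v
    ... | false = z≤n
    ... | true  = 𝟙-*≤′ (not (light u v)) λ p →
      ≤-trans (≤ᵇ-false {codeg u v * 1000} p) (≤-reflexive (cong (_* 1000) (sym (*-identityˡ (codeg u v)))))

  #exceptional : ℕ
  #exceptional = ∑ (λ u → 𝟙 (exceptional u))

  -- Each exceptional vertex uses up at least n/1000 of the at most 375n heavy ordered pairs, so the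
  -- bound does not depend on `n`.
  #exceptional≤ : #exceptional ≤ 375000
  #exceptional≤ = *-cancelʳ-≤ _ _ n {{n-nonZero large}} (begin
    #exceptional * n
      ≡⟨ ∑-*ʳ n (λ u → 𝟙 (exceptional u)) ⟨
    ∑ (λ u → 𝟙 (exceptional u) * n)
      ≤⟨ ∑-mono (λ u → 𝟙-*≤′ (exceptional u) (≤ᵇ-false {heavy-degree u * 1000})) ⟩
    ∑ (λ u → heavy-degree u * 1000)
      ≡⟨ ∑-*ʳ 1000 heavy-degree ⟩
    ∑ heavy-degree * 1000
      ≤⟨ few-exceptional (∑ heavy-degree) n heavies ⟩
    375000 * n ∎)
    where open ≤-Reasoning

  good-degree≥ : ∀ u → exceptional u ≡ false → k ≤ good-degree u + heavy-degree u + #exceptional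
  good-degree≥ u eu = begin
    k             ≡⟨ reg u ⟨
    ∑ (a u)       ≤⟨ ∑-mono bound ⟩
    ∑ (λ v → 𝟙 (good u v) + 𝟙 (heavy u v) + 𝟙 (exceptional v))
      ≡⟨ trans (∑-+ _ (𝟙 ∘ exceptional)) (cong (_+ #exceptional) (∑-+ (λ v → 𝟙 (good u v)) (λ v → 𝟙 (heavy u v)))) ⟩
    good-degree u + heavy-degree u + #exceptional ∎
    where
    open ≤-Reasoning
    bound : ∀ v → a u v ≤ 𝟙 (good u v) + 𝟙 (heavy u v) + 𝟙 (exceptional v)
    bound v rewrite eu = bool-≤ 3 (λ { (x ∷ y ∷ z ∷ []) → 𝟙 x })
      (λ { (x ∷ y ∷ z ∷ []) → 𝟙 (x ∧ y ∧ true ∧ not z) + 𝟙 (x ∧ not y) + 𝟙 z })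
      (adj G u v ∷ light u v ∷ exceptional v ∷ [])

-- Closed walks of five good edges.

∑-+₅ : ∀ {n} (f₀ f₁ f₂ f₃ f₄ : Fin n → ℕ) →
  ∑ (λ i → f₀ i + f₁ i + f₂ i + f₃ i + f₄ i) ≡ ∑ f₀ + ∑ f₁ + ∑ f₂ + ∑ f₃ + ∑ f₄
∑-+₅ f₀ f₁ f₂ f₃ f₄ =
  trans (∑-+ _ f₄) (cong (_+ ∑ f₄) (trans (∑-+ _ f₃) (cong (_+ ∑ f₃) (trans (∑-+ _ f₂) (cong (_+ ∑ f₂) (∑-+ f₀ f₁))))))

*-distribʳ-+₅ : ∀ b x y z s t → (x + y + z + s + t) * b ≡ x * b + y * b + z * b + s * b + t * b
*-distribʳ-+₅ b x y z s t = trans (*-distribʳ-+ b (x + y + z + s) t) (cong (_+ t * b)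
  (trans (*-distribʳ-+ b (x + y + z) s) (cong (_+ s * b)
  (trans (*-distribʳ-+ b (x + y) z) (cong (_+ z * b) (*-distribʳ-+ b x y))))))

*-distribˡ-+₅ : ∀ b x y z s t → b * (x + y + z + s + t) ≡ b * x + b * y + b * z + b * s + b * t
*-distribˡ-+₅ b x y z s t = trans (*-distribˡ-+ b (x + y + z + s) t) (cong (_+ b * t)
  (trans (*-distribˡ-+ b (x + y + z) s) (cong (_+ b * s)
  (trans (*-distribˡ-+ b (x + y) z) (cong (_+ b * z) (*-distribˡ-+ b x y))))))

cong₅ : ∀ {x₀ x₁ x₂ x₃ x₄ y₀ y₁ y₂ y₃ y₄ : ℕ} → x₀ ≡ y₀ → x₁ ≡ y₁ → x₂ ≡ y₂ → x₃ ≡ y₃ → x₄ ≡ y₄ →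
  x₀ + x₁ + x₂ + x₃ + x₄ ≡ y₀ + y₁ + y₂ + y₃ + y₄
cong₅ refl refl refl refl refl = refl

mono₅ : ∀ {x₀ x₁ x₂ x₃ x₄ y₀ y₁ y₂ y₃ y₄ : ℕ} → x₀ ≤ y₀ → x₁ ≤ y₁ → x₂ ≤ y₂ → x₃ ≤ y₃ → x₄ ≤ y₄ →
  x₀ + x₁ + x₂ + x₃ + x₄ ≤ y₀ + y₁ + y₂ + y₃ + y₄
mono₅ p₀ p₁ p₂ p₃ p₄ = +-mono-≤ (+-mono-≤ (+-mono-≤ (+-mono-≤ p₀ p₁) p₂) p₃) p₄

-- Either one term is a surcharge and suffices alone, or every term dominates its codegree and the
-- bound for codegrees applies.
sum≥2 : ∀ x₀ x₁ x₂ x₃ x₄ c₀ c₁ c₂ c₃ c₄ →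
  2 ≤ x₀ ⊎ c₀ ≤ x₀ → 2 ≤ x₁ ⊎ c₁ ≤ x₁ → 2 ≤ x₂ ⊎ c₂ ≤ x₂ → 2 ≤ x₃ ⊎ c₃ ≤ x₃ → 2 ≤ x₄ ⊎ c₄ ≤ x₄ →
  2 ≤ c₀ + c₁ + c₂ + c₃ + c₄ → 2 ≤ x₀ + x₁ + x₂ + x₃ + x₄
sum≥2 x₀ x₁ x₂ x₃ x₄ c₀ c₁ c₂ c₃ c₄ = λ where
  (inj₁ p) _ _ _ _ _ → mono₅ {2} {0} {0} {0} {0} {x₀} {x₁} {x₂} {x₃} {x₄} p z≤n z≤n z≤n z≤n
  _ (inj₁ p) _ _ _ _ → mono₅ {0} {2} {0} {0} {0} {x₀} {x₁} {x₂} {x₃} {x₄} z≤n p z≤n z≤n z≤n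
  _ _ (inj₁ p) _ _ _ → mono₅ {0} {0} {2} {0} {0} {x₀} {x₁} {x₂} {x₃} {x₄} z≤n z≤n p z≤n z≤n
  _ _ _ (inj₁ p) _ _ → mono₅ {0} {0} {0} {2} {0} {x₀} {x₁} {x₂} {x₃} {x₄} z≤n z≤n z≤n p z≤n
  _ _ _ _ (inj₁ p) _ → mono₅ {0} {0} {0} {0} {2} {x₀} {x₁} {x₂} {x₃} {x₄} z≤n z≤n z≤n z≤n p
  (inj₂ p₀) (inj₂ p₁) (inj₂ p₂) (inj₂ p₃) (inj₂ p₄) le → ≤-trans le (mono₅ p₀ p₁ p₂ p₃ p₄)

-- The vertices are classified by their adjacencies to the five vertices of a closed walk:
-- class i consists of the vertices adjacent to the (i-1)-st and (i+1)-st ones only.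

Pattern : Set
Pattern = Vec Bool 5

class₀ class₁ class₂ class₃ class₄ unclassified : Pattern → Bool
class₀ (x₀ ∷ x₁ ∷ x₂ ∷ x₃ ∷ x₄ ∷ []) = x₄ ∧ x₁ ∧ not x₀ ∧ not x₂ ∧ not x₃
class₁ (x₀ ∷ x₁ ∷ x₂ ∷ x₃ ∷ x₄ ∷ []) = x₀ ∧ x₂ ∧ not x₁ ∧ not x₃ ∧ not x₄
class₂ (x₀ ∷ x₁ ∷ x₂ ∷ x₃ ∷ x₄ ∷ []) = x₁ ∧ x₃ ∧ not x₂ ∧ not x₄ ∧ not x₀
class₃ (x₀ ∷ x₁ ∷ x₂ ∷ x₃ ∷ x₄ ∷ []) = x₂ ∧ x₄ ∧ not x₃ ∧ not x₀ ∧ not x₁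
class₄ (x₀ ∷ x₁ ∷ x₂ ∷ x₃ ∷ x₄ ∷ []) = x₃ ∧ x₀ ∧ not x₄ ∧ not x₁ ∧ not x₂
unclassified x = not (class₀ x ∨ class₁ x ∨ class₂ x ∨ class₃ x ∨ class₄ x)

next : Pattern → Pattern → ℕ
next x y = 𝟙 (class₀ x) * 𝟙 (class₁ y) + 𝟙 (class₁ x) * 𝟙 (class₂ y) + 𝟙 (class₂ x) * 𝟙 (class₃ y)
         + 𝟙 (class₃ x) * 𝟙 (class₄ y) + 𝟙 (class₄ x) * 𝟙 (class₀ y)

weight pairs : Pattern → ℕ
weight (x₀ ∷ x₁ ∷ x₂ ∷ x₃ ∷ x₄ ∷ []) = 𝟙 x₀ + 𝟙 x₁ + 𝟙 x₂ + 𝟙 x₃ + 𝟙 x₄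
pairs  (x₀ ∷ x₁ ∷ x₂ ∷ x₃ ∷ x₄ ∷ []) = 𝟙 x₀ * 𝟙 x₁ + 𝟙 x₁ * 𝟙 x₂ + 𝟙 x₂ * 𝟙 x₃ + 𝟙 x₃ * 𝟙 x₄ + 𝟙 x₄ * 𝟙 x₀

common owned : Pattern → Pattern → ℕ
common (x₀ ∷ x₁ ∷ x₂ ∷ x₃ ∷ x₄ ∷ []) (y₀ ∷ y₁ ∷ y₂ ∷ y₃ ∷ y₄ ∷ []) =
  𝟙 x₀ * 𝟙 y₀ + 𝟙 x₁ * 𝟙 y₁ + 𝟙 x₂ * 𝟙 y₂ + 𝟙 x₃ * 𝟙 y₃ + 𝟙 x₄ * 𝟙 y₄
owned x (y₀ ∷ y₁ ∷ y₂ ∷ y₃ ∷ y₄ ∷ []) =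
  𝟙 (class₀ x) * 𝟙 y₀ + 𝟙 (class₁ x) * 𝟙 y₁ + 𝟙 (class₂ x) * 𝟙 y₂ + 𝟙 (class₃ x) * 𝟙 y₃ + 𝟙 (class₄ x) * 𝟙 y₄

halves : Vec Bool 10 → Pattern × Pattern
halves (x₀ ∷ x₁ ∷ x₂ ∷ x₃ ∷ x₄ ∷ y) = (x₀ ∷ x₁ ∷ x₂ ∷ x₃ ∷ x₄ ∷ []) , y

pattern-≤₁ : (f g : Pattern → ℕ) → {T (allB 5 (λ x → f x ≤ᵇ g x))} → ∀ x → f x ≤ g x
pattern-≤₁ f g {t} = bool-≤ 5 f g {t}

pattern-≤₂ : (f g : Pattern → Pattern → ℕ) →
  {T (allB 10 (λ v → f (proj₁ (halves v)) (proj₂ (halves v)) ≤ᵇ g (proj₁ (halves v)) (proj₂ (halves v))))} →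
  ∀ x y → f x y ≤ g x y
pattern-≤₂ f g {t} (x₀ ∷ x₁ ∷ x₂ ∷ x₃ ∷ x₄ ∷ []) y =
  bool-≤ 10 (λ v → f (proj₁ (halves v)) (proj₂ (halves v))) (λ v → g (proj₁ (halves v)) (proj₂ (halves v))) {t}
    (x₀ ∷ x₁ ∷ x₂ ∷ x₃ ∷ x₄ ∷ y)

-- An independent set of the 5-cycle has at most two elements, and each element beyond the second
-- creates at least one more consecutive pair.
weight≤2+pairs : ∀ x → weight x ≤ 2 + pairs x
weight≤2+pairs = pattern-≤₁ weight (λ x → 2 + pairs x)

-- The classified patterns are exactly the non-consecutive pairs. Any other pattern has at most one
-- element or contains a consecutive pair, so counting `pairs` twice leaves room for an additional
-- 1.
unclassified+weight : ∀ x → 𝟙 (unclassified x) + weight x ≤ 2 + 2 * pairs x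
unclassified+weight = pattern-≤₁ (λ x → 𝟙 (unclassified x) + weight x) (λ x → 2 + 2 * pairs x)

-- The two classes next to class i are precisely those adjacent to the i-th vertex of the walk. The
-- possible partners of a vertex of class i therefore lie in a neighbourhood of size `k`.
next+next≤owned : ∀ x y → next x y + next y x ≤ owned x y
next+next≤owned = pattern-≤₂ (λ x y → next x y + next y x) owned

next+next≤1 : ∀ x y → next x y + next y x ≤ 1
next+next≤1 = pattern-≤₂ (λ x y → next x y + next y x) (λ _ _ → 1)

-- Two vertices in equal or non-consecutive classes have a common neighbour on the walk, as any two
-- such non-consecutive pairs of the 5-cycle intersect.
classified≤ : ∀ x y → 𝟙 (not (unclassified x)) ≤ next x y + next y x + 𝟙 (unclassified y) + common x y
classified≤ = pattern-≤₂ (λ x y → 𝟙 (not (unclassified x))) (λ x y → next x y + next y x + 𝟙 (unclassified y) + common x y)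

classes≡classified : ∀ x → 𝟙 (class₀ x) + 𝟙 (class₁ x) + 𝟙 (class₂ x) + 𝟙 (class₃ x) + 𝟙 (class₄ x) ≡ 𝟙 (not (unclassified x))
classes≡classified = bool-≡ 5 _ _

-- Five light edges have total codegree at most n/200, so 5k is at most 2.005n.
walk-k : ∀ n k C → k + k + k + k + k ≤ 2 * n + C → C * 1000 ≤ 5 * n → k * 1000 ≤ n * 401
walk-k n k C p₁ p₂ =
  certify (n ∷ k ∷ C ∷ []) 4
  (# 1 ⊗ con 1000) (# 0 ⊗ con 401)
   ((con 1000 · # 1 ⊕ # 1 ⊕ # 1 ⊕ # 1 ⊕ # 1 ≼ con 2 ⊗ # 0 ⊕ # 2)
  ∷ (con 1 · # 2 ⊗ con 1000 ≼ con 5 ⊗ # 0) ∷ [])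
  (p₁ , p₂ , tt)
-- `D` is at most 2C - (5k - 2n), hence less than 2C, and 2C is at most n/100.
walk-D : ∀ n k q h C D → n ≡ 1 + 2 * q → k ≡ 2 * h → 2 * q + 2 ≤ 5 * h →
  D + (k + k + k + k + k) ≤ 2 * n + 2 * C → C * 1000 ≤ 5 * n → D * 100 ≤ n
walk-D n k q h C D p₁ p₂ p₃ p₄ p₅ =
  certify (n ∷ k ∷ q ∷ h ∷ C ∷ D ∷ []) 4
  (# 5 ⊗ con 100) (# 0)
   ((con 1000 · # 0 ≼ con 1 ⊕ con 2 ⊗ # 2)
  ∷ (con 2500 · con 2 ⊗ # 3 ≼ # 1)
  ∷ (con 1000 · con 2 ⊗ # 2 ⊕ con 2 ≼ con 5 ⊗ # 3)
  ∷ (con 500 · # 5 ⊕ (# 1 ⊕ # 1 ⊕ # 1 ⊕ # 1 ⊕ # 1) ≼ con 2 ⊗ # 0 ⊕ con 2 ⊗ # 4)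
  ∷ (con 1 · # 4 ⊗ con 1000 ≼ con 5 ⊗ # 0) ∷ [])
  (≤-reflexive p₁ , ≤-reflexive (sym p₂) , p₃ , p₄ , p₅ , tt)
walk-fits : ∀ n k D → k * 1000 ≤ n * 401 → D * 100 ≤ n → D + 2 * k ≤ n
walk-fits n k D p₁ p₂ =
  certify (n ∷ k ∷ D ∷ []) 499
  (# 2 ⊕ con 2 ⊗ # 1) (# 0)
   ((con 1 · # 1 ⊗ con 1000 ≼ # 0 ⊗ con 401)
  ∷ (con 5 · # 2 ⊗ con 100 ≼ # 0) ∷ [])
  (p₁ , p₂ , tt)
walk-m : ∀ n k D m → k * 1000 ≤ n * 401 → D * 100 ≤ n → m + (D + 2 * k) ≡ n → n * 188 ≤ m * 1000
walk-m n k D m p₁ p₂ p₃ =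
  certify (n ∷ k ∷ D ∷ m ∷ []) 0
  (# 0 ⊗ con 188) (# 3 ⊗ con 1000)
   ((con 2 · # 1 ⊗ con 1000 ≼ # 0 ⊗ con 401)
  ∷ (con 10 · # 2 ⊗ con 100 ≼ # 0)
  ∷ (con 1000 · # 0 ≼ # 3 ⊕ (# 2 ⊕ con 2 ⊗ # 1)) ∷ [])
  (p₁ , p₂ , ≤-reflexive (sym p₃) , tt)
m-square : ∀ n m → n * 188 ≤ m * 1000 → n * n * 35344 ≤ m * m * 1000000
m-square n m p₁ =
  certify (n ∷ m ∷ []) 0
  (# 0 ⊗ # 0 ⊗ con 35344) (# 1 ⊗ # 1 ⊗ con 1000000)
   ((con 188 ⊗ # 0 ⊕ con 1000 ⊗ # 1 · # 0 ⊗ con 188 ≼ # 1 ⊗ con 1000) ∷ [])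
  (p₁ , tt)
-- From k ≤ 0.401n follow h ≤ 0.2005n and, as `e` is 3h minus roughly n/2, e ≤ 0.1015n; the product
-- of the constants is slightly below 0.020361.
he-small : ∀ n k q h e → n ≡ 1 + 2 * q → k ≡ 2 * h → 3 * h ≡ q + 1 + e → k * 1000 ≤ n * 401 →
  h * e * 1000000 ≤ n * n * 20361
he-small n k q h e p₁ p₂ p₃ p₄ =
  certify (n ∷ k ∷ q ∷ h ∷ e ∷ []) 3
  (# 3 ⊗ # 4 ⊗ con 1000000) (# 0 ⊗ # 0 ⊗ con 20361)
   ((con 400959 ⊗ # 0 · # 0 ≼ con 1 ⊕ con 2 ⊗ # 2)
  ∷ (con 1203000 ⊗ # 0 ⊕ con 2000000 ⊗ # 4 · con 2 ⊗ # 3 ≼ # 1)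
  ∷ (con 802000 ⊗ # 0 · # 2 ⊕ con 1 ⊕ # 4 ≼ con 3 ⊗ # 3)
  ∷ (con 1203 ⊗ # 0 ⊕ con 2000 ⊗ # 4 · # 1 ⊗ con 1000 ≼ # 0 ⊗ con 401) ∷ [])
  (≤-reflexive p₁ , ≤-reflexive (sym p₂) , ≤-reflexive (sym p₃) , p₄ , tt)
miss-small : ∀ n k D X → k * 1000 ≤ n * 401 → D * 100 ≤ n → X * 1000 ≤ 10 * (k * n) →
  (D * k + X) * 100000 ≤ n * n * 802
miss-small n k D X p₁ p₂ p₃ =
  certify (n ∷ k ∷ D ∷ X ∷ []) 0
  ((# 2 ⊗ # 1 ⊕ # 3) ⊗ con 100000) (# 0 ⊗ # 0 ⊗ con 802)
   ((con 2 ⊗ # 0 · # 1 ⊗ con 1000 ≼ # 0 ⊗ con 401)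
  ∷ (con 1000 ⊗ # 1 · # 2 ⊗ con 100 ≼ # 0)
  ∷ (con 100 · # 3 ⊗ con 1000 ≼ con 10 ⊗ (# 1 ⊗ # 0)) ∷ [])
  (p₁ , p₂ , p₃ , tt)
-- In units of n²/10⁶ the left side 4m² is at least 4 · 35344 = 141376, while triangles and missing
-- pairs provide at most 6 · 20361 + 2 · 8020 = 138206.
walk-contradiction : ∀ N m he S M Y → N * 35344 ≤ m * 1000000 → he * 1000000 ≤ N * 20361 →
  M ≤ Y → Y * 100000 ≤ N * 802 → 4 * m ≤ S + 2 * M → S ≤ 6 * he → 1 ≤ N → ⊥
walk-contradiction N m he S M Y p₁ p₂ p₃ p₄ p₅ p₆ p₇ =
  1≰0 (certify (N ∷ m ∷ he ∷ S ∷ M ∷ Y ∷ []) 1584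
  (con 1) (con 0)
   ((con 2 · # 0 ⊗ con 35344 ≼ # 1 ⊗ con 1000000)
  ∷ (con 3 · # 2 ⊗ con 1000000 ≼ # 0 ⊗ con 20361)
  ∷ (con 1000000 · # 4 ≼ # 5)
  ∷ (con 10 · # 5 ⊗ con 100000 ≼ # 0 ⊗ con 802)
  ∷ (con 500000 · con 4 ⊗ # 1 ≼ # 3 ⊕ con 2 ⊗ # 4)
  ∷ (con 500000 · # 3 ≼ con 6 ⊗ # 2)
  ∷ (con 1585 · con 1 ≼ # 0) ∷ [])
  (p₁ , p₂ , p₃ , p₄ , p₅ , p₆ , p₇ , tt))
five≥2-arith : ∀ n k q h C → n ≡ 1 + 2 * q → k ≡ 2 * h → 2 * q + 2 ≤ 5 * h →
  k + k + k + k + k ≤ 2 * n + C → 2 ≤ C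
five≥2-arith n k q h C p₁ p₂ p₃ p₄ =
  certify (n ∷ k ∷ q ∷ h ∷ C ∷ []) 0
  (con 2) (# 4)
   ((con 2 · # 0 ≼ con 1 ⊕ con 2 ⊗ # 2)
  ∷ (con 5 · con 2 ⊗ # 3 ≼ # 1)
  ∷ (con 2 · con 2 ⊗ # 2 ⊕ con 2 ≼ con 5 ⊗ # 3)
  ∷ (con 1 · # 1 ⊕ # 1 ⊕ # 1 ⊕ # 1 ⊕ # 1 ≼ con 2 ⊗ # 0 ⊕ # 4) ∷ [])
  (≤-reflexive p₁ , ≤-reflexive (sym p₂) , p₃ , p₄ , tt)
m-positive : ∀ n m → n * 188 ≤ m * 1000 → 1000000000 ≤ n → 1 ≤ m
m-positive n m p₁ p₂ =
  certify (n ∷ m ∷ []) 187999999999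
  (con 1) (# 1)
   ((con 1 · # 0 ⊗ con 188 ≼ # 1 ⊗ con 1000)
  ∷ (con 188 · con 1000000000 ≼ # 0) ∷ [])
  (p₁ , p₂ , tt)

module Pentagon {n k q h e} (G : Graph n) (rg : Range n k q h e) (reg : ∀ i → ∑ (Triangles.a G i) ≡ k)
            (few : ∑³ (Triangles.tri G) ≤ 6 * (h * e)) where
  open Triangles G
  open Range rg
  open Good G rg reg few

  ∑-2+ : ∀ f → ∑ {n} (λ w → 2 + f w) ≡ 2 * n + ∑ f
  ∑-2+ f = trans (∑-+ (λ _ → 2) f) (cong (_+ ∑ f) (trans (∑-const n 2) (*-comm n 2)))

  pattern-of : (v₀ v₁ v₂ v₃ v₄ : Fin n) → Fin n → Pattern
  pattern-of v₀ v₁ v₂ v₃ v₄ w = adj G v₀ w ∷ adj G v₁ w ∷ adj G v₂ w ∷ adj G v₃ w ∷ adj G v₄ w ∷ []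

  ∑weight : ∀ v₀ v₁ v₂ v₃ v₄ → ∑ (weight ∘ pattern-of v₀ v₁ v₂ v₃ v₄) ≡ k + k + k + k + k
  ∑weight v₀ v₁ v₂ v₃ v₄ = trans (∑-+₅ (a v₀) (a v₁) (a v₂) (a v₃) (a v₄))
    (cong₅ (reg v₀) (reg v₁) (reg v₂) (reg v₃) (reg v₄))

  around : (f : Fin n → Fin n → ℕ) (v₀ v₁ v₂ v₃ v₄ : Fin n) → ℕ
  around f v₀ v₁ v₂ v₃ v₄ = f v₀ v₁ + f v₁ v₂ + f v₂ v₃ + f v₃ v₄ + f v₄ v₀

  ∑pairs : ∀ v₀ v₁ v₂ v₃ v₄ → ∑ (pairs ∘ pattern-of v₀ v₁ v₂ v₃ v₄) ≡ around codeg v₀ v₁ v₂ v₃ v₄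
  ∑pairs v₀ v₁ v₂ v₃ v₄ = ∑-+₅ (λ w → a v₀ w * a v₁ w) (λ w → a v₁ w * a v₂ w) (λ w → a v₂ w * a v₃ w)
    (λ w → a v₃ w * a v₄ w) (λ w → a v₄ w * a v₀ w)

  codegrees-around : ∀ v₀ v₁ v₂ v₃ v₄ → k + k + k + k + k ≤ 2 * n + around codeg v₀ v₁ v₂ v₃ v₄
  codegrees-around v₀ v₁ v₂ v₃ v₄ = begin
    k + k + k + k + k               ≡⟨ ∑weight v₀ v₁ v₂ v₃ v₄ ⟨
    ∑ (weight ∘ pat)                ≤⟨ ∑-mono (λ w → weight≤2+pairs (pat w)) ⟩
    ∑ (λ w → 2 + pairs (pat w))     ≡⟨ ∑-2+ (pairs ∘ pat) ⟩
    2 * n + ∑ (pairs ∘ pat)         ≡⟨ cong (2 * n +_) (∑pairs v₀ v₁ v₂ v₃ v₄) ⟩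
    2 * n + around codeg v₀ v₁ v₂ v₃ v₄ ∎
    where
    open ≤-Reasoning
    pat = pattern-of v₀ v₁ v₂ v₃ v₄

  -- The surcharge 2 for a non-adjacent pair makes five≥2 valid for all quintuples.
  φ : Fin n → Fin n → ℕ
  φ u w = a u w * codeg u w + 2 * 𝟙 (not (adj G u w))

  φ-sym : ∀ u w → φ u w ≡ φ w u
  φ-sym u w rewrite adj-sym G u w | codeg-sym u w = refl

  φ-large : ∀ u w → 2 ≤ φ u w ⊎ codeg u w ≤ φ u w
  φ-large u w with adj G u w
  ... | true  = inj₂ (≤-reflexive (sym (trans (+-identityʳ _) (*-identityˡ _))))
  ... | false = inj₁ ≤-refl

  five≥2 : ∀ v₀ v₁ v₂ v₃ v₄ → 2 ≤ around φ v₀ v₁ v₂ v₃ v₄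
  five≥2 v₀ v₁ v₂ v₃ v₄ = sum≥2 (φ v₀ v₁) (φ v₁ v₂) (φ v₂ v₃) (φ v₃ v₄) (φ v₄ v₀)
    (codeg v₀ v₁) (codeg v₁ v₂) (codeg v₂ v₃) (codeg v₃ v₄) (codeg v₄ v₀)
    (φ-large v₀ v₁) (φ-large v₁ v₂) (φ-large v₂ v₃) (φ-large v₃ v₄) (φ-large v₄ v₀)
    (five≥2-arith n k q h (around codeg v₀ v₁ v₂ v₃ v₄) n≡ k≡ 2q<5h (codegrees-around v₀ v₁ v₂ v₃ v₄))

  module Walk (v₀ v₁ v₂ v₃ v₄ : Fin n) (g₀ : good v₀ v₁ ≡ true) (g₁ : good v₁ v₂ ≡ true)
              (g₂ : good v₂ v₃ ≡ true) (g₃ : good v₃ v₄ ≡ true) (g₄ : good v₄ v₀ ≡ true) where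

    pat : Fin n → Pattern
    pat = pattern-of v₀ v₁ v₂ v₃ v₄

    C D : ℕ
    C = around codeg v₀ v₁ v₂ v₃ v₄
    D = ∑ (λ w → 𝟙 (unclassified (pat w)))

    C≤ : C * 1000 ≤ 5 * n
    C≤ = begin
      C * 1000
        ≡⟨ *-distribʳ-+₅ 1000 (codeg v₀ v₁) (codeg v₁ v₂) (codeg v₂ v₃) (codeg v₃ v₄) (codeg v₄ v₀) ⟩
      codeg v₀ v₁ * 1000 + codeg v₁ v₂ * 1000 + codeg v₂ v₃ * 1000 + codeg v₃ v₄ * 1000 + codeg v₄ v₀ * 1000
        ≤⟨ mono₅ (good-light g₀) (good-light g₁) (good-light g₂) (good-light g₃) (good-light g₄) ⟩
      n + n + n + n + n
        ≤⟨ five n ⟩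
      5 * n ∎
      where
      open ≤-Reasoning
      five : ∀ x → x + x + x + x + x ≤ 5 * x
      five x = certify (x ∷ []) 0 (# 0 ⊕ # 0 ⊕ # 0 ⊕ # 0 ⊕ # 0) (con 5 ⊗ # 0) [] tt

    k≤ : k * 1000 ≤ n * 401
    k≤ = walk-k n k C (codegrees-around v₀ v₁ v₂ v₃ v₄) C≤

    D≤ : D * 100 ≤ n
    D≤ = walk-D n k q h C D n≡ k≡ 2q<5h (begin
      D + (k + k + k + k + k)                       ≡⟨ cong (D +_) (∑weight v₀ v₁ v₂ v₃ v₄) ⟨
      D + ∑ (weight ∘ pat)                          ≡⟨ ∑-+ (λ w → 𝟙 (unclassified (pat w))) (weight ∘ pat) ⟨
      ∑ (λ w → 𝟙 (unclassified (pat w)) + weight (pat w)) ≤⟨ ∑-mono (λ w → unclassified+weight (pat w)) ⟩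
      ∑ (λ w → 2 + 2 * pairs (pat w))               ≡⟨ ∑-2+ (λ w → 2 * pairs (pat w)) ⟩
      2 * n + ∑ (λ w → 2 * pairs (pat w))           ≡⟨ cong (2 * n +_) (∑-*ˡ 2 (pairs ∘ pat)) ⟩
      2 * n + 2 * ∑ (pairs ∘ pat)                   ≡⟨ cong (λ x → 2 * n + 2 * x) (∑pairs v₀ v₁ v₂ v₃ v₄) ⟩
      2 * n + 2 * C                                 ∎) C≤
      where open ≤-Reasoning

    m : ℕ
    m = n ∸ (D + 2 * k)

    m≡ : m + (D + 2 * k) ≡ n
    m≡ = m∸n+n≡m (walk-fits n k D k≤ D≤)

    m≥ : n * 188 ≤ m * 1000
    m≥ = walk-m n k D m k≤ D≤ m≡

    -- For a suitable pair `u`, `w` of walk vertices, a classified vertex adjacent to neither of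
    -- them can only lie in the class `c`. Discarding `D` unclassified vertices and two
    -- neighbourhoods of size `k` leaves `m`.
    class-size : (c : Pattern → Bool) (u w : Fin n) →
      (∀ z → 1 ≤ 𝟙 (c (pat z)) + 𝟙 (unclassified (pat z)) + a u z + a w z) → m ≤ ∑ (λ z → 𝟙 (c (pat z)))
    class-size c u w le = +-cancelʳ-≤ (D + 2 * k) m _ (begin
      m + (D + 2 * k)    ≡⟨ m≡ ⟩
      n                  ≡⟨ trans (∑-const n 1) (*-identityʳ n) ⟨
      ∑ {n} (λ _ → 1)    ≤⟨ ∑-mono le ⟩
      ∑ (λ z → 𝟙 (c (pat z)) + 𝟙 (unclassified (pat z)) + a u z + a w z)
        ≡⟨ trans (∑-+ _ (a w)) (cong₂ _+_ (trans (∑-+ _ (a u)) (cong₂ _+_ (∑-+ (λ z → 𝟙 (c (pat z))) _) (reg u))) (reg w)) ⟩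
      ∑ (λ z → 𝟙 (c (pat z))) + D + k + k
        ≤⟨ regroup _ D k ⟩
      ∑ (λ z → 𝟙 (c (pat z))) + (D + 2 * k) ∎)
      where
      open ≤-Reasoning
      regroup : ∀ x d y → x + d + y + y ≤ x + (d + 2 * y)
      regroup x d y = certify (x ∷ d ∷ y ∷ []) 0 (# 0 ⊕ # 1 ⊕ # 2 ⊕ # 2) (# 0 ⊕ (# 1 ⊕ con 2 ⊗ # 2)) [] tt

    size₀ : m ≤ ∑ (λ z → 𝟙 (class₀ (pat z)))
    size₀ = class-size class₀ v₂ v₃ (λ z → pattern-≤₁ (λ _ → 1)
      (λ { x@(x₀ ∷ x₁ ∷ x₂ ∷ x₃ ∷ x₄ ∷ []) → 𝟙 (class₀ x) + 𝟙 (unclassified x) + 𝟙 x₂ + 𝟙 x₃ }) (pat z))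
    size₁ : m ≤ ∑ (λ z → 𝟙 (class₁ (pat z)))
    size₁ = class-size class₁ v₃ v₄ (λ z → pattern-≤₁ (λ _ → 1)
      (λ { x@(x₀ ∷ x₁ ∷ x₂ ∷ x₃ ∷ x₄ ∷ []) → 𝟙 (class₁ x) + 𝟙 (unclassified x) + 𝟙 x₃ + 𝟙 x₄ }) (pat z))
    size₂ : m ≤ ∑ (λ z → 𝟙 (class₂ (pat z)))
    size₂ = class-size class₂ v₄ v₀ (λ z → pattern-≤₁ (λ _ → 1)
      (λ { x@(x₀ ∷ x₁ ∷ x₂ ∷ x₃ ∷ x₄ ∷ []) → 𝟙 (class₂ x) + 𝟙 (unclassified x) + 𝟙 x₄ + 𝟙 x₀ }) (pat z))
    size₃ : m ≤ ∑ (λ z → 𝟙 (class₃ (pat z)))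
    size₃ = class-size class₃ v₀ v₁ (λ z → pattern-≤₁ (λ _ → 1)
      (λ { x@(x₀ ∷ x₁ ∷ x₂ ∷ x₃ ∷ x₄ ∷ []) → 𝟙 (class₃ x) + 𝟙 (unclassified x) + 𝟙 x₀ + 𝟙 x₁ }) (pat z))
    size₄ : m ≤ ∑ (λ z → 𝟙 (class₄ (pat z)))
    size₄ = class-size class₄ v₁ v₂ (λ z → pattern-≤₁ (λ _ → 1)
      (λ { x@(x₀ ∷ x₁ ∷ x₂ ∷ x₃ ∷ x₄ ∷ []) → 𝟙 (class₄ x) + 𝟙 (unclassified x) + 𝟙 x₁ + 𝟙 x₂ }) (pat z))

    cross : Fin n → Fin n → ℕ
    cross u w = next (pat u) (pat w) + next (pat w) (pat u)

    miss : ℕ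
    miss = ∑ (λ u → ∑ (λ w → cross u w * 𝟙 (not (adj G u w))))

    inside : Fin n → ℕ
    inside v = ∑ (λ u → ∑ (λ w → a u w * (a v u * a v w)))

    inside≡ : ∀ v → inside v ≡ ∑ (λ u → a v u * codeg v u)
    inside≡ v = ∑-cong (λ u → trans
      (∑-cong (λ w → bool-≡ 3 (λ { (x ∷ y ∷ z ∷ []) → 𝟙 x * (𝟙 y * 𝟙 z) }) (λ { (x ∷ y ∷ z ∷ []) → 𝟙 y * (𝟙 z * 𝟙 x) })
        (adj G u w ∷ adj G v u ∷ adj G v w ∷ [])))
      (∑-*ˡ (a v u) (λ w → a v w * a u w)))

    -- A light neighbour contributes at most n/1000. A heavy one may contribute up to `k`, but an
    -- unexceptional vertex has at most n/1000 of them.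
    inside≤ : ∀ v → exceptional v ≡ false → inside v * 1000 ≤ 2 * (k * n)
    inside≤ v ev = begin
      inside v * 1000
        ≡⟨ cong (_* 1000) (inside≡ v) ⟩
      ∑ (λ u → a v u * codeg v u) * 1000
        ≡⟨ ∑-*ʳ 1000 (λ u → a v u * codeg v u) ⟨
      ∑ (λ u → a v u * codeg v u * 1000)
        ≤⟨ ∑-mono bound ⟩
      ∑ (λ u → a v u * n + 𝟙 (heavy v u) * (k * 1000))
        ≡⟨ trans (∑-+ (λ u → a v u * n) _) (cong₂ _+_ (trans (∑-*ʳ n (a v)) (cong (_* n) (reg v))) (∑-*ʳ (k * 1000) (λ u → 𝟙 (heavy v u)))) ⟩
      k * n + heavy-degree v * (k * 1000)
        ≤⟨ total (heavy-degree v) k n (unexceptional ev) ⟩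
      2 * (k * n) ∎
      where
      open ≤-Reasoning
      bound : ∀ u → a v u * codeg v u * 1000 ≤ a v u * n + 𝟙 (heavy v u) * (k * 1000)
      bound u with adj G v u | light v u in eq
      ... | false | _     = z≤n
      ... | true  | true  rewrite *-identityˡ (codeg v u) | *-identityˡ n = ≤-trans (≤ᵇ-true eq) (m≤m+n n 0)
      ... | true  | false rewrite *-identityˡ (codeg v u) | *-identityˡ (k * 1000) =
        ≤-trans (*-monoˡ-≤ 1000 (≤-trans (codeg≤degree v u) (≤-reflexive (reg v)))) (m≤n+m _ (1 * n))
      total : ∀ d k n → d * 1000 ≤ n → k * n + d * (k * 1000) ≤ 2 * (k * n)
      total d k n p = certify (d ∷ k ∷ n ∷ []) 0 (# 1 ⊗ # 2 ⊕ # 0 ⊗ (# 1 ⊗ con 1000)) (con 2 ⊗ (# 1 ⊗ # 2))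
        ((# 1 · # 0 ⊗ con 1000 ≼ # 2) ∷ []) (p , tt)

    insides : ℕ
    insides = inside v₀ + inside v₁ + inside v₂ + inside v₃ + inside v₄

    insides≤ : insides * 1000 ≤ 10 * (k * n)
    insides≤ = sum-of (inside v₀) (inside v₁) (inside v₂) (inside v₃) (inside v₄) (k * n)
      (inside≤ v₀ (good-left g₀)) (inside≤ v₁ (good-left g₁)) (inside≤ v₂ (good-left g₂))
      (inside≤ v₃ (good-left g₃)) (inside≤ v₄ (good-left g₄))
      where
      sum-of : ∀ x y z s t b → x * 1000 ≤ 2 * b → y * 1000 ≤ 2 * b → z * 1000 ≤ 2 * b →
        s * 1000 ≤ 2 * b → t * 1000 ≤ 2 * b → (x + y + z + s + t) * 1000 ≤ 10 * b
      sum-of x y z s t b p₁ p₂ p₃ p₄ p₅ =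
        certify (x ∷ y ∷ z ∷ s ∷ t ∷ b ∷ []) 0
        ((# 0 ⊕ # 1 ⊕ # 2 ⊕ # 3 ⊕ # 4) ⊗ con 1000) (con 10 ⊗ # 5)
         ((con 1 · # 0 ⊗ con 1000 ≼ con 2 ⊗ # 5)
        ∷ (con 1 · # 1 ⊗ con 1000 ≼ con 2 ⊗ # 5)
        ∷ (con 1 · # 2 ⊗ con 1000 ≼ con 2 ⊗ # 5)
        ∷ (con 1 · # 3 ⊗ con 1000 ≼ con 2 ⊗ # 5)
        ∷ (con 1 · # 4 ⊗ con 1000 ≼ con 2 ⊗ # 5) ∷ [])
        (p₁ , p₂ , p₃ , p₄ , p₅ , tt)

    cross-total : ∑ (λ u → ∑ (cross u)) ≤ ∑ (λ u → ∑ (λ w → 𝟙 (not (unclassified (pat u))) * a u w))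
    cross-total = ∑-mono λ u → begin
      ∑ (cross u)
        ≤⟨ ∑-mono (λ w → next+next≤owned (pat u) (pat w)) ⟩
      ∑ (λ w → owned (pat u) (pat w))
        ≡⟨ trans (∑-+₅ _ _ _ _ _) (cong₅ (row class₀ u v₀) (row class₁ u v₁) (row class₂ u v₂) (row class₃ u v₃) (row class₄ u v₄)) ⟩
      𝟙 (class₀ (pat u)) * k + 𝟙 (class₁ (pat u)) * k + 𝟙 (class₂ (pat u)) * k + 𝟙 (class₃ (pat u)) * k + 𝟙 (class₄ (pat u)) * k
        ≡⟨ *-distribʳ-+₅ k (𝟙 (class₀ (pat u))) _ _ _ _ ⟨
      (𝟙 (class₀ (pat u)) + 𝟙 (class₁ (pat u)) + 𝟙 (class₂ (pat u)) + 𝟙 (class₃ (pat u)) + 𝟙 (class₄ (pat u))) * k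
        ≡⟨ cong₂ _*_ (classes≡classified (pat u)) (sym (reg u)) ⟩
      𝟙 (not (unclassified (pat u))) * ∑ (a u)
        ≡⟨ ∑-*ˡ (𝟙 (not (unclassified (pat u)))) (a u) ⟨
      ∑ (λ w → 𝟙 (not (unclassified (pat u))) * a u w) ∎
      where
      open ≤-Reasoning
      row : ∀ c u v → ∑ (λ w → 𝟙 (c (pat u)) * a v w) ≡ 𝟙 (c (pat u)) * k
      row c u v = trans (∑-*ˡ (𝟙 (c (pat u))) (a v)) (cong (𝟙 (c (pat u)) *_) (reg v))

    ∑cross-adj : ℕ
    ∑cross-adj = ∑ (λ u → ∑ (λ w → cross u w * a u w))

    -- By `cross-total` the possible cross pairs are no more numerous than the edges leaving
    -- classified vertices. Such an edge is itself a cross pair, or ends in an unclassified vertex,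
    -- or lies inside the neighbourhood of a walk vertex. The last two kinds are rare, so nearly all
    -- cross pairs must be edges.
    miss≤ : miss ≤ D * k + insides
    miss≤ = +-cancelˡ-≤ ∑cross-adj _ _ (begin
      ∑cross-adj + miss
        ≡⟨ ∑∑-+ (λ u w → cross u w * a u w) _ ⟨
      ∑ (λ u → ∑ (λ w → cross u w * a u w + cross u w * 𝟙 (not (adj G u w))))
        ≡⟨ ∑∑-cong (λ u w → whole (cross u w) (adj G u w)) ⟩
      ∑ (λ u → ∑ (cross u))
        ≤⟨ cross-total ⟩
      ∑ (λ u → ∑ (λ w → 𝟙 (not (unclassified (pat u))) * a u w))
        ≤⟨ ∑∑-mono (λ u w → ≤-trans (*-monoˡ-≤ (a u w) (classified≤ (pat u) (pat w))) (≤-reflexive (distribute u w))) ⟩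
      ∑ (λ u → ∑ (λ w → cross u w * a u w + 𝟙 (unclassified (pat w)) * a u w + (t v₀ u w + t v₁ u w + t v₂ u w + t v₃ u w + t v₄ u w)))
        ≡⟨ trans (∑∑-+ _ (λ u w → t v₀ u w + t v₁ u w + t v₂ u w + t v₃ u w + t v₄ u w))
             (cong₂ _+_ (∑∑-+ (λ u w → cross u w * a u w) _)
               (trans (∑-cong (λ u → ∑-+₅ (t v₀ u) (t v₁ u) (t v₂ u) (t v₃ u) (t v₄ u)))
                      (∑-+₅ (λ u → ∑ (t v₀ u)) (λ u → ∑ (t v₁ u)) (λ u → ∑ (t v₂ u)) (λ u → ∑ (t v₃ u)) (λ u → ∑ (t v₄ u))))) ⟩
      ∑cross-adj + ∑ (λ u → ∑ (λ w → 𝟙 (unclassified (pat w)) * a u w)) + insides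
        ≡⟨ cong (λ x → ∑cross-adj + x + insides) outside ⟩
      ∑cross-adj + D * k + insides
        ≡⟨ +-assoc ∑cross-adj (D * k) insides ⟩
      ∑cross-adj + (D * k + insides) ∎)
      where
      open ≤-Reasoning
      t : Fin n → Fin n → Fin n → ℕ
      t v u w = a u w * (a v u * a v w)
      whole : ∀ c b → c * 𝟙 b + c * 𝟙 (not b) ≡ c
      whole c true  rewrite *-identityʳ c | *-zeroʳ c = +-identityʳ c
      whole c false rewrite *-identityʳ c | *-zeroʳ c = refl
      distribute : ∀ u w → (cross u w + 𝟙 (unclassified (pat w)) + common (pat u) (pat w)) * a u w
        ≡ cross u w * a u w + 𝟙 (unclassified (pat w)) * a u w + (t v₀ u w + t v₁ u w + t v₂ u w + t v₃ u w + t v₄ u w)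
      distribute u w = trans (*-distribʳ-+ (a u w) (cross u w + 𝟙 (unclassified (pat w))) (common (pat u) (pat w)))
        (cong₂ _+_ (*-distribʳ-+ (a u w) (cross u w) _)
          (trans (*-comm (common (pat u) (pat w)) (a u w)) (*-distribˡ-+₅ (a u w) (a v₀ u * a v₀ w) (a v₁ u * a v₁ w) (a v₂ u * a v₂ w) (a v₃ u * a v₃ w) (a v₄ u * a v₄ w))))
      outside : ∑ (λ u → ∑ (λ w → 𝟙 (unclassified (pat w)) * a u w)) ≡ D * k
      outside = trans (∑-swap (λ u w → 𝟙 (unclassified (pat w)) * a u w))
        (trans (∑-cong (λ w → trans (∑-*ˡ (𝟙 (unclassified (pat w))) (λ u → a u w))
                 (cong (𝟙 (unclassified (pat w)) *_) (trans (∑-cong (λ u → a-sym u w)) (reg w)))))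
               (∑-*ʳ k (λ w → 𝟙 (unclassified (pat w)))))

    sel₀ : Selection (class₀ ∘ pat) m
    sel₀ = select (class₀ ∘ pat) m size₀
    module S₀ = Selection sel₀
    sel₁ : Selection (class₁ ∘ pat) m
    sel₁ = select (class₁ ∘ pat) m size₁
    module S₁ = Selection sel₁
    sel₂ : Selection (class₂ ∘ pat) m
    sel₂ = select (class₂ ∘ pat) m size₂
    module S₂ = Selection sel₂
    sel₃ : Selection (class₃ ∘ pat) m
    sel₃ = select (class₃ ∘ pat) m size₃
    module S₃ = Selection sel₃
    sel₄ : Selection (class₄ ∘ pat) m
    sel₄ = select (class₄ ∘ pat) m size₄
    module S₄ = Selection sel₄

    picked : ∀ (c d : Pattern → Bool) (S : Selection (c ∘ pat) m) (S′ : Selection (d ∘ pat) m) →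
      ∑ (λ x → ∑ (λ y → φ (Selection.pick S x) (Selection.pick S′ y)))
        ≤ ∑ (λ u → ∑ (λ w → 𝟙 (c (pat u)) * 𝟙 (d (pat w)) * φ u w))
    picked c d S S′ = begin
      ∑ (λ x → ∑ (λ y → φ (pick S x) (pick S′ y)))
        ≤⟨ ∑-mono (λ x → ∑-pick S′ (φ (pick S x))) ⟩
      ∑ (λ x → ∑ (λ w → 𝟙 (d (pat w)) * φ (pick S x) w))
        ≤⟨ ∑-pick S (λ u → ∑ (λ w → 𝟙 (d (pat w)) * φ u w)) ⟩
      ∑ (λ u → 𝟙 (c (pat u)) * ∑ (λ w → 𝟙 (d (pat w)) * φ u w))
        ≡⟨ ∑-cong (λ u → ∑-*ˡ (𝟙 (c (pat u))) (λ w → 𝟙 (d (pat w)) * φ u w)) ⟨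
      ∑ (λ u → ∑ (λ w → 𝟙 (c (pat u)) * (𝟙 (d (pat w)) * φ u w)))
        ≡⟨ ∑∑-cong (λ u w → *-assoc (𝟙 (c (pat u))) (𝟙 (d (pat w))) (φ u w)) ⟨
      ∑ (λ u → ∑ (λ w → 𝟙 (c (pat u)) * 𝟙 (d (pat w)) * φ u w)) ∎
      where
      open ≤-Reasoning
      open Selection

    Z₀ Z₁ Z₂ Z₃ Z₄ W : ℕ
    Z₀ = ∑ (λ x → ∑ (λ y → φ (S₀.pick x) (S₁.pick y)))
    Z₁ = ∑ (λ y → ∑ (λ x → φ (S₁.pick y) (S₂.pick x)))
    Z₂ = ∑ (λ x → ∑ (λ y → φ (S₂.pick x) (S₃.pick y)))
    Z₃ = ∑ (λ y → ∑ (λ z → φ (S₃.pick y) (S₄.pick z)))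
    Z₄ = ∑ (λ z → ∑ (λ x → φ (S₄.pick z) (S₀.pick x)))
    W = ∑ (λ u → ∑ (λ w → next (pat u) (pat w) * φ u w))

    ∑Z≤W : Z₀ + Z₁ + Z₂ + Z₃ + Z₄ ≤ W
    ∑Z≤W = begin
      Z₀ + Z₁ + Z₂ + Z₃ + Z₄
        ≤⟨ mono₅ (picked class₀ class₁ sel₀ sel₁)
                 (picked class₁ class₂ sel₁ sel₂)
                 (picked class₂ class₃ sel₂ sel₃)
                 (picked class₃ class₄ sel₃ sel₄)
                 (picked class₄ class₀ sel₄ sel₀) ⟩
      part class₀ class₁ + part class₁ class₂ + part class₂ class₃ + part class₃ class₄ + part class₄ class₀
        ≡⟨ trans (∑-cong (λ u → ∑-+₅ (cell class₀ class₁ u) (cell class₁ class₂ u) (cell class₂ class₃ u) (cell class₃ class₄ u) (cell class₄ class₀ u)))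
            (∑-+₅ (λ u → ∑ (cell class₀ class₁ u)) (λ u → ∑ (cell class₁ class₂ u)) (λ u → ∑ (cell class₂ class₃ u))
                  (λ u → ∑ (cell class₃ class₄ u)) (λ u → ∑ (cell class₄ class₀ u))) ⟨
      ∑ (λ u → ∑ (λ w → cell class₀ class₁ u w + cell class₁ class₂ u w + cell class₂ class₃ u w + cell class₃ class₄ u w + cell class₄ class₀ u w))
        ≡⟨ ∑∑-cong (λ u w → *-distribʳ-+₅ (φ u w) (both class₀ class₁ u w) (both class₁ class₂ u w) (both class₂ class₃ u w)
             (both class₃ class₄ u w) (both class₄ class₀ u w)) ⟨
      W ∎
      where
      open ≤-Reasoning
      both cell : (c d : Pattern → Bool) → Fin n → Fin n → ℕ
      both c d u w = 𝟙 (c (pat u)) * 𝟙 (d (pat w))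
      cell c d u w = both c d u w * φ u w
      part : (c d : Pattern → Bool) → ℕ
      part c d = ∑ (λ u → ∑ (cell c d u))

    -- The quintuples are indexed by (x , y , x , y , z), so that three indices suffice.
    m*m*2≤∑Z : m * (m * 2) ≤ Z₀ + Z₁ + Z₂ + Z₃ + Z₄
    m*m*2≤∑Z = *-cancelˡ-≤ m {{>-nonZero (m-positive n m m≥ large)}} (begin
      m * (m * (m * 2))
        ≡⟨ trans (∑-cong (λ _ → trans (∑-cong (λ _ → ∑-const m 2)) (∑-const m (m * 2)))) (∑-const m (m * (m * 2))) ⟨
      ∑ {m} (λ x → ∑ {m} (λ y → ∑ {m} (λ z → 2)))
        ≤⟨ ∑³-mono (λ x y z → five≥2 (S₀.pick x) (S₁.pick y) (S₂.pick x) (S₃.pick y) (S₄.pick z)) ⟩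
      ∑³ (λ x y z → t₀ x y z + t₁ x y z + t₂ x y z + t₃ x y z + t₄ x y z)
        ≡⟨ trans (∑³-+ _ t₄) (cong (_+ ∑³ t₄) (trans (∑³-+ _ t₃) (cong (_+ ∑³ t₃)
             (trans (∑³-+ _ t₂) (cong (_+ ∑³ t₂) (∑³-+ t₀ t₁)))))) ⟩
      ∑³ t₀ + ∑³ t₁ + ∑³ t₂ + ∑³ t₃ + ∑³ t₄
        ≡⟨ cong₅ e₀ e₁ e₂ e₃ e₄ ⟩
      m * Z₀ + m * Z₁ + m * Z₂ + m * Z₃ + m * Z₄
        ≡⟨ *-distribˡ-+₅ m Z₀ Z₁ Z₂ Z₃ Z₄ ⟨
      m * (Z₀ + Z₁ + Z₂ + Z₃ + Z₄) ∎)
      where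
      open ≤-Reasoning
      t₀ t₁ t₂ t₃ t₄ : Fin m → Fin m → Fin m → ℕ
      t₀ x y z = φ (S₀.pick x) (S₁.pick y)
      t₁ x y z = φ (S₁.pick y) (S₂.pick x)
      t₂ x y z = φ (S₂.pick x) (S₃.pick y)
      t₃ x y z = φ (S₃.pick y) (S₄.pick z)
      t₄ x y z = φ (S₄.pick z) (S₀.pick x)
      free-z : (f : Fin m → Fin m → ℕ) → ∑³ (λ x y z → f x y) ≡ m * ∑ (λ x → ∑ (f x))
      free-z f = trans (∑-cong (λ x → trans (∑-cong (λ y → ∑-const m (f x y))) (∑-*ˡ m (f x)))) (∑-*ˡ m (λ x → ∑ (f x)))
      e₀ : ∑³ t₀ ≡ m * Z₀
      e₀ = free-z (λ x y → φ (S₀.pick x) (S₁.pick y))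
      e₁ : ∑³ t₁ ≡ m * Z₁
      e₁ = trans (free-z (λ x y → φ (S₁.pick y) (S₂.pick x))) (cong (m *_) (∑-swap (λ x y → φ (S₁.pick y) (S₂.pick x))))
      e₂ : ∑³ t₂ ≡ m * Z₂
      e₂ = free-z (λ x y → φ (S₂.pick x) (S₃.pick y))
      e₃ : ∑³ t₃ ≡ m * Z₃
      e₃ = ∑-const m Z₃
      e₄ : ∑³ t₄ ≡ m * Z₄
      e₄ = trans (∑-cong (λ x → ∑-const m (∑ (λ z → φ (S₄.pick z) (S₀.pick x)))))
        (trans (∑-*ˡ m (λ x → ∑ (λ z → φ (S₄.pick z) (S₀.pick x)))) (cong (m *_) (∑-swap (λ x z → φ (S₄.pick z) (S₀.pick x)))))

    -- Adjacent cross pairs contribute codegrees, which are part of the ordered triangle count; each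
    -- non-adjacent one costs the surcharge 2. The factor 2 on `W` arises because `next` fixes the
    -- direction of a pair while `tri` counts both.
    2W≤ : W + W ≤ ∑³ tri + 2 * miss
    2W≤ = begin
      W + W
        ≡⟨ cong (W +_) (trans (∑-swap (λ u w → next (pat u) (pat w) * φ u w)) (∑∑-cong (λ u w → cong (next (pat w) (pat u) *_) (φ-sym w u)))) ⟩
      W + ∑ (λ u → ∑ (λ w → next (pat w) (pat u) * φ u w))
        ≡⟨ ∑∑-+ (λ u w → next (pat u) (pat w) * φ u w) _ ⟨
      ∑ (λ u → ∑ (λ w → next (pat u) (pat w) * φ u w + next (pat w) (pat u) * φ u w))
        ≡⟨ ∑∑-cong (λ u w → *-distribʳ-+ (φ u w) (next (pat u) (pat w)) (next (pat w) (pat u))) ⟨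
      ∑ (λ u → ∑ (λ w → cross u w * φ u w))
        ≤⟨ ∑∑-mono (λ u w → bound (cross u w) (a u w * codeg u w) (𝟙 (not (adj G u w))) (next+next≤1 (pat u) (pat w))) ⟩
      ∑ (λ u → ∑ (λ w → a u w * codeg u w + 2 * (cross u w * 𝟙 (not (adj G u w)))))
        ≡⟨ trans (∑∑-+ (λ u w → a u w * codeg u w) _) (cong₂ _+_ (sym ∑tri≡∑codeg)
             (trans (∑-cong (λ u → ∑-*ˡ 2 (λ w → cross u w * 𝟙 (not (adj G u w))))) (∑-*ˡ 2 (λ u → ∑ (λ w → cross u w * 𝟙 (not (adj G u w))))))) ⟩
      ∑³ tri + 2 * miss ∎
      where
      open ≤-Reasoning
      bound : ∀ c x y → c ≤ 1 → c * (x + 2 * y) ≤ x + 2 * (c * y)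
      bound c x y p = certify (c ∷ x ∷ y ∷ []) 0 (# 0 ⊗ (# 1 ⊕ con 2 ⊗ # 2)) (# 1 ⊕ con 2 ⊗ (# 0 ⊗ # 2))
        ((# 1 · # 0 ≼ con 1) ∷ []) (p , tt)

    impossible : ⊥
    impossible = walk-contradiction (n * n) (m * m) (h * e) (∑³ tri) miss (D * k + insides)
      (m-square n m m≥) (he-small n k q h e n≡ k≡ e≡ k≤) miss≤ (miss-small n k D insides k≤ D≤ insides≤)
      (≤-trans (≤-trans (four m) (+-mono-≤ 2m²≤W 2m²≤W)) 2W≤) few (*-mono-≤ {1} {n} {1} {n} 1≤n 1≤n)
      where
      2m²≤W : m * (m * 2) ≤ W
      2m²≤W = ≤-trans m*m*2≤∑Z ∑Z≤W
      1≤n : 1 ≤ n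
      1≤n = ≤-trans (s≤s z≤n) large
      four : ∀ m → 4 * (m * m) ≤ m * (m * 2) + m * (m * 2)
      four m = certify (m ∷ []) 0 (con 4 ⊗ (# 0 ⊗ # 0)) (# 0 ⊗ (# 0 ⊗ con 2) ⊕ # 0 ⊗ (# 0 ⊗ con 2)) [] tt

-- A locally maximal cut

agree : Bool → Bool → Bool
agree b c = if b then c else not c

agree-sym : ∀ b c → agree b c ≡ agree c b
agree-sym true  true  = refl
agree-sym true  false = refl
agree-sym false true  = refl
agree-sym false false = refl

module Cut {n k} (G : Graph n) (reg : ∀ i → ∑ (Triangles.a G i) ≡ k) where
  open Triangles G

  in-edge out-edge : (Fin n → Bool) → Fin n → Fin n → ℕ
  in-edge  s u v = a u v * 𝟙 (agree (s u) (s v))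
  out-edge s u v = a u v * 𝟙 (not (agree (s u) (s v)))

  in-degree out-degree : (Fin n → Bool) → Fin n → ℕ
  in-degree  s u = ∑ (in-edge s u)
  out-degree s u = ∑ (out-edge s u)

  in-edges : (Fin n → Bool) → ℕ
  in-edges s = ∑ (in-degree s)

  in+out : ∀ s u → in-degree s u + out-degree s u ≡ k
  in+out s u = trans (sym (∑-+ (in-edge s u) (out-edge s u)))
    (trans (∑-cong (λ v → bool-≡ 2 (λ { (x ∷ y ∷ []) → 𝟙 x * 𝟙 y + 𝟙 x * 𝟙 (not y) }) (λ { (x ∷ y ∷ []) → 𝟙 x })
             (adj G u v ∷ agree (s u) (s v) ∷ []))) (reg u))

  in-edge-sym : ∀ s u v → in-edge s u v ≡ in-edge s v u
  in-edge-sym s u v rewrite adj-sym G u v | agree-sym (s u) (s v) = refl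

  out-edge-sym : ∀ s u v → out-edge s u v ≡ out-edge s v u
  out-edge-sym s u v rewrite adj-sym G u v | agree-sym (s u) (s v) = refl

  flip : (Fin n → Bool) → Fin n → Fin n → Bool
  flip s w u = if ⌊ u ≟ w ⌋ then not (s u) else s u

  flip-edge : ∀ s w u v →
    in-edge (flip s w) u v + (𝟙 ⌊ u ≟ w ⌋ * in-edge s u v + 𝟙 ⌊ v ≟ w ⌋ * in-edge s u v)
    ≡ in-edge s u v + (𝟙 ⌊ u ≟ w ⌋ * out-edge s u v + 𝟙 ⌊ v ≟ w ⌋ * out-edge s u v)
  flip-edge s w u v with u ≟ w | v ≟ w
  ... | yes refl | yes refl rewrite adj-irrefl G u = refl
  ... | yes _ | no _ = bool-≡ 3
    (λ { (x ∷ y ∷ z ∷ []) → 𝟙 x * 𝟙 (agree (not y) z) + (1 * (𝟙 x * 𝟙 (agree y z)) + 0) })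
    (λ { (x ∷ y ∷ z ∷ []) → 𝟙 x * 𝟙 (agree y z) + (1 * (𝟙 x * 𝟙 (not (agree y z))) + 0) })
    (adj G u v ∷ s u ∷ s v ∷ [])
  ... | no _ | yes _ = bool-≡ 3
    (λ { (x ∷ y ∷ z ∷ []) → 𝟙 x * 𝟙 (agree y (not z)) + (0 + 1 * (𝟙 x * 𝟙 (agree y z))) })
    (λ { (x ∷ y ∷ z ∷ []) → 𝟙 x * 𝟙 (agree y z) + (0 + 1 * (𝟙 x * 𝟙 (not (agree y z)))) })
    (adj G u v ∷ s u ∷ s v ∷ [])
  ... | no _ | no _ = refl

  star-sum : ∀ (f : Fin n → Fin n → ℕ) → (∀ u v → f u v ≡ f v u) → ∀ w →
    ∑ (λ u → ∑ (λ v → 𝟙 ⌊ u ≟ w ⌋ * f u v + 𝟙 ⌊ v ≟ w ⌋ * f u v)) ≡ ∑ (f w) + ∑ (f w)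
  star-sum f f-sym w = trans (∑∑-+ (λ u v → 𝟙 ⌊ u ≟ w ⌋ * f u v) _) (cong₂ _+_
    (trans (∑-cong (λ u → ∑-*ˡ (𝟙 ⌊ u ≟ w ⌋) (f u))) (∑-single w (λ u → ∑ (f u))))
    (trans (∑-cong (λ u → ∑-single w (f u))) (∑-cong (λ u → f-sym u w))))

  flip-total : ∀ s w → in-edges (flip s w) + (in-degree s w + in-degree s w)
                     ≡ in-edges s + (out-degree s w + out-degree s w)
  flip-total s w = begin
    in-edges (flip s w) + (in-degree s w + in-degree s w)
      ≡⟨ cong (in-edges (flip s w) +_) (star-sum (in-edge s) (in-edge-sym s) w) ⟨
    in-edges (flip s w) + ∑ (λ u → ∑ (λ v → 𝟙 ⌊ u ≟ w ⌋ * in-edge s u v + 𝟙 ⌊ v ≟ w ⌋ * in-edge s u v))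
      ≡⟨ ∑∑-+ (in-edge (flip s w)) _ ⟨
    ∑ (λ u → ∑ (λ v → in-edge (flip s w) u v + (𝟙 ⌊ u ≟ w ⌋ * in-edge s u v + 𝟙 ⌊ v ≟ w ⌋ * in-edge s u v)))
      ≡⟨ ∑∑-cong (flip-edge s w) ⟩
    ∑ (λ u → ∑ (λ v → in-edge s u v + (𝟙 ⌊ u ≟ w ⌋ * out-edge s u v + 𝟙 ⌊ v ≟ w ⌋ * out-edge s u v)))
      ≡⟨ ∑∑-+ (in-edge s) _ ⟩
    in-edges s + ∑ (λ u → ∑ (λ v → 𝟙 ⌊ u ≟ w ⌋ * out-edge s u v + 𝟙 ⌊ v ≟ w ⌋ * out-edge s u v))
      ≡⟨ cong (in-edges s +_) (star-sum (out-edge s) (out-edge-sym s) w) ⟩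
    in-edges s + (out-degree s w + out-degree s w) ∎
    where open ≡-Reasoning

  Stable : (Fin n → Bool) → Set
  Stable s = ∀ w → 2 * in-degree s w ≤ k

  -- Moving a vertex that has more than half of its edges inside its own part strictly decreases
  -- `in-edges`; `bound` is the fuel for this descent.
  stabilise : ∀ bound s → in-edges s ≤ bound → ∃ λ s′ → in-edges s′ ≤ in-edges s × Stable s′
  stabilise bound s le with any? (λ w → k <ᴺ? 2 * in-degree s w)
  ... | no none = s , ≤-refl , λ w → ≮⇒≥ (λ p → none (w , p))
  stabilise bound s le | yes (w , p) = go bound le
    where
    flip-arith : ∀ f d i o k → f + (d + d) ≡ i + (o + o) → d + o ≡ k → k < 2 * d → f < i
    flip-arith f d i o k p₁ p₂ p₃ =
      certify (f ∷ d ∷ i ∷ o ∷ k ∷ []) 0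
      (con 1 ⊕ # 0) (# 2)
       ((con 1 · # 0 ⊕ (# 1 ⊕ # 1) ≼ # 2 ⊕ (# 3 ⊕ # 3))
      ∷ (con 2 · # 1 ⊕ # 3 ≼ # 4)
      ∷ (con 2 · con 1 ⊕ # 4 ≼ con 2 ⊗ # 1) ∷ [])
      (≤-reflexive p₁ , ≤-reflexive p₂ , p₃ , tt)
    smaller : in-edges (flip s w) < in-edges s
    smaller = flip-arith _ (in-degree s w) _ (out-degree s w) k (flip-total s w) (in+out s w) p
    go : ∀ b → in-edges s ≤ b → ∃ λ s′ → in-edges s′ ≤ in-edges s × Stable s′
    go zero    le with ≤-trans smaller le
    ... | ()
    go (suc b) le with stabilise b (flip s w) (≤-pred (≤-trans smaller le))
    ... | s′ , le′ , st = s′ , ≤-trans le′ (<⇒≤ smaller) , st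

-- The graph is close to bipartite

not-all-exceptional : ∀ n E F → E + F ≡ n → E ≤ 375000 → 1000000000 ≤ n → 1 ≤ F
not-all-exceptional n E F p₁ p₂ p₃ =
  certify (n ∷ E ∷ F ∷ []) 999624999
  (con 1) (# 2)
   ((con 1 · # 0 ≼ # 1 ⊕ # 2)
  ∷ (con 1 · # 1 ≼ con 375000)
  ∷ (con 1 · con 1000000000 ≼ # 0) ∷ [])
  (≤-reflexive (sym p₁) , p₂ , p₃ , tt)
good-positive : ∀ n k q h d H E → n ≡ 1 + 2 * q → k ≡ 2 * h → 2 * q + 2 ≤ 5 * h →
  k ≤ d + H + E → H * 1000 ≤ n → E ≤ 375000 → 1000000000 ≤ n → 1 ≤ d
good-positive n k q h d H E p₁ p₂ p₃ p₄ p₅ p₆ p₇ =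
  certify (n ∷ k ∷ q ∷ h ∷ d ∷ H ∷ E ∷ []) 398625000399
  (con 1) (# 4)
   ((con 400 · # 0 ≼ con 1 ⊕ con 2 ⊗ # 2)
  ∷ (con 1000 · con 2 ⊗ # 3 ≼ # 1)
  ∷ (con 400 · con 2 ⊗ # 2 ⊕ con 2 ≼ con 5 ⊗ # 3)
  ∷ (con 1000 · # 1 ≼ # 4 ⊕ # 5 ⊕ # 6)
  ∷ (con 1 · # 5 ⊗ con 1000 ≼ # 0)
  ∷ (con 1000 · # 6 ≼ con 375000)
  ∷ (con 399 · con 1000000000 ≼ # 0) ∷ [])
  (≤-reflexive p₁ , ≤-reflexive (sym p₂) , p₃ , p₄ , p₅ , p₆ , p₇ , tt)
-- A good degree falls short of `k` by at most n/1000 + 375000. Three of them therefore exceed 1.2n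
-- up to this small loss, whereas the overlap `t` allows only 1.001n.
triple-contradiction : ∀ n k q h x y z X Y Z E t → n ≡ 1 + 2 * q → k ≡ 2 * h →
  2 * q + 2 ≤ 5 * h → k ≤ x + X + E → X * 1000 ≤ n → k ≤ y + Y + E → Y * 1000 ≤ n →
  k ≤ z + Z + E → Z * 1000 ≤ n → E ≤ 375000 → 1000000000 ≤ n → x + y + z ≤ n + t →
  t * 1000 ≤ n → ⊥
triple-contradiction n k q h x y z X Y Z E t p₁ p₂ p₃ p₄ p₅ p₆ p₇ p₈ p₉ p₁₀ p₁₁ p₁₂ p₁₃ =
  1≰0 (certify (n ∷ k ∷ q ∷ h ∷ x ∷ y ∷ z ∷ X ∷ Y ∷ Z ∷ E ∷ t ∷ []) 194875001199
  (con 1) (con 0)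
   ((con 1200 · # 0 ≼ con 1 ⊕ con 2 ⊗ # 2)
  ∷ (con 3000 · con 2 ⊗ # 3 ≼ # 1)
  ∷ (con 1200 · con 2 ⊗ # 2 ⊕ con 2 ≼ con 5 ⊗ # 3)
  ∷ (con 1000 · # 1 ≼ # 4 ⊕ # 7 ⊕ # 10)
  ∷ (con 1 · # 7 ⊗ con 1000 ≼ # 0)
  ∷ (con 1000 · # 1 ≼ # 5 ⊕ # 8 ⊕ # 10)
  ∷ (con 1 · # 8 ⊗ con 1000 ≼ # 0)
  ∷ (con 1000 · # 1 ≼ # 6 ⊕ # 9 ⊕ # 10)
  ∷ (con 1 · # 9 ⊗ con 1000 ≼ # 0)
  ∷ (con 3000 · # 10 ≼ con 375000)
  ∷ (con 196 · con 1000000000 ≼ # 0)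
  ∷ (con 1000 · # 4 ⊕ # 5 ⊕ # 6 ≼ # 0 ⊕ # 11)
  ∷ (con 1 · # 11 ⊗ con 1000 ≼ # 0) ∷ [])
  (≤-reflexive p₁ , ≤-reflexive (sym p₂) , p₃ , p₄ , p₅ , p₆ , p₇ , p₈ , p₉ , p₁₀ , p₁₁ , p₁₂ ,
   p₁₃ , tt))
-- The constant is 375 + 375000: the heavy pairs give 375n, and 2 · 375000 · k is at most 375000n
-- because k is below n/2.
in-edges-arith : ∀ n k q h I H E → n ≡ 1 + 2 * q → k ≡ 2 * h → 2 * h ≤ q →
  I ≤ H + E * k + E * k → H ≤ n * 375 → E ≤ 375000 → I ≤ n * 375375
in-edges-arith n k q h I H E p₁ p₂ p₃ p₄ p₅ p₆ =
  certify (n ∷ k ∷ q ∷ h ∷ I ∷ H ∷ E ∷ []) 0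
  (# 4) (# 0 ⊗ con 375375)
   ((con 375000 · con 1 ⊕ con 2 ⊗ # 2 ≼ # 0)
  ∷ (con 750000 · # 1 ≼ con 2 ⊗ # 3)
  ∷ (con 750000 · con 2 ⊗ # 3 ≼ # 2)
  ∷ (con 1 · # 4 ≼ # 5 ⊕ # 6 ⊗ # 1 ⊕ # 6 ⊗ # 1)
  ∷ (con 1 · # 5 ≼ # 0 ⊗ con 375)
  ∷ (con 2 ⊗ # 1 · # 6 ≼ con 375000) ∷ [])
  (≤-reflexive (sym p₁) , ≤-reflexive p₂ , p₃ , p₄ , p₅ , p₆ , tt)

module NearBipartite {n k q h e} (G : Graph n) (rg : Range n k q h e) (reg : ∀ i → ∑ (Triangles.a G i) ≡ k)
            (few : ∑³ (Triangles.tri G) ≤ 6 * (h * e)) where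
  open Triangles G
  open Range rg
  open Good G rg reg few
  open Pentagon G rg reg few using (module Walk)
  open Cut G reg

  good-edge : ∃ λ u → ∃ λ v → good u v ≡ true
  good-edge = from (∑𝟙-positive (not ∘ exceptional)
      (not-all-exceptional n #exceptional (∑ (𝟙 ∘ not ∘ exceptional)) (∑𝟙+∑𝟙not exceptional) #exceptional≤ large))
    where
    from : (∃ λ u → not (exceptional u) ≡ true) → ∃ λ u → ∃ λ v → good u v ≡ true
    from (u , p) = u , ∑𝟙-positive (good u) (good-positive n k q h (good-degree u) (heavy-degree u) #exceptional n≡ k≡ 2q<5h
      (good-degree≥ u (not-true p)) (unexceptional (not-true p)) #exceptional≤ large)

  flip-good : ∀ {u v} → good u v ≡ true → good v u ≡ true
  flip-good {u} {v} p = trans (good-sym v u) p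

  module Sides (u₀ v₀ : Fin n) (u₀v₀ : good u₀ v₀ ≡ true) where

    no-walk : ∀ w x y → good w x ≡ true → good x u₀ ≡ true → good v₀ y ≡ true → good y w ≡ true → ⊥
    no-walk w x y wx xu vy yw = Walk.impossible u₀ v₀ y w x u₀v₀ vy yw wx xu

    side? : ∀ w → _
    side? w = any? (λ x → (good w x ∧ good x u₀) ≟ᴮ true)

    side : Fin n → Bool
    side w = ⌊ side? w ⌋

    -- If the good neighbourhoods of `w` and `w′` both avoid that of `z₀`, they share a set too
    -- small to hold them disjointly. Their overlap is then too large for the light edge `w w′`.
    avoid⇒⊥ : ∀ w w′ z₀ → good w w′ ≡ true → exceptional z₀ ≡ false →
      (∀ z → good z₀ z ≡ true → good w z ≡ true → ⊥) → (∀ z → good z₀ z ≡ true → good w′ z ≡ true → ⊥) → ⊥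
    avoid⇒⊥ w w′ z₀ ww′ ez p p′ = triple-contradiction n k q h
      (good-degree w) (good-degree w′) (good-degree z₀) (heavy-degree w) (heavy-degree w′) (heavy-degree z₀) #exceptional (codeg w w′)
      n≡ k≡ 2q<5h (good-degree≥ w ew) (unexceptional ew) (good-degree≥ w′ ew′) (unexceptional ew′)
      (good-degree≥ z₀ ez) (unexceptional ez) #exceptional≤ large total (good-light ww′)
      where
      ew : exceptional w ≡ false
      ew = good-left ww′
      ew′ : exceptional w′ ≡ false
      ew′ = good-left (flip-good ww′)
      bound : ∀ z → 𝟙 (good w z) + 𝟙 (good w′ z) + 𝟙 (good z₀ z) ≤ 1 + a w z * a w′ z
      bound z with good w z in e₁ | good w′ z in e₂ | good z₀ z in e₃
      ... | true  | _     | true  = ⊥-elim (p z e₃ e₁)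
      ... | false | true  | true  = ⊥-elim (p′ z e₃ e₂)
      ... | true  | true  | false rewrite good-adj {w} {z} e₁ | good-adj {w′} {z} e₂ = ≤-refl
      ... | true  | false | false = s≤s z≤n
      ... | false | true  | false = s≤s z≤n
      ... | false | false | true  = s≤s z≤n
      ... | false | false | false = z≤n
      total : good-degree w + good-degree w′ + good-degree z₀ ≤ n + codeg w w′
      total = begin
        good-degree w + good-degree w′ + good-degree z₀
          ≡⟨ trans (∑-+ _ (λ z → 𝟙 (good z₀ z))) (cong (_+ good-degree z₀) (∑-+ (λ z → 𝟙 (good w z)) (λ z → 𝟙 (good w′ z)))) ⟨
        ∑ (λ z → 𝟙 (good w z) + 𝟙 (good w′ z) + 𝟙 (good z₀ z))
          ≤⟨ ∑-mono bound ⟩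
        ∑ (λ z → 1 + a w z * a w′ z)
          ≡⟨ trans (∑-+ (λ _ → 1) (λ z → a w z * a w′ z)) (cong (_+ codeg w w′) (trans (∑-const n 1) (*-identityʳ n))) ⟩
        n + codeg w w′ ∎
        where open ≤-Reasoning

    ∧-intro : ∀ {b c} → b ≡ true → c ≡ true → b ∧ c ≡ true
    ∧-intro refl refl = refl

    -- For both ends in `side` the third vertex is `v₀`: a good common neighbour of `v₀` and such an
    -- end `w` would close a five-walk through `u₀`, `v₀` and the path from `w` to `u₀`. For both
    -- ends outside, the third vertex is `u₀`, and the definition of `side` itself excludes a good
    -- common neighbour.
    good-crosses : ∀ w w′ → good w w′ ≡ true → agree (side w) (side w′) ≡ false
    good-crosses w w′ ww′ with side? w | side? w′
    ... | yes (x , p) | yes (x′ , p′) = ⊥-elim (avoid⇒⊥ w w′ v₀ ww′ (good-left (flip-good u₀v₀))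
      (λ z vz wz → no-walk w x z (proj₁ (∧-true p)) (proj₂ (∧-true {good w x} p)) vz (flip-good wz))
      (λ z vz wz → no-walk w′ x′ z (proj₁ (∧-true p′)) (proj₂ (∧-true {good w′ x′} p′)) vz (flip-good wz)))
    ... | no p | no p′ = ⊥-elim (avoid⇒⊥ w w′ u₀ ww′ (good-left u₀v₀)
      (λ z uz wz → p (z , ∧-intro wz (flip-good uz)))
      (λ z uz wz → p′ (z , ∧-intro wz (flip-good uz))))
    ... | yes _ | no _  = refl
    ... | no _  | yes _ = refl

    side-in-edges : in-edges side ≤ n * 375375
    side-in-edges = in-edges-arith n k q h _ (∑ heavy-degree) #exceptional n≡ k≡ 2h≤q (begin
      in-edges side
        ≤⟨ ∑∑-mono bound ⟩
      ∑ (λ u → ∑ (λ v → 𝟙 (heavy u v) + 𝟙 (exceptional u) * a u v + 𝟙 (exceptional v) * a u v))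
        ≡⟨ trans (∑∑-+ _ (λ u v → 𝟙 (exceptional v) * a u v)) (cong₂ _+_ (trans (∑∑-+ (λ u v → 𝟙 (heavy u v)) (λ u v → 𝟙 (exceptional u) * a u v))
             (cong (∑ heavy-degree +_) left)) (trans (∑-swap (λ u v → 𝟙 (exceptional v) * a u v))
               (trans (∑∑-cong (λ u v → cong (𝟙 (exceptional u) *_) (a-sym v u))) left))) ⟩
      ∑ heavy-degree + #exceptional * k + #exceptional * k ∎) heavies #exceptional≤
      where
      open ≤-Reasoning
      left : ∑ (λ u → ∑ (λ v → 𝟙 (exceptional u) * a u v)) ≡ #exceptional * k
      left = trans (∑-cong (λ u → trans (∑-*ˡ (𝟙 (exceptional u)) (a u)) (cong (𝟙 (exceptional u) *_) (reg u))))
                   (∑-*ʳ k (𝟙 ∘ exceptional))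
      bound : ∀ u v → in-edge side u v ≤ 𝟙 (heavy u v) + 𝟙 (exceptional u) * a u v + 𝟙 (exceptional v) * a u v
      bound u v = cell (adj G u v) (light u v) (exceptional u) (exceptional v) (agree (side u) (side v)) (good-crosses u v)
        where
        cell : ∀ x l b c g → (x ∧ l ∧ not b ∧ not c ≡ true → g ≡ false) →
          𝟙 x * 𝟙 g ≤ 𝟙 (x ∧ not l) + 𝟙 b * 𝟙 x + 𝟙 c * 𝟙 x
        cell false _     _     _     _     _ = z≤n
        cell true  _     _     _     false _ = z≤n
        cell true  false _     _     true  _ = s≤s z≤n
        cell true  true  true  _     true  _ = s≤s z≤n
        cell true  true  false true  true  _ = s≤s z≤n
        cell true  true  false false true  p with p refl
        ... | ()

  stable-cut : ∃ λ s → in-edges s ≤ n * 375375 × Stable s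
  stable-cut = from good-edge
    where
    from : (∃ λ u → ∃ λ v → good u v ≡ true) → ∃ λ s → in-edges s ≤ n * 375375 × Stable s
    from (u₀ , v₀ , u₀v₀) = within (stabilise (in-edges side) side ≤-refl)
      where
      open Sides u₀ v₀ u₀v₀
      within : (∃ λ s → in-edges s ≤ in-edges side × Stable s) → ∃ λ s → in-edges s ≤ n * 375375 × Stable s
      within (s , le , st) = s , ≤-trans le side-in-edges , st

-- Degree squares

induced : ∀ {n} → Graph n → (Fin n → Bool) → Graph n
induced G p = record
  { adj    = λ i j → adj G i j ∧ p i ∧ p j
  ; sym    = λ i j → cong₂ _∧_ (adj-sym G i j) (∧-comm (p i) (p j))
  ; irrefl = λ i → cong (_∧ p i ∧ p i) (adj-irrefl G i) }

module Degrees {n} (H : Graph n) where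
  open Triangles H

  deg : Fin n → ℕ
  deg u = ∑ (a u)

  volume : ℕ
  volume = ∑ deg

  ∑∑-a-left : ∀ (f : Fin n → ℕ) → ∑ (λ u → ∑ (λ v → a u v * f u)) ≡ ∑ (λ u → deg u * f u)
  ∑∑-a-left f = ∑-cong (λ u → ∑-*ʳ (f u) (a u))

  ∑∑-a-right : ∀ (f : Fin n → ℕ) → ∑ (λ u → ∑ (λ v → a u v * f v)) ≡ ∑ (λ u → deg u * f u)
  ∑∑-a-right f = trans (∑-swap (λ u v → a u v * f v))
    (trans (∑∑-cong (λ u v → cong (_* f u) (a-sym v u))) (∑∑-a-left f))

  -- Among the edges meeting `x` or `y` only `x y` is counted at both ends. Everything is doubled
  -- since `volume` counts each edge in both directions.
  edge-degrees : ∀ x y → adj H x y ≡ true → deg x + deg y + deg x + deg y ≤ volume + 1 + 1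
  edge-degrees x y xy = begin
    deg x + deg y + deg x + deg y
      ≡⟨ cong₂ _+_ (cong₂ _+_ (cong₂ _+_ (row x) (row y)) (column x)) (column y) ⟨
    ∑ (λ u → ∑ (λ w → 𝟙 ⌊ u ≟ x ⌋ * a u w)) + ∑ (λ u → ∑ (λ w → 𝟙 ⌊ u ≟ y ⌋ * a u w))
    + ∑ (λ u → ∑ (λ w → 𝟙 ⌊ w ≟ x ⌋ * a u w)) + ∑ (λ u → ∑ (λ w → 𝟙 ⌊ w ≟ y ⌋ * a u w))
      ≡⟨ trans (∑∑-+ _ (λ u w → 𝟙 ⌊ w ≟ y ⌋ * a u w)) (cong (_+ ∑ (λ u → ∑ (λ w → 𝟙 ⌊ w ≟ y ⌋ * a u w)))
          (trans (∑∑-+ _ (λ u w → 𝟙 ⌊ w ≟ x ⌋ * a u w)) (cong (_+ ∑ (λ u → ∑ (λ w → 𝟙 ⌊ w ≟ x ⌋ * a u w)))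
            (∑∑-+ (λ u w → 𝟙 ⌊ u ≟ x ⌋ * a u w) (λ u w → 𝟙 ⌊ u ≟ y ⌋ * a u w))))) ⟨
    ∑ (λ u → ∑ (λ w → 𝟙 ⌊ u ≟ x ⌋ * a u w + 𝟙 ⌊ u ≟ y ⌋ * a u w + 𝟙 ⌊ w ≟ x ⌋ * a u w + 𝟙 ⌊ w ≟ y ⌋ * a u w))
      ≤⟨ ∑∑-mono bound ⟩
    ∑ (λ u → ∑ (λ w → a u w + 𝟙 ⌊ u ≟ x ⌋ * (𝟙 ⌊ w ≟ y ⌋ * 1) + 𝟙 ⌊ u ≟ y ⌋ * (𝟙 ⌊ w ≟ x ⌋ * 1)))
      ≡⟨ trans (∑∑-+ _ (λ u w → 𝟙 ⌊ u ≟ y ⌋ * (𝟙 ⌊ w ≟ x ⌋ * 1))) (cong₂ _+_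
          (trans (∑∑-+ a _) (cong (volume +_) (point x y))) (point y x)) ⟩
    volume + 1 + 1 ∎
    where
    open ≤-Reasoning
    row : ∀ v → ∑ (λ u → ∑ (λ w → 𝟙 ⌊ u ≟ v ⌋ * a u w)) ≡ deg v
    row v = trans (∑-cong (λ u → ∑-*ˡ (𝟙 ⌊ u ≟ v ⌋) (a u))) (∑-single v deg)
    column : ∀ v → ∑ (λ u → ∑ (λ w → 𝟙 ⌊ w ≟ v ⌋ * a u w)) ≡ deg v
    column v = trans (∑-cong (λ u → ∑-single v (a u))) (∑-cong (λ u → a-sym u v))
    point : ∀ v z → ∑ (λ u → ∑ (λ w → 𝟙 ⌊ u ≟ v ⌋ * (𝟙 ⌊ w ≟ z ⌋ * 1))) ≡ 1
    point v z = trans (∑-cong (λ u → trans (∑-*ˡ (𝟙 ⌊ u ≟ v ⌋) _) (cong (𝟙 ⌊ u ≟ v ⌋ *_) (∑-single z (λ _ → 1))))) (∑-single v (λ _ → 1))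
    loop : ∀ {A : Set} u → adj H u u ≡ true → A
    loop u p with trans (sym p) (adj-irrefl H u)
    ... | ()
    bound : ∀ u w → 𝟙 ⌊ u ≟ x ⌋ * a u w + 𝟙 ⌊ u ≟ y ⌋ * a u w + 𝟙 ⌊ w ≟ x ⌋ * a u w + 𝟙 ⌊ w ≟ y ⌋ * a u w
      ≤ a u w + 𝟙 ⌊ u ≟ x ⌋ * (𝟙 ⌊ w ≟ y ⌋ * 1) + 𝟙 ⌊ u ≟ y ⌋ * (𝟙 ⌊ w ≟ x ⌋ * 1)
    bound u w with adj H u w in uw
    ... | false rewrite *-zeroʳ (𝟙 ⌊ u ≟ x ⌋) | *-zeroʳ (𝟙 ⌊ u ≟ y ⌋) | *-zeroʳ (𝟙 ⌊ w ≟ x ⌋) | *-zeroʳ (𝟙 ⌊ w ≟ y ⌋) = z≤n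
    ... | true with u ≟ x | u ≟ y | w ≟ x | w ≟ y
    ...   | yes refl | yes refl | _        | _        = loop u xy
    ...   | yes refl | no _     | yes refl | _        = loop u uw
    ...   | no _     | yes refl | _        | yes refl = loop u uw
    ...   | no _     | no _     | yes refl | yes refl = loop w xy
    ...   | yes _    | no _     | no _     | yes _    = ≤-refl
    ...   | yes _    | no _     | no _     | no _     = ≤-refl
    ...   | no _     | yes _    | yes _    | no _     = ≤-refl
    ...   | no _     | yes _    | no _     | no _     = ≤-refl
    ...   | no _     | no _     | yes _    | no _     = ≤-refl
    ...   | no _     | no _     | no _     | yes _    = ≤-refl
    ...   | no _     | no _     | no _     | no _     = z≤n

  ∑deg² : ℕ
  ∑deg² = ∑ (λ u → deg u * deg u)

  -- The sum of squares is the sum over edges of the degree sums of their ends. With m edges,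
  -- `edge-degrees` bounds each summand by m + 1; here `volume` is 2m.
  4∑deg²≤ : 4 * ∑deg² ≤ volume * (volume + 1 + 1)
  4∑deg²≤ = begin
    4 * ∑deg²
      ≤⟨ four ∑deg² ⟩
    ∑deg² + ∑deg² + ∑deg² + ∑deg²
      ≡⟨ cong₂ _+_ (cong₂ _+_ (cong₂ _+_ (∑∑-a-left deg) (∑∑-a-right deg)) (∑∑-a-left deg)) (∑∑-a-right deg) ⟨
    l + r + l + r
      ≡⟨ trans (∑∑-+ _ (λ u v → a u v * deg v)) (cong (_+ r) (trans (∑∑-+ _ (λ u v → a u v * deg u)) (cong (_+ l)
           (∑∑-+ (λ u v → a u v * deg u) (λ u v → a u v * deg v))))) ⟨
    ∑ (λ u → ∑ (λ v → a u v * deg u + a u v * deg v + a u v * deg u + a u v * deg v))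
      ≤⟨ ∑∑-mono bound ⟩
    ∑ (λ u → ∑ (λ v → a u v * (volume + 1 + 1)))
      ≡⟨ trans (∑-cong (λ u → ∑-*ʳ (volume + 1 + 1) (a u))) (∑-*ʳ (volume + 1 + 1) deg) ⟩
    volume * (volume + 1 + 1) ∎
    where
    open ≤-Reasoning
    l r : ℕ
    l = ∑ (λ u → ∑ (λ v → a u v * deg u))
    r = ∑ (λ u → ∑ (λ v → a u v * deg v))
    four : ∀ x → 4 * x ≤ x + x + x + x
    four x = certify (x ∷ []) 0 (con 4 ⊗ # 0) (# 0 ⊕ # 0 ⊕ # 0 ⊕ # 0) [] tt
    bound : ∀ u v → a u v * deg u + a u v * deg v + a u v * deg u + a u v * deg v ≤ a u v * (volume + 1 + 1)
    bound u v with adj H u v in uv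
    ... | false = z≤n
    ... | true rewrite *-identityˡ (deg u) | *-identityˡ (deg v) | *-identityˡ (volume + 1 + 1) = edge-degrees u v uv

module Deletion {n} (H : Graph n) (v : Fin n) where
  open Triangles H
  open Degrees H

  H⁻ : Graph n
  H⁻ = induced H (λ u → not ⌊ u ≟ v ⌋)

  module T⁻ = Triangles H⁻
  module D⁻ = Degrees H⁻

  split-edge : ∀ u w → a u w ≡ 𝟙 ⌊ u ≟ v ⌋ * a v w + T⁻.a u w + 𝟙 ⌊ w ≟ v ⌋ * a u w
  split-edge u w with u ≟ v | w ≟ v
  ... | yes refl | yes refl rewrite adj-irrefl H u = refl
  ... | yes refl | no _ with adj H u w
  ...   | true  = refl
  ...   | false = refl
  split-edge u w | no _ | yes refl with adj H u w
  ...   | true  = refl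
  ...   | false = refl
  split-edge u w | no _ | no _ with adj H u w
  ...   | true  = refl
  ...   | false = refl

  split-degree : ∀ u → deg u ≡ 𝟙 ⌊ u ≟ v ⌋ * deg v + D⁻.deg u + a u v
  split-degree u = trans (∑-cong (split-edge u))
    (trans (∑-+ _ (λ w → 𝟙 ⌊ w ≟ v ⌋ * a u w)) (cong₂ _+_
      (trans (∑-+ (λ w → 𝟙 ⌊ u ≟ v ⌋ * a v w) (T⁻.a u)) (cong (_+ D⁻.deg u) (∑-*ˡ (𝟙 ⌊ u ≟ v ⌋) (a v))))
      (∑-single v (a u))))

  volume-split : volume ≡ deg v + D⁻.volume + deg v
  volume-split = trans (∑-cong split-degree) (trans (∑-+ _ (λ u → a u v)) (cong₂ _+_
    (trans (∑-+ (λ u → 𝟙 ⌊ u ≟ v ⌋ * deg v) D⁻.deg) (cong (_+ D⁻.volume) (∑-single v (λ _ → deg v))))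
    (∑-cong (λ u → a-sym u v))))

  -- Away from `v` the degree is `d⁻` or `d⁻ + 1`. The cross term 2 `d⁻` is kept in both cases, so
  -- that its sum is a volume.
  square-split : ∀ x β d dᵥ d⁻ → d ≡ 𝟙 x * dᵥ + d⁻ + 𝟙 β → (x ≡ true → d⁻ ≡ 0 × β ≡ false) →
    d * d ≤ 𝟙 x * (dᵥ * dᵥ) + d⁻ * d⁻ + 2 * d⁻ + 𝟙 β
  square-split true β d dᵥ d⁻ eq p with p refl
  ... | refl , refl rewrite eq | *-identityˡ dᵥ | +-identityʳ dᵥ | +-identityʳ dᵥ =
    ≤-reflexive (sym (trans (+-identityʳ _) (trans (+-identityʳ _) (trans (+-identityʳ _) (+-identityʳ _)))))
  square-split false true  d dᵥ d⁻ eq _ rewrite eq =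
    certify (d⁻ ∷ []) 0 ((# 0 ⊕ con 1) ⊗ (# 0 ⊕ con 1)) (# 0 ⊗ # 0 ⊕ con 2 ⊗ # 0 ⊕ con 1) [] tt
  square-split false false d dᵥ d⁻ eq _ rewrite eq =
    certify (d⁻ ∷ []) 0 ((# 0 ⊕ con 0) ⊗ (# 0 ⊕ con 0)) (# 0 ⊗ # 0 ⊕ con 2 ⊗ # 0 ⊕ con 0) [] tt

  deg⁻-v : ∀ u → ⌊ u ≟ v ⌋ ≡ true → D⁻.deg u ≡ 0 × adj H u v ≡ false
  deg⁻-v u p = trans (∑-cong zero-edge) (∑-0 n) , loop p
    where
    zero-edge : ∀ w → T⁻.a u w ≡ 0
    zero-edge w with adj H u w
    ... | true rewrite p = refl
    ... | false = refl
    loop : ⌊ u ≟ v ⌋ ≡ true → adj H u v ≡ false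
    loop q with u ≟ v
    ... | yes refl = adj-irrefl H u

  deg²-split : ∀ u → deg u * deg u ≤ 𝟙 ⌊ u ≟ v ⌋ * (deg v * deg v) + D⁻.deg u * D⁻.deg u + 2 * D⁻.deg u + a u v
  deg²-split u = square-split ⌊ u ≟ v ⌋ (adj H u v) (deg u) (deg v) (D⁻.deg u) (split-degree u) (deg⁻-v u)

  ∑deg²≤ : ∑deg² ≤ deg v * deg v + D⁻.∑deg² + 2 * D⁻.volume + deg v
  ∑deg²≤ = ≤-trans (∑-mono deg²-split) (≤-reflexive
    (trans (∑-+ _ (λ u → a u v)) (cong₂ _+_ (trans (∑-+ _ (λ u → 2 * D⁻.deg u))
      (cong₂ _+_ (trans (∑-+ (λ u → 𝟙 ⌊ u ≟ v ⌋ * (deg v * deg v)) (λ u → D⁻.deg u * D⁻.deg u))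
                        (cong (_+ D⁻.∑deg²) (∑-single v (λ _ → deg v * deg v))))
                 (∑-*ˡ 2 D⁻.deg)))
      (∑-cong (λ u → a-sym u v)))))

star-arith : ∀ Q d Q1 S → Q ≤ d * d + Q1 + 2 * S + d → 4 * Q1 ≤ S * (S + 1 + 1) →
  4 * Q ≤ 4 * (d * d) + 4 * d + S * S + 10 * S
star-arith Q d Q1 S p₁ p₂ =
  certify (Q ∷ d ∷ Q1 ∷ S ∷ []) 0
  (con 4 ⊗ # 0) (con 4 ⊗ (# 1 ⊗ # 1) ⊕ con 4 ⊗ # 1 ⊕ # 3 ⊗ # 3 ⊕ con 10 ⊗ # 3)
   ((con 4 · # 0 ≼ # 1 ⊗ # 1 ⊕ # 2 ⊕ con 2 ⊗ # 3 ⊕ # 1)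
  ∷ (con 1 · con 4 ⊗ # 2 ≼ # 3 ⊗ (# 3 ⊕ con 1 ⊕ con 1)) ∷ [])
  (p₁ , p₂ , tt)

-- The crude edge bound is applied only after deleting `v`, so the square of the dominant degree
-- stays exact and stars are nearly sharp. With S = 2s the right side is four times d² + d + s² +
-- 5s.
4∑deg²-star : ∀ {n} (H : Graph n) v → let open Degrees H ; S = Degrees.volume (Deletion.H⁻ H v) in
  4 * ∑deg² ≤ 4 * (deg v * deg v) + 4 * deg v + S * S + 10 * S
4∑deg²-star H v = star-arith (Degrees.∑deg² H) (Degrees.deg H v) (Degrees.∑deg² (Deletion.H⁻ H v)) (Degrees.volume (Deletion.H⁻ H v))
  (Deletion.∑deg²≤ H v) (Degrees.4∑deg²≤ (Deletion.H⁻ H v))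

argmax : ∀ {n} (f : Fin (suc n) → ℕ) → ∃ λ v → ∀ u → f u ≤ f v
argmax {zero}  f = zero , λ { zero → ≤-refl }
argmax {suc n} f with argmax (f ∘ suc)
... | v , max with ≤-total (f zero) (f (suc v))
...   | inj₁ p = suc v , λ { zero → p ; (suc u) → max u }
...   | inj₂ p = zero , λ { zero → ≤-refl ; (suc u) → ≤-trans (max u) p }

-- Edges inside the larger side of the cut.

e-large : ∀ n q h e → n ≡ 1 + 2 * q → 3 * h ≡ q + 1 + e → 2 * q + 2 ≤ 5 * h → n ≤ e * 10
e-large n q h e p₁ p₂ p₃ =
  certify (n ∷ q ∷ h ∷ e ∷ []) 0
  (# 0) (# 3 ⊗ con 10)
   ((con 1 · # 0 ≼ con 1 ⊕ con 2 ⊗ # 1)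
  ∷ (con 10 · con 3 ⊗ # 2 ≼ # 1 ⊕ con 1 ⊕ # 3)
  ∷ (con 6 · con 2 ⊗ # 1 ⊕ con 2 ≼ con 5 ⊗ # 2) ∷ [])
  (≤-reflexive p₁ , ≤-reflexive p₂ , p₃ , tt)
h≤2e : ∀ q h e → 3 * h ≡ q + 1 + e → 2 * q + 2 ≤ 5 * h → h ≤ 2 * e
h≤2e q h e p₁ p₂ =
  certify (q ∷ h ∷ e ∷ []) 0
  (# 1) (con 2 ⊗ # 2)
   ((con 2 · con 3 ⊗ # 1 ≼ # 0 ⊕ con 1 ⊕ # 2)
  ∷ (con 1 · con 2 ⊗ # 0 ⊕ con 2 ≼ con 5 ⊗ # 1) ∷ [])
  (≤-reflexive p₁ , p₂ , tt)
h-large : ∀ n q h → n ≡ 1 + 2 * q → 2 * q + 2 ≤ 5 * h → 1000000000 ≤ n → 200000000 ≤ h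
h-large n q h p₁ p₂ p₃ =
  certify (n ∷ q ∷ h ∷ []) 1000000000
  (con 200000000) (# 2)
   ((con 200000000 · # 0 ≼ con 1 ⊕ con 2 ⊗ # 1)
  ∷ (con 200000000 · con 2 ⊗ # 1 ⊕ con 2 ≼ con 5 ⊗ # 2)
  ∷ (con 200000000 · con 1000000000 ≼ # 0) ∷ [])
  (≤-reflexive p₁ , p₂ , p₃ , tt)
-- The edges across the cut cancel, so the inner volumes differ by k(X - Y), and X - Y is 1 + 2j.
-- One unit of imbalance forces the `2h`; `EY` and `j` measure what comes on top.
volume-excess : ∀ n q h k X Y j EX EY C → n ≡ 1 + 2 * q → k ≡ 2 * h → X + Y ≡ n → Y + j ≡ q →
  EX + C ≡ X * k → EY + C ≡ Y * k → EX ≤ 2 * h + (EY + 4 * (h * j))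
volume-excess n q h k X Y j EX EY C p₁ p₂ p₃ p₄ p₅ p₆ =
  certify (n ∷ q ∷ h ∷ k ∷ X ∷ Y ∷ j ∷ EX ∷ EY ∷ C ∷ []) 0
  (# 7) (con 2 ⊗ # 2 ⊕ (# 8 ⊕ con 4 ⊗ (# 2 ⊗ # 6)))
   ((con 2 ⊗ # 2 · # 0 ≼ con 1 ⊕ con 2 ⊗ # 1)
  ∷ (# 4 · # 3 ≼ con 2 ⊗ # 2)
  ∷ (# 5 · con 2 ⊗ # 2 ≼ # 3)
  ∷ (con 2 ⊗ # 2 · # 4 ⊕ # 5 ≼ # 0)
  ∷ (con 4 ⊗ # 2 · # 1 ≼ # 5 ⊕ # 6)
  ∷ (con 1 · # 7 ⊕ # 9 ≼ # 4 ⊗ # 3)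
  ∷ (con 1 · # 5 ⊗ # 3 ≼ # 8 ⊕ # 9) ∷ [])
  (≤-reflexive p₁ , ≤-reflexive p₂ , ≤-reflexive (sym p₂) , ≤-reflexive p₃ ,
   ≤-reflexive (sym p₄) , ≤-reflexive p₅ , ≤-reflexive (sym p₆) , tt)
volume-excess′ : ∀ n q h k X Y j EX EY C → n ≡ 1 + 2 * q → k ≡ 2 * h → X + Y ≡ n → Y + j ≡ q →
  EX + C ≡ X * k → EY + C ≡ Y * k → 2 * h + (EY + 4 * (h * j)) ≤ EX
volume-excess′ n q h k X Y j EX EY C p₁ p₂ p₃ p₄ p₅ p₆ =
  certify (n ∷ q ∷ h ∷ k ∷ X ∷ Y ∷ j ∷ EX ∷ EY ∷ C ∷ []) 0
  (con 2 ⊗ # 2 ⊕ (# 8 ⊕ con 4 ⊗ (# 2 ⊗ # 6))) (# 7)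
   ((con 2 ⊗ # 2 · con 1 ⊕ con 2 ⊗ # 1 ≼ # 0)
  ∷ (# 5 · # 3 ≼ con 2 ⊗ # 2)
  ∷ (# 4 · con 2 ⊗ # 2 ≼ # 3)
  ∷ (con 2 ⊗ # 2 · # 0 ≼ # 4 ⊕ # 5)
  ∷ (con 4 ⊗ # 2 · # 5 ⊕ # 6 ≼ # 1)
  ∷ (con 1 · # 4 ⊗ # 3 ≼ # 7 ⊕ # 9)
  ∷ (con 1 · # 8 ⊕ # 9 ≼ # 5 ⊗ # 3) ∷ [])
  (≤-reflexive (sym p₁) , ≤-reflexive p₂ , ≤-reflexive (sym p₂) , ≤-reflexive (sym p₃) ,
   ≤-reflexive p₄ , ≤-reflexive (sym p₅) , ≤-reflexive p₆ , tt)
minority-size : ∀ n q X Y → n ≡ 1 + 2 * q → X + Y ≡ n → q + 1 ≤ X → Y ≤ q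
minority-size n q X Y p₁ p₂ p₃ =
  certify (n ∷ q ∷ X ∷ Y ∷ []) 0
  (# 3) (# 1)
   ((con 1 · # 0 ≼ con 1 ⊕ con 2 ⊗ # 1)
  ∷ (con 1 · # 2 ⊕ # 3 ≼ # 0)
  ∷ (con 1 · # 1 ⊕ con 1 ≼ # 2) ∷ [])
  (≤-reflexive p₁ , ≤-reflexive p₂ , p₃ , tt)
common-arith : ∀ h q k du dv yu yv t Y → k ≡ 2 * h → du + yu ≡ k → dv + yv ≡ k →
  yu + yv ≤ t + Y → Y ≤ q → 4 * h ≤ t + q + du + dv
common-arith h q k du dv yu yv t Y p₁ p₂ p₃ p₄ p₅ =
  certify (h ∷ q ∷ k ∷ du ∷ dv ∷ yu ∷ yv ∷ t ∷ Y ∷ []) 0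
  (con 4 ⊗ # 0) (# 7 ⊕ # 1 ⊕ # 3 ⊕ # 4)
   ((con 2 · con 2 ⊗ # 0 ≼ # 2)
  ∷ (con 1 · # 2 ≼ # 3 ⊕ # 5)
  ∷ (con 1 · # 2 ≼ # 4 ⊕ # 6)
  ∷ (con 1 · # 5 ⊕ # 6 ≼ # 7 ⊕ # 8)
  ∷ (con 1 · # 8 ≼ # 1) ∷ [])
  (≤-reflexive (sym p₁) , ≤-reflexive (sym p₂) , ≤-reflexive (sym p₃) , p₄ , p₅ , tt)
-- Here t is at least 4h - q - h - 3e/10, and 3h - q is e + 1.
small-end : ∀ h q e t x y → 4 * h ≤ t + q + x + y → 3 * h ≡ q + 1 + e → x * 10 ≤ 3 * e →
  y ≤ h → 7 * e ≤ t * 10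
small-end h q e t x y p₁ p₂ p₃ p₄ =
  certify (h ∷ q ∷ e ∷ t ∷ x ∷ y ∷ []) 0
  (con 7 ⊗ # 2) (# 3 ⊗ con 10)
   ((con 10 · con 4 ⊗ # 0 ≼ # 3 ⊕ # 1 ⊕ # 4 ⊕ # 5)
  ∷ (con 10 · # 1 ⊕ con 1 ⊕ # 2 ≼ con 3 ⊗ # 0)
  ∷ (con 1 · # 4 ⊗ con 10 ≼ con 3 ⊗ # 2)
  ∷ (con 10 · # 5 ≼ # 0) ∷ [])
  (p₁ , ≤-reflexive (sym p₂) , p₃ , p₄ , tt)
small-end′ : ∀ h q e t x y → 4 * h ≤ t + q + x + y → 3 * h ≡ q + 1 + e → y * 10 ≤ 3 * e →
  x ≤ h → 7 * e ≤ t * 10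
small-end′ h q e t x y p₁ p₂ p₃ p₄ =
  certify (h ∷ q ∷ e ∷ t ∷ x ∷ y ∷ []) 0
  (con 7 ⊗ # 2) (# 3 ⊗ con 10)
   ((con 10 · con 4 ⊗ # 0 ≼ # 3 ⊕ # 1 ⊕ # 4 ⊕ # 5)
  ∷ (con 10 · # 1 ⊕ con 1 ⊕ # 2 ≼ con 3 ⊗ # 0)
  ∷ (con 1 · # 5 ⊗ con 10 ≼ con 3 ⊗ # 2)
  ∷ (con 10 · # 4 ≼ # 0) ∷ [])
  (p₁ , ≤-reflexive (sym p₂) , p₃ , p₄ , tt)
third : ∀ TT S he → TT + TT + TT ≤ S → S ≤ 6 * he → TT ≤ 2 * he
third TT S he p₁ p₂ =
  certify (TT ∷ S ∷ he ∷ []) 2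
  (# 0) (con 2 ⊗ # 2)
   ((con 1 · # 0 ⊕ # 0 ⊕ # 0 ≼ # 1)
  ∷ (con 1 · # 1 ≼ con 6 ⊗ # 2) ∷ [])
  (p₁ , p₂ , tt)
M-arith : ∀ M e TT h → M * (7 * e) ≤ TT * 10 → TT ≤ 2 * (h * e) → M * 7 * e ≤ 20 * h * e
M-arith M e TT h p₁ p₂ =
  certify (M ∷ e ∷ TT ∷ h ∷ []) 0
  (# 0 ⊗ con 7 ⊗ # 1) (con 20 ⊗ # 3 ⊗ # 1)
   ((con 1 · # 0 ⊗ (con 7 ⊗ # 1) ≼ # 2 ⊗ con 10)
  ∷ (con 10 · # 2 ≼ con 2 ⊗ (# 3 ⊗ # 1)) ∷ [])
  (p₁ , p₂ , tt)
-- The constant is 375375 · 10 · 10 / 3: a vertex of large inner degree takes 3e/10 of a volume that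
-- is at most 375375 · 10e.
ℓ-first : ∀ l e V n → l * (3 * e) ≤ V * 10 → V ≤ n * 375375 → n ≤ e * 10 → l * e ≤ 12512500 * e
ℓ-first l e V n p₁ p₂ p₃ =
  certify (l ∷ e ∷ V ∷ n ∷ []) 2
  (# 0 ⊗ # 1) (con 12512500 ⊗ # 1)
   ((con 1 · # 0 ⊗ (con 3 ⊗ # 1) ≼ # 2 ⊗ con 10)
  ∷ (con 10 · # 2 ≼ # 3 ⊗ con 375375)
  ∷ (con 3753750 · # 3 ≼ # 1 ⊗ con 10) ∷ [])
  (p₁ , p₂ , p₃ , tt)
-- The bound is improved by feeding it back. One factor of ℓ² is replaced by 12512500, which is at
-- most 0.125125e because e ≥ 10⁸. Then ℓ times 0.174e is at most 20h/7, which is at most 40e/7, and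
-- this already gives ℓ < 33.
ℓ-second : ∀ l e V M h n → l * (3 * e) ≤ V * 10 → V ≤ M + l * l → M * 7 ≤ 20 * h → h ≤ 2 * e →
  l ≤ 12512500 → 1000000000 ≤ n → n ≤ e * 10 → l * e ≤ 41 * e
ℓ-second l e V M h n p₁ p₂ p₃ p₄ p₅ p₆ p₇ =
  certify (l ∷ e ∷ V ∷ M ∷ h ∷ n ∷ []) 1225345924999
  (# 0 ⊗ # 1) (con 41 ⊗ # 1)
   ((con 700697704000 · # 0 ⊗ (con 3 ⊗ # 1) ≼ # 2 ⊗ con 10)
  ∷ (con 7006977040000 · # 2 ≼ # 3 ⊕ # 0 ⊗ # 0)
  ∷ (con 1000996720000 · # 3 ⊗ con 7 ≼ con 20 ⊗ # 4)
  ∷ (con 20019934400000 · # 4 ≼ con 2 ⊗ # 1)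
  ∷ (con 7006977040000 ⊗ # 0 ⊕ con 815130 ⊗ # 1 · # 0 ≼ con 12512500)
  ∷ (con 87674800213 ⊗ # 0 · con 1000000000 ≼ # 5)
  ∷ (con 87674800213 ⊗ # 0 · # 5 ≼ # 1 ⊗ con 10) ∷ [])
  (p₁ , p₂ , p₃ , p₄ , p₅ , p₆ , p₇ , tt)
-- The constant 11767 is 7 · 41², and 6h is 20h - 14h.
volume-bound : ∀ V M l h R → V ≤ M + l * l → M * 7 ≤ 20 * h → l ≤ 41 → 2 * h + R ≤ V →
  R * 7 ≤ 6 * h + 11767
volume-bound V M l h R p₁ p₂ p₃ p₄ =
  certify (V ∷ M ∷ l ∷ h ∷ R ∷ []) 0
  (# 4 ⊗ con 7) (con 6 ⊗ # 3 ⊕ con 11767)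
   ((con 7 · # 0 ≼ # 1 ⊕ # 2 ⊗ # 2)
  ∷ (con 1 · # 1 ⊗ con 7 ≼ con 20 ⊗ # 3)
  ∷ (con 287 ⊕ con 7 ⊗ # 2 · # 2 ≼ con 41)
  ∷ (con 7 · con 2 ⊗ # 3 ⊕ # 4 ≼ # 0) ∷ [])
  (p₁ , p₂ , p₃ , p₄ , tt)
-- As 2h ≤ V, the triangle budget 2he is at most eV. Division by V leaves 4h ≤ e + q + 2d, and e + q
-- is 3h - 1.
Δ-arith : ∀ h q e V TT Q d → 4 * h * V ≤ TT + q * V + 2 * Q → TT ≤ 2 * (h * e) → Q ≤ V * d →
  2 * h ≤ V → 3 * h ≡ q + 1 + e → (h + 1) * V ≤ 2 * d * V
Δ-arith h q e V TT Q d p₁ p₂ p₃ p₄ p₅ =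
  certify (h ∷ q ∷ e ∷ V ∷ TT ∷ Q ∷ d ∷ []) 0
  ((# 0 ⊕ con 1) ⊗ # 3) (con 2 ⊗ # 6 ⊗ # 3)
   ((con 1 · con 4 ⊗ # 0 ⊗ # 3 ≼ # 4 ⊕ # 1 ⊗ # 3 ⊕ con 2 ⊗ # 5)
  ∷ (con 1 · # 4 ≼ con 2 ⊗ (# 0 ⊗ # 2))
  ∷ (con 2 · # 5 ≼ # 3 ⊗ # 6)
  ∷ (# 2 · con 2 ⊗ # 0 ≼ # 3)
  ∷ (# 3 · # 1 ⊕ con 1 ⊕ # 2 ≼ con 3 ⊗ # 0) ∷ [])
  (p₁ , p₂ , p₃ , p₄ , ≤-reflexive (sym p₅) , tt)
-- With d = h - p and S = R + 2p the terms free of R and p cancel, leaving R(h + e - 4) + 4hp ≤ 4p²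
-- + 2pR + R²/2 + 8p. Since 2p < h, the first two terms on the right are at most 2hp and hR. Since
-- R/2 is at most 3h/7 plus a constant while e ≥ h/2, the third stays below eR by about hR/14. For
-- large h only R = p = 0 is possible.
final-arith : ∀ h q e V TT Q d p R S → 4 * h * V ≤ TT + q * V + 2 * Q → TT ≤ 2 * (h * e) →
  4 * Q ≤ 4 * (d * d) + 4 * d + S * S + 10 * S → V ≡ 2 * h + R → V ≡ 2 * d + S → h ≡ d + p →
  3 * h ≡ q + 1 + e → h + 1 ≤ 2 * d → R * 7 ≤ 6 * h + 11767 → h ≤ 2 * e → 200000000 ≤ h →
  R + p ≤ 0
final-arith h q e V TT Q d p R S p₁ p₂ p₃ p₄ p₅ p₆ p₇ p₈ p₉ p₁₀ p₁₁ =
  certify (h ∷ q ∷ e ∷ V ∷ TT ∷ Q ∷ d ∷ p ∷ R ∷ S ∷ []) 831997620812208758199999999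
  (# 8 ⊕ # 7) (con 0)
   ((con 5320032937800000000 · con 4 ⊗ # 0 ⊗ # 3 ≼ # 4 ⊕ # 1 ⊗ # 3 ⊕ con 2 ⊗ # 5)
  ∷ (con 5320032937800000000 · # 4 ≼ con 2 ⊗ (# 0 ⊗ # 2))
  ∷ (con 2660016468900000000
      · con 4 ⊗ # 5 ≼ con 4 ⊗ (# 6 ⊗ # 6) ⊕ con 4 ⊗ # 6 ⊕ # 9 ⊗ # 9 ⊕ con 10 ⊗ # 9)
  ∷ (con 740011842038956209 ⊗ # 7 ⊕ con 2660016468900000000 ⊗ # 9 · # 3 ≼ con 2 ⊗ # 0 ⊕ # 8)
  ∷ (con 1499971635161043791 ⊗ # 6 ⊕ con 5320032937800000000 ⊗ # 2 · con 2 ⊗ # 0 ⊕ # 8 ≼ # 3)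
  ∷ (con 5320032937800000000 ⊕ con 2239983477200000000 ⊗ # 7 ⊕ con 3820061302638956209 ⊗ # 0 ⊕
     con 2660016468900000000 ⊗ # 9
      · con 2 ⊗ # 6 ⊕ # 9 ≼ # 3)
  ∷ (con 1499971635161043791 ⊗ # 8 ⊕ con 2239983477200000000 ⊗ # 9 · # 0 ≼ # 6 ⊕ # 7)
  ∷ (con 10640065875600000000 ⊗ # 6 ⊕ con 1499971635161043791 ⊗ # 3 · # 6 ⊕ # 7 ≼ # 0)
  ∷ (con 5320032937800000000 ⊗ # 3 · # 1 ⊕ con 1 ⊕ # 2 ≼ con 3 ⊗ # 0)
  ∷ (con 7560016415000000000 ⊗ # 7 ⊕ con 1540024730300000000 ⊗ # 9 · # 0 ⊕ con 1 ≼ con 2 ⊗ # 6)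
  ∷ (con 319997639600000000 ⊗ # 7 ⊕ con 380002352700000000 ⊗ # 9
      · # 8 ⊗ con 7 ≼ con 6 ⊗ # 0 ⊕ con 11767)
  ∷ (con 2660016468900000000 ⊗ # 8 · # 0 ≼ con 2 ⊗ # 2)
  ∷ (con 4159988104061043791 ⊗ # 8 ⊕ con 4160006893322087582 ⊗ # 7 ⊕ con 22456138956209 ⊗ # 9
      · con 200000000 ≼ # 0) ∷ [])
  (p₁ , p₂ , p₃ , ≤-reflexive p₄ , ≤-reflexive (sym p₄) , ≤-reflexive (sym p₅) ,
   ≤-reflexive p₆ , ≤-reflexive (sym p₆) , ≤-reflexive (sym p₇) , p₈ , p₉ , p₁₀ , p₁₁ , tt)

module Majority {n k q h e} (G : Graph n) (rg : Range n k q h e) (reg : ∀ i → ∑ (Triangles.a G i) ≡ k)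
    (few : ∑³ (Triangles.tri G) ≤ 6 * (h * e)) (X : Fin n → Bool)
    (major : q + 1 ≤ ∑ (λ u → 𝟙 (X u)))
    (stable : ∀ u → X u ≡ true → ∑ (λ w → Triangles.a G u w * 𝟙 (X w)) ≤ h)
    (sparse : Degrees.volume (induced G X) ≤ n * 375375) where
  open Triangles G
  open Range rg

  Y : Fin n → Bool
  Y u = not (X u)

  Gˣ : Graph n
  Gˣ = induced G X

  open Triangles Gˣ using () renaming (a to aˣ)
  open Degrees Gˣ renaming (deg to D; volume to V; ∑deg² to Q)

  |X| |Y| : ℕ
  |X| = ∑ (λ u → 𝟙 (X u))
  |Y| = ∑ (λ u → 𝟙 (Y u))

  dˣ dʸ : Fin n → ℕ
  dˣ u = ∑ (λ w → a u w * 𝟙 (X w))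
  dʸ u = ∑ (λ w → a u w * 𝟙 (Y w))

  dˣ+dʸ : ∀ u → dˣ u + dʸ u ≡ k
  dˣ+dʸ u = trans (sym (∑-+ (λ w → a u w * 𝟙 (X w)) (λ w → a u w * 𝟙 (Y w))))
    (trans (∑-cong (λ w → bool-≡ 2 (λ { (x ∷ y ∷ []) → 𝟙 x * 𝟙 y + 𝟙 x * 𝟙 (not y) }) (λ { (x ∷ y ∷ []) → 𝟙 x })
             (adj G u w ∷ X w ∷ []))) (reg u))

  aˣ≡ : ∀ u w → aˣ u w ≡ 𝟙 (X u) * (a u w * 𝟙 (X w))
  aˣ≡ u w = bool-≡ 3 (λ { (x ∷ y ∷ z ∷ []) → 𝟙 (x ∧ y ∧ z) }) (λ { (x ∷ y ∷ z ∷ []) → 𝟙 y * (𝟙 x * 𝟙 z) })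
    (adj G u w ∷ X u ∷ X w ∷ [])

  D≡ : ∀ u → D u ≡ 𝟙 (X u) * dˣ u
  D≡ u = trans (∑-cong (aˣ≡ u)) (∑-*ˡ (𝟙 (X u)) (λ w → a u w * 𝟙 (X w)))

  D≡dˣ : ∀ {u} → X u ≡ true → D u ≡ dˣ u
  D≡dˣ {u} p = trans (D≡ u) (trans (cong (λ b → 𝟙 b * dˣ u) p) (*-identityˡ (dˣ u)))

  D≤h : ∀ u → D u ≤ h
  D≤h u = ≤-trans (≤-reflexive (D≡ u)) (𝟙-*≤′ (X u) (stable u))

  |X|+|Y| : |X| + |Y| ≡ n
  |X|+|Y| = ∑𝟙+∑𝟙not X

  |Y|≤q : |Y| ≤ q
  |Y|≤q = minority-size n q |X| |Y| n≡ |X|+|Y| major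

  j Vʸ R : ℕ
  j  = q ∸ |Y|
  Vʸ = ∑ (λ u → 𝟙 (Y u) * dʸ u)
  R  = Vʸ + 4 * (h * j)

  V≡ : V ≡ 2 * h + R
  V≡ = ≤-antisym (volume-excess  n q h k |X| |Y| j V Vʸ between n≡ k≡ |X|+|Y| |Y|+j X-total Y-total)
                 (volume-excess′ n q h k |X| |Y| j V Vʸ between n≡ k≡ |X|+|Y| |Y|+j X-total Y-total)
    where
    |Y|+j : |Y| + j ≡ q
    |Y|+j = m+[n∸m]≡n |Y|≤q
    between : ℕ
    between = ∑ (λ u → 𝟙 (X u) * dʸ u)
    total : ∀ (p : Fin n → Bool) → ∑ (λ u → 𝟙 (p u) * dˣ u) + ∑ (λ u → 𝟙 (p u) * dʸ u) ≡ ∑ (λ u → 𝟙 (p u)) * k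
    total p = trans (sym (∑-+ (λ u → 𝟙 (p u) * dˣ u) (λ u → 𝟙 (p u) * dʸ u)))
      (trans (∑-cong (λ u → trans (sym (*-distribˡ-+ (𝟙 (p u)) (dˣ u) (dʸ u))) (cong (𝟙 (p u) *_) (dˣ+dʸ u))))
             (∑-*ʳ k (λ u → 𝟙 (p u))))
    X-total : V + between ≡ |X| * k
    X-total = trans (cong (_+ between) (∑-cong D≡)) (total X)
    symmetric : ∑ (λ u → 𝟙 (Y u) * dˣ u) ≡ between
    symmetric = trans (∑-cong (λ u → sym (∑-*ˡ (𝟙 (Y u)) (λ w → a u w * 𝟙 (X w)))))
      (trans (∑-swap (λ u w → 𝟙 (Y u) * (a u w * 𝟙 (X w))))
      (trans (∑∑-cong (λ w u → trans (cong (λ x → 𝟙 (Y u) * (x * 𝟙 (X w))) (a-sym u w))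
               (bool-≡ 3 (λ { (x ∷ y ∷ z ∷ []) → 𝟙 y * (𝟙 x * 𝟙 z) }) (λ { (x ∷ y ∷ z ∷ []) → 𝟙 z * (𝟙 x * 𝟙 y) })
                 (adj G w u ∷ Y u ∷ X w ∷ []))))
             (∑-cong (λ w → ∑-*ˡ (𝟙 (X w)) (λ u → a w u * 𝟙 (Y u))))))
    Y-total : Vʸ + between ≡ |Y| * k
    Y-total = trans (+-comm Vʸ between) (trans (cong (_+ Vʸ) (sym symmetric)) (total Y))

  2h≤V : 2 * h ≤ V
  2h≤V = ≤-trans (m≤m+n (2 * h) R) (≤-reflexive (sym V≡))

  tʸ : Fin n → Fin n → ℕ
  tʸ u w = ∑ (λ z → a u z * a w z * 𝟙 (Y z))

  dʸ+dʸ≤ : ∀ u w → dʸ u + dʸ w ≤ tʸ u w + |Y|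
  dʸ+dʸ≤ u w = begin
    dʸ u + dʸ w
      ≡⟨ ∑-+ (λ z → a u z * 𝟙 (Y z)) (λ z → a w z * 𝟙 (Y z)) ⟨
    ∑ (λ z → a u z * 𝟙 (Y z) + a w z * 𝟙 (Y z))
      ≤⟨ ∑-mono (λ z → bool-≤ 3 (λ { (x ∷ y ∷ s ∷ []) → 𝟙 x * 𝟙 s + 𝟙 y * 𝟙 s }) (λ { (x ∷ y ∷ s ∷ []) → 𝟙 x * 𝟙 y * 𝟙 s + 𝟙 s })
           (adj G u z ∷ adj G w z ∷ Y z ∷ [])) ⟩
    ∑ (λ z → a u z * a w z * 𝟙 (Y z) + 𝟙 (Y z))
      ≡⟨ ∑-+ (λ z → a u z * a w z * 𝟙 (Y z)) (λ z → 𝟙 (Y z)) ⟩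
    tʸ u w + |Y| ∎
    where open ≤-Reasoning

  edge-inside : ∀ {u w} → adj Gˣ u w ≡ true → X u ≡ true × X w ≡ true
  edge-inside {u} {w} p = ∧-true (proj₂ (∧-true {adj G u w} p))

  common-Y : ∀ u w → adj Gˣ u w ≡ true → 4 * h ≤ tʸ u w + q + D u + D w
  common-Y u w p = common-arith h q k (D u) (D w) (dʸ u) (dʸ w) (tʸ u w) |Y| k≡
    (trans (cong (_+ dʸ u) (D≡dˣ (proj₁ (edge-inside p)))) (dˣ+dʸ u))
    (trans (cong (_+ dʸ w) (D≡dˣ (proj₂ (edge-inside {u} p)))) (dˣ+dʸ w)) (dʸ+dʸ≤ u w) |Y|≤q

  TT : ℕ
  TT = ∑ (λ u → ∑ (λ w → aˣ u w * tʸ u w))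

  -- In an ordered triangle with exactly two vertices in `X`, the one in `Y` can stand in three
  -- positions; `TT` counts one of them.
  3TT≤ : TT + TT + TT ≤ ∑³ tri
  3TT≤ = begin
    TT + TT + TT
      ≡⟨ cong₂ _+_ (cong₂ _+_ TT≡ (trans TT≡ (sym (∑³-swap₂₃ f)))) (trans TT≡ (sym (trans (∑³-swap₁₂ f₁) (∑³-swap₂₃ f)))) ⟩
    ∑³ f + ∑³ f₁ + ∑³ f₂
      ≡⟨ trans (∑³-+ _ f₂) (cong (_+ ∑³ f₂) (∑³-+ f f₁)) ⟨
    ∑³ (λ u v w → f u v w + f₁ u v w + f₂ u v w)
      ≤⟨ ∑³-mono bound ⟩
    ∑³ tri ∎
    where
    open ≤-Reasoning
    f f₁ f₂ : Fin n → Fin n → Fin n → ℕ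
    f  u v w = tri u v w * 𝟙 (X u ∧ X v ∧ Y w)
    f₁ u v w = f u w v
    f₂ u v w = f v w u
    TT≡ : TT ≡ ∑³ f
    TT≡ = ∑∑-cong (λ u v → trans (sym (∑-*ˡ (aˣ u v) (λ z → a u z * a v z * 𝟙 (Y z))))
      (∑-cong (λ z → bool-≡ 6 (λ { (x ∷ y ∷ s ∷ b ∷ c ∷ d ∷ []) → 𝟙 (x ∧ b ∧ c) * (𝟙 y * 𝟙 s * 𝟙 d) })
        (λ { (x ∷ y ∷ s ∷ b ∷ c ∷ d ∷ []) → 𝟙 x * (𝟙 y * 𝟙 s) * 𝟙 (b ∧ c ∧ d) })
        (adj G u v ∷ adj G u z ∷ adj G v z ∷ X u ∷ X v ∷ Y z ∷ []))))
    bound : ∀ u v w → f u v w + f₁ u v w + f₂ u v w ≤ tri u v w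
    bound u v w rewrite sym (tri-swap₂₃ u v w) | trans (tri-swap₂₃ v w u) (sym (tri-swap₁₂ u v w)) =
      one-pattern (tri u v w) (X u) (X v) (X w)
      where
      one-pattern : ∀ t x y z → t * 𝟙 (x ∧ y ∧ not z) + t * 𝟙 (x ∧ z ∧ not y) + t * 𝟙 (y ∧ z ∧ not x) ≤ t
      one-pattern t x y z = ≤-trans (≤-reflexive (trans (cong (_+ t * 𝟙 (y ∧ z ∧ not x)) (sym (*-distribˡ-+ t (𝟙 (x ∧ y ∧ not z)) (𝟙 (x ∧ z ∧ not y)))))
        (sym (*-distribˡ-+ t (𝟙 (x ∧ y ∧ not z) + 𝟙 (x ∧ z ∧ not y)) _))))
        (≤-trans (*-monoʳ-≤ t (bool-≤ 3 (λ { (x ∷ y ∷ z ∷ []) → 𝟙 (x ∧ y ∧ not z) + 𝟙 (x ∧ z ∧ not y) + 𝟙 (y ∧ z ∧ not x) }) (λ _ → 1) (x ∷ y ∷ z ∷ [])))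
          (≤-reflexive (*-identityʳ t)))

  TT≤ : TT ≤ 2 * (h * e)
  TT≤ = third TT (∑³ tri) (h * e) 3TT≤ few

  -- A threshold τe in place of 3e/10 would bound the number of inner edges up to a constant by h/(1
  -- - τ). This must be below 3h/2 for `final-arith`, so τ has to be less than 1/3.
  L : Fin n → Bool
  L u = not (D u * 10 ≤ᵇ 3 * e)

  L-false : ∀ u → L u ≡ false → D u * 10 ≤ 3 * e
  L-false u p with D u * 10 ≤ᵇ 3 * e in eq
  ... | true = ≤ᵇ-true eq

  M ℓ : ℕ
  M = ∑ (λ u → ∑ (λ w → aˣ u w * 𝟙 (not (L u ∧ L w))))
  ℓ = ∑ (λ u → 𝟙 (L u))

  0<e : NonZero e
  0<e = >-nonZero (positive e (≤-trans large (e-large n q h e n≡ e≡ 2q<5h)))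
    where
    positive : ∀ e → 1000000000 ≤ e * 10 → 1 ≤ e
    positive e p₁ =
      certify (e ∷ []) 999999999
      (con 1) (# 0)
       ((con 1 · con 1000000000 ≼ # 0 ⊗ con 10) ∷ [])
      (p₁ , tt)

  M≤ : M * 7 ≤ 20 * h
  M≤ = *-cancelʳ-≤ (M * 7) (20 * h) e {{0<e}} (M-arith M e TT h (begin
    M * (7 * e)
      ≡⟨ trans (∑-cong (λ u → ∑-*ʳ (7 * e) (λ w → aˣ u w * 𝟙 (not (L u ∧ L w))))) (∑-*ʳ (7 * e) (λ u → ∑ (λ w → aˣ u w * 𝟙 (not (L u ∧ L w))))) ⟨
    ∑ (λ u → ∑ (λ w → aˣ u w * 𝟙 (not (L u ∧ L w)) * (7 * e)))
      ≤⟨ ∑∑-mono bound ⟩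
    ∑ (λ u → ∑ (λ w → aˣ u w * tʸ u w * 10))
      ≡⟨ trans (∑-cong (λ u → ∑-*ʳ 10 (λ w → aˣ u w * tʸ u w))) (∑-*ʳ 10 (λ u → ∑ (λ w → aˣ u w * tʸ u w))) ⟩
    TT * 10 ∎) TT≤)
    where
    open ≤-Reasoning
    inner : ∀ u w → adj Gˣ u w ≡ true → 𝟙 (not (L u ∧ L w)) * (7 * e) ≤ tʸ u w * 10
    inner u w p with L u in eu | L w in ew
    ... | true  | true  = z≤n
    ... | false | _     = ≤-trans (≤-reflexive (*-identityˡ (7 * e)))
      (small-end h q e (tʸ u w) (D u) (D w) (common-Y u w p) e≡ (L-false u eu) (D≤h w))
    ... | true  | false = ≤-trans (≤-reflexive (*-identityˡ (7 * e)))
      (small-end′ h q e (tʸ u w) (D u) (D w) (common-Y u w p) e≡ (L-false w ew) (D≤h u))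
    bound : ∀ u w → aˣ u w * 𝟙 (not (L u ∧ L w)) * (7 * e) ≤ aˣ u w * tʸ u w * 10
    bound u w = ≤-trans (≤-reflexive (*-assoc (aˣ u w) _ (7 * e))) (≤-trans (𝟙-*≤ (adj Gˣ u w) (inner u w)) (≤-reflexive (sym (*-assoc (aˣ u w) (tʸ u w) 10))))

  V≤M+ℓ² : V ≤ M + ℓ * ℓ
  V≤M+ℓ² = begin
    V
      ≤⟨ ∑∑-mono (λ u w → bool-≤ 3 (λ { (x ∷ y ∷ z ∷ []) → 𝟙 x }) (λ { (x ∷ y ∷ z ∷ []) → 𝟙 x * 𝟙 (not (y ∧ z)) + 𝟙 y * 𝟙 z })
           (adj Gˣ u w ∷ L u ∷ L w ∷ [])) ⟩
    ∑ (λ u → ∑ (λ w → aˣ u w * 𝟙 (not (L u ∧ L w)) + 𝟙 (L u) * 𝟙 (L w)))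
      ≡⟨ ∑∑-+ (λ u w → aˣ u w * 𝟙 (not (L u ∧ L w))) (λ u w → 𝟙 (L u) * 𝟙 (L w)) ⟩
    M + ∑ (λ u → ∑ (λ w → 𝟙 (L u) * 𝟙 (L w)))
      ≡⟨ cong (M +_) (trans (∑-cong (λ u → ∑-*ˡ (𝟙 (L u)) (λ w → 𝟙 (L w)))) (∑-*ʳ ℓ (λ u → 𝟙 (L u)))) ⟩
    M + ℓ * ℓ ∎
    where open ≤-Reasoning

  ℓ*3e≤ : ℓ * (3 * e) ≤ V * 10
  ℓ*3e≤ = begin
    ℓ * (3 * e)                    ≡⟨ ∑-*ʳ (3 * e) (λ u → 𝟙 (L u)) ⟨
    ∑ (λ u → 𝟙 (L u) * (3 * e))    ≤⟨ ∑-mono (λ u → 𝟙-*≤′ (L u) (≤ᵇ-false {D u * 10})) ⟩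
    ∑ (λ u → D u * 10)             ≡⟨ ∑-*ʳ 10 D ⟩
    V * 10 ∎
    where open ≤-Reasoning

  ℓ≤ : ℓ ≤ 41
  ℓ≤ = *-cancelʳ-≤ ℓ 41 e {{0<e}} (ℓ-second ℓ e V M h n ℓ*3e≤ V≤M+ℓ² M≤ (h≤2e q h e e≡ 2q<5h)
    (*-cancelʳ-≤ ℓ 12512500 e {{0<e}} (ℓ-first ℓ e V n ℓ*3e≤ sparse n≤10e)) large n≤10e)
    where
    n≤10e : n ≤ e * 10
    n≤10e = e-large n q h e n≡ e≡ 2q<5h

  R≤ : R * 7 ≤ 6 * h + 11767
  R≤ = volume-bound V M ℓ h R V≤M+ℓ² M≤ ℓ≤ (≤-reflexive (sym V≡))

  square-sum : 4 * h * V ≤ TT + q * V + 2 * Q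
  square-sum = begin
    4 * h * V
      ≡⟨ trans (∑-cong (λ u → ∑-*ˡ (4 * h) (aˣ u))) (∑-*ˡ (4 * h) D) ⟨
    ∑ (λ u → ∑ (λ w → 4 * h * aˣ u w))
      ≤⟨ ∑∑-mono bound ⟩
    ∑ (λ u → ∑ (λ w → aˣ u w * tʸ u w + q * aˣ u w + aˣ u w * D u + aˣ u w * D w))
      ≡⟨ trans (∑∑-+ _ (λ u w → aˣ u w * D w)) (cong₂ _+_ (trans (∑∑-+ _ (λ u w → aˣ u w * D u)) (cong₂ _+_
          (trans (∑∑-+ (λ u w → aˣ u w * tʸ u w) (λ u w → q * aˣ u w)) (cong (TT +_) (trans (∑-cong (λ u → ∑-*ˡ q (aˣ u))) (∑-*ˡ q D))))
          (∑∑-a-left D))) (∑∑-a-right D)) ⟩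
    TT + q * V + Q + Q
      ≡⟨ trans (+-assoc (TT + q * V) Q Q) (cong (λ x → TT + q * V + (Q + x)) (sym (+-identityʳ Q))) ⟩
    TT + q * V + 2 * Q ∎
    where
    open ≤-Reasoning
    bound : ∀ u w → 4 * h * aˣ u w ≤ aˣ u w * tʸ u w + q * aˣ u w + aˣ u w * D u + aˣ u w * D w
    bound u w = scaled (adj Gˣ u w) (tʸ u w) (D u) (D w) (common-Y u w)
      where
      scaled : ∀ b t x y → (b ≡ true → 4 * h ≤ t + q + x + y) → 4 * h * 𝟙 b ≤ 𝟙 b * t + q * 𝟙 b + 𝟙 b * x + 𝟙 b * y
      scaled false t x y p rewrite *-zeroʳ (4 * h) = z≤n
      scaled true  t x y p rewrite *-identityʳ (4 * h) | *-identityˡ t | *-identityʳ q | *-identityˡ x | *-identityˡ y = p refl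

  module Maximum (v : Fin n) (max : ∀ u → D u ≤ D v) where

    Q≤ : Q ≤ V * D v
    Q≤ = ≤-trans (∑-mono (λ u → *-monoʳ-≤ (D u) (max u))) (≤-reflexive (∑-*ʳ (D v) D))

    V-nonZero : NonZero V
    V-nonZero = >-nonZero (≤-trans (two h (h-large n q h n≡ 2q<5h large)) 2h≤V)
      where
      two : ∀ h → 200000000 ≤ h → 1 ≤ 2 * h
      two h p₁ =
        certify (h ∷ []) 199999999
        (con 1) (con 2 ⊗ # 0)
         ((con 1 · con 200000000 ≼ # 0) ∷ [])
        (p₁ , tt)

    h<2D : h + 1 ≤ 2 * D v
    h<2D = *-cancelʳ-≤ (h + 1) (2 * D v) V {{V-nonZero}} (Δ-arith h q e V TT Q (D v) square-sum TT≤ Q≤ 2h≤V e≡)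

    module Del = Deletion Gˣ v

    R+p≤0 : R + (h ∸ D v) ≤ 0
    R+p≤0 = final-arith h q e V TT Q (D v) (h ∸ D v) R Del.D⁻.volume square-sum TT≤ (4∑deg²-star Gˣ v) V≡
      (trans Del.volume-split (regroup (D v) Del.D⁻.volume)) (sym (m+[n∸m]≡n (D≤h v))) e≡ h<2D R≤ (h≤2e q h e e≡ 2q<5h) (h-large n q h n≡ 2q<5h large)
      where
      regroup : ∀ d s → d + s + d ≡ 2 * d + s
      regroup d s = ≤-antisym (certify (d ∷ s ∷ []) 0 (# 0 ⊕ # 1 ⊕ # 0) (con 2 ⊗ # 0 ⊕ # 1) [] tt)
                              (certify (d ∷ s ∷ []) 0 (con 2 ⊗ # 0 ⊕ # 1) (# 0 ⊕ # 1 ⊕ # 0) [] tt)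

-- Structure forced by a star with `h` edges.

Y-size : ∀ n q x y → n ≡ 1 + 2 * q → x + y ≡ n → x ≡ q + 1 → y ≤ q
Y-size n q x y p₁ p₂ p₃ =
  certify (n ∷ q ∷ x ∷ y ∷ []) 0
  (# 3) (# 1)
   ((con 1 · # 0 ≼ con 1 ⊕ con 2 ⊗ # 1)
  ∷ (con 1 · # 2 ⊕ # 3 ≼ # 0)
  ∷ (con 1 · # 1 ⊕ con 1 ≼ # 2) ∷ [])
  (≤-reflexive p₁ , ≤-reflexive p₂ , ≤-reflexive (sym p₃) , tt)
Y-size′ : ∀ n q x y → n ≡ 1 + 2 * q → x + y ≡ n → x ≡ q + 1 → q ≤ y
Y-size′ n q x y p₁ p₂ p₃ =
  certify (n ∷ q ∷ x ∷ y ∷ []) 0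
  (# 1) (# 3)
   ((con 1 · con 1 ⊕ con 2 ⊗ # 1 ≼ # 0)
  ∷ (con 1 · # 0 ≼ # 2 ⊕ # 3)
  ∷ (con 1 · # 2 ≼ # 1 ⊕ con 1) ∷ [])
  (≤-reflexive (sym p₁) , ≤-reflexive (sym p₂) , ≤-reflexive p₃ , tt)
X⁻-size : ∀ q x y → x ≡ q + 1 → y + 1 ≡ x → y ≤ q
X⁻-size q x y p₁ p₂ =
  certify (q ∷ x ∷ y ∷ []) 0
  (# 2) (# 0)
   ((con 1 · # 1 ≼ # 0 ⊕ con 1)
  ∷ (con 1 · # 2 ⊕ con 1 ≼ # 1) ∷ [])
  (≤-reflexive p₁ , ≤-reflexive p₂ , tt)
X⁻-size′ : ∀ q x y → x ≡ q + 1 → y + 1 ≡ x → q ≤ y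
X⁻-size′ q x y p₁ p₂ =
  certify (q ∷ x ∷ y ∷ []) 0
  (# 0) (# 2)
   ((con 1 · # 0 ⊕ con 1 ≼ # 1)
  ∷ (con 1 · # 1 ≼ # 2 ⊕ con 1) ∷ [])
  (≤-reflexive (sym p₁) , ≤-reflexive (sym p₂) , tt)
other-half : ∀ k h x y → k ≡ 2 * h → x + y ≡ k → x ≡ h → y ≤ h
other-half k h x y p₁ p₂ p₃ =
  certify (k ∷ h ∷ x ∷ y ∷ []) 0
  (# 3) (# 1)
   ((con 1 · # 0 ≼ con 2 ⊗ # 1)
  ∷ (con 1 · # 2 ⊕ # 3 ≼ # 0)
  ∷ (con 1 · # 1 ≼ # 2) ∷ [])
  (≤-reflexive p₁ , ≤-reflexive p₂ , ≤-reflexive (sym p₃) , tt)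
other-half′ : ∀ k h x y → k ≡ 2 * h → x + y ≡ k → x ≡ h → h ≤ y
other-half′ k h x y p₁ p₂ p₃ =
  certify (k ∷ h ∷ x ∷ y ∷ []) 0
  (# 1) (# 3)
   ((con 1 · con 2 ⊗ # 1 ≼ # 0)
  ∷ (con 1 · # 0 ≼ # 2 ⊕ # 3)
  ∷ (con 1 · # 2 ≼ # 1) ∷ [])
  (≤-reflexive (sym p₁) , ≤-reflexive (sym p₂) , ≤-reflexive p₃ , tt)
-- Besides `v`, a neighbour of `v` has 2h - 1 neighbours, all on the opposite side. At most q - h of
-- them are not adjacent to `v`, and 2h - 1 - (q - h) is e.
e≤into : ∀ k h q e x y z → k ≡ 2 * h → 3 * h ≡ q + 1 + e → x + y + 1 ≡ k → z + h ≡ q → y ≤ z →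
  e ≤ x
e≤into k h q e x y z p₁ p₂ p₃ p₄ p₅ =
  certify (k ∷ h ∷ q ∷ e ∷ x ∷ y ∷ z ∷ []) 0
  (# 3) (# 4)
   ((con 1 · con 2 ⊗ # 1 ≼ # 0)
  ∷ (con 1 · # 2 ⊕ con 1 ⊕ # 3 ≼ con 3 ⊗ # 1)
  ∷ (con 1 · # 0 ≼ # 4 ⊕ # 5 ⊕ con 1)
  ∷ (con 1 · # 6 ⊕ # 1 ≼ # 2)
  ∷ (con 1 · # 5 ≼ # 6) ∷ [])
  (≤-reflexive (sym p₁) , ≤-reflexive (sym p₂) , ≤-reflexive (sym p₃) , ≤-reflexive p₄ , p₅ , tt)
full-arith : ∀ k h q e x y z → k ≡ 2 * h → 3 * h ≡ q + 1 + e → x + y + 1 ≡ k → z + h ≡ q →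
  x ≡ e → z ≤ y
full-arith k h q e x y z p₁ p₂ p₃ p₄ p₅ =
  certify (k ∷ h ∷ q ∷ e ∷ x ∷ y ∷ z ∷ []) 0
  (# 6) (# 5)
   ((con 1 · con 2 ⊗ # 1 ≼ # 0)
  ∷ (con 1 · # 2 ⊕ con 1 ⊕ # 3 ≼ con 3 ⊗ # 1)
  ∷ (con 1 · # 0 ≼ # 4 ⊕ # 5 ⊕ con 1)
  ∷ (con 1 · # 6 ⊕ # 1 ≼ # 2)
  ∷ (con 1 · # 4 ≼ # 3) ∷ [])
  (≤-reflexive (sym p₁) , ≤-reflexive (sym p₂) , ≤-reflexive (sym p₃) , ≤-reflexive p₄ ,
   ≤-reflexive p₅ , tt)
rest-into : ∀ k h q x y z r → k ≡ 2 * h → x + y ≡ k → x ≡ h → z + h ≡ q → r + y ≡ z →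
  r + 2 * h ≤ q
rest-into k h q x y z r p₁ p₂ p₃ p₄ p₅ =
  certify (k ∷ h ∷ q ∷ x ∷ y ∷ z ∷ r ∷ []) 0
  (# 6 ⊕ con 2 ⊗ # 1) (# 2)
   ((con 1 · con 2 ⊗ # 1 ≼ # 0)
  ∷ (con 1 · # 0 ≼ # 3 ⊕ # 4)
  ∷ (con 1 · # 3 ≼ # 1)
  ∷ (con 1 · # 5 ⊕ # 1 ≼ # 2)
  ∷ (con 1 · # 6 ⊕ # 4 ≼ # 5) ∷ [])
  (≤-reflexive (sym p₁) , ≤-reflexive (sym p₂) , ≤-reflexive p₃ , ≤-reflexive p₄ ,
   ≤-reflexive p₅ , tt)
rest-into′ : ∀ k h q x y z r → k ≡ 2 * h → x + y ≡ k → x ≡ h → z + h ≡ q → r + y ≡ z →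
  q ≤ r + 2 * h
rest-into′ k h q x y z r p₁ p₂ p₃ p₄ p₅ =
  certify (k ∷ h ∷ q ∷ x ∷ y ∷ z ∷ r ∷ []) 0
  (# 2) (# 6 ⊕ con 2 ⊗ # 1)
   ((con 1 · # 0 ≼ con 2 ⊗ # 1)
  ∷ (con 1 · # 3 ⊕ # 4 ≼ # 0)
  ∷ (con 1 · # 1 ≼ # 3)
  ∷ (con 1 · # 2 ≼ # 5 ⊕ # 1)
  ∷ (con 1 · # 5 ≼ # 6 ⊕ # 4) ∷ [])
  (≤-reflexive p₁ , ≤-reflexive p₂ , ≤-reflexive (sym p₃) , ≤-reflexive (sym p₄) ,
   ≤-reflexive (sym p₅) , tt)
same-total : ∀ h q e r → r + e ≡ h → 3 * h ≡ q + 1 + e → r + 2 * h ≤ q + 1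
same-total h q e r p₁ p₂ =
  certify (h ∷ q ∷ e ∷ r ∷ []) 0
  (# 3 ⊕ con 2 ⊗ # 0) (# 1 ⊕ con 1)
   ((con 1 · # 3 ⊕ # 2 ≼ # 0)
  ∷ (con 1 · con 3 ⊗ # 0 ≼ # 1 ⊕ con 1 ⊕ # 2) ∷ [])
  (≤-reflexive p₁ , ≤-reflexive p₂ , tt)
same-total′ : ∀ h q e r → r + e ≡ h → 3 * h ≡ q + 1 + e → q + 1 ≤ r + 2 * h
same-total′ h q e r p₁ p₂ =
  certify (h ∷ q ∷ e ∷ r ∷ []) 0
  (# 1 ⊕ con 1) (# 3 ⊕ con 2 ⊗ # 0)
   ((con 1 · # 0 ≼ # 3 ⊕ # 2)
  ∷ (con 1 · # 1 ⊕ con 1 ⊕ # 2 ≼ con 3 ⊗ # 0) ∷ [])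
  (≤-reflexive (sym p₁) , ≤-reflexive (sym p₂) , tt)

half-n : ∀ {n q} → n ≡ 1 + 2 * q → (n ∸ 1) / 2 ≡ q
half-n {q = q} refl = trans (cong (_/ 2) (*-comm 2 q)) (m*n/n≡m q 2)

half-k : ∀ {k h} → k ≡ 2 * h → k / 2 ≡ h
half-k {h = h} refl = trans (cong (_/ 2) (*-comm 2 h)) (m*n/n≡m h 2)

factor₁ : ∀ {n k q h r} → n ≡ 1 + 2 * q → k ≡ 2 * h → 2 * h ≤ q → r + 2 * h ≡ q + 1 → ((n ∸ 2 * k) + 1) / 2 ≡ r
factor₁ {q = q} {h} {r} refl refl le eq = trans (cong (_/ 2) (begin
  (1 + 2 * q ∸ 2 * (2 * h)) + 1  ≡⟨ +-comm _ 1 ⟩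
  1 + (1 + 2 * q ∸ 2 * (2 * h))  ≡⟨ +-∸-assoc 1 fits ⟨
  2 + 2 * q ∸ 2 * (2 * h)        ≡⟨ cong (_∸ 2 * (2 * h)) total ⟩
  r * 2 + 2 * (2 * h) ∸ 2 * (2 * h) ≡⟨ m+n∸n≡m (r * 2) (2 * (2 * h)) ⟩
  r * 2 ∎)) (m*n/n≡m r 2)
  where
  open ≡-Reasoning
  total : 2 + 2 * q ≡ r * 2 + 2 * (2 * h)
  total = ≤-antisym (up q h r eq) (down q h r eq)
    where
    up : ∀ q h r → r + 2 * h ≡ q + 1 → 2 + 2 * q ≤ r * 2 + 2 * (2 * h)
    up q h r p₁ =
      certify (q ∷ h ∷ r ∷ []) 0
      (con 2 ⊕ con 2 ⊗ # 0) (# 2 ⊗ con 2 ⊕ con 2 ⊗ (con 2 ⊗ # 1))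
       ((con 2 · # 0 ⊕ con 1 ≼ # 2 ⊕ con 2 ⊗ # 1) ∷ [])
      (≤-reflexive (sym p₁) , tt)
    down : ∀ q h r → r + 2 * h ≡ q + 1 → r * 2 + 2 * (2 * h) ≤ 2 + 2 * q
    down q h r p₁ =
      certify (q ∷ h ∷ r ∷ []) 0
      (# 2 ⊗ con 2 ⊕ con 2 ⊗ (con 2 ⊗ # 1)) (con 2 ⊕ con 2 ⊗ # 0)
       ((con 2 · # 2 ⊕ con 2 ⊗ # 1 ≼ # 0 ⊕ con 1) ∷ [])
      (≤-reflexive p₁ , tt)
  fits : 2 * (2 * h) ≤ 1 + 2 * q
  fits = m≤n⇒m≤1+n (*-monoʳ-≤ 2 le)

factor₂ : ∀ {n k q h r} → n ≡ 1 + 2 * q → k ≡ 2 * h → r + 2 * h ≡ q → (n ∸ 2 * k ∸ 1) / 2 ≡ r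
factor₂ {q = q} {h} {r} refl refl eq = trans (cong (_/ 2) (begin
  1 + 2 * q ∸ 2 * (2 * h) ∸ 1    ≡⟨ ∸-+-assoc (1 + 2 * q) (2 * (2 * h)) 1 ⟩
  1 + 2 * q ∸ (2 * (2 * h) + 1)  ≡⟨ cong (_∸ (2 * (2 * h) + 1)) total ⟩
  r * 2 + (2 * (2 * h) + 1) ∸ (2 * (2 * h) + 1) ≡⟨ m+n∸n≡m (r * 2) (2 * (2 * h) + 1) ⟩
  r * 2 ∎)) (m*n/n≡m r 2)
  where
  open ≡-Reasoning
  total : 1 + 2 * q ≡ r * 2 + (2 * (2 * h) + 1)
  total = ≤-antisym (up q h r eq) (down q h r eq)
    where
    up : ∀ q h r → r + 2 * h ≡ q → 1 + 2 * q ≤ r * 2 + (2 * (2 * h) + 1)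
    up q h r p₁ =
      certify (q ∷ h ∷ r ∷ []) 0
      (con 1 ⊕ con 2 ⊗ # 0) (# 2 ⊗ con 2 ⊕ (con 2 ⊗ (con 2 ⊗ # 1) ⊕ con 1))
       ((con 2 · # 0 ≼ # 2 ⊕ con 2 ⊗ # 1) ∷ [])
      (≤-reflexive (sym p₁) , tt)
    down : ∀ q h r → r + 2 * h ≡ q → r * 2 + (2 * (2 * h) + 1) ≤ 1 + 2 * q
    down q h r p₁ =
      certify (q ∷ h ∷ r ∷ []) 0
      (# 2 ⊗ con 2 ⊕ (con 2 ⊗ (con 2 ⊗ # 1) ⊕ con 1)) (con 1 ⊕ con 2 ⊗ # 0)
       ((con 2 · # 2 ⊕ con 2 ⊗ # 1 ≼ # 0) ∷ [])
      (≤-reflexive p₁ , tt)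

-- Here x, y are the sides of two vertices other than `v`, α, β their adjacencies to `v`, and z
-- their own adjacency. Opposite pairs with α = β lie in one of the two removed pieces, which delete
-- exactly the missing edges; opposite pairs with α ≠ β are never removed and must be edges.
built : ∀ x y α β z → (agree x y ≡ true → z ≡ false) → (agree x y ≡ false → agree α β ≡ false → z ≡ true) →
  z ≡ ((x ∧ not y) ∨ (not x ∧ y))
    ∧ not ((((α ∧ x) ∧ (β ∧ not y)) ∨ ((α ∧ not x) ∧ (β ∧ y))) ∧ not z)
    ∧ not ((((x ∧ not (α ∧ x)) ∧ (not y ∧ not (β ∧ not y))) ∨ ((not x ∧ not (α ∧ not x)) ∧ (y ∧ not (β ∧ y)))) ∧ not z)
built true  true  α β z p _ rewrite p refl = refl
built false false α β z p _ rewrite p refl = refl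
built true  false true  true  true  _ _ = refl
built true  false true  true  false _ _ = refl
built true  false false false true  _ _ = refl
built true  false false false false _ _ = refl
built true  false true  false z _ p rewrite p refl refl = refl
built true  false false true  z _ p rewrite p refl refl = refl
built false true  true  true  true  _ _ = refl
built false true  true  true  false _ _ = refl
built false true  false false true  _ _ = refl
built false true  false false false _ _ = refl
built false true  true  false z _ p rewrite p refl refl = refl
built false true  false true  z _ p rewrite p refl refl = refl

removed : ∀ {n} (G : Graph n) (S U : Fin n → Bool) → (∀ i → S i ∧ U i ≡ false) → Graph n
removed G S U disjoint = record
  { adj    = λ i j → ((S i ∧ U j) ∨ (U i ∧ S j)) ∧ not (adj G i j)
  ; sym    = λ i j → cong₂ (λ b c → b ∧ not c)
      (trans (∨-comm (S i ∧ U j) (U i ∧ S j)) (cong₂ _∨_ (∧-comm (U i) (S j)) (∧-comm (S i) (U j)))) (adj-sym G i j)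
  ; irrefl = λ i → loop (S i) (U i) (disjoint i) }
  where
  loop : ∀ b c {x} → b ∧ c ≡ false → ((b ∧ c) ∨ (c ∧ b)) ∧ x ≡ false
  loop true  false _ = refl
  loop false true  _ = refl
  loop false false _ = refl

module Extremal {n k q h e} (G : Graph n) (rg : Range n k q h e) (reg : ∀ i → ∑ (Triangles.a G i) ≡ k)
    (X : Fin n → Bool) (v : Fin n) (Xv : X v ≡ true) (|X|≡ : ∑ (λ u → 𝟙 (X u)) ≡ q + 1)
    (X-independent : ∀ u w → X u ≡ true → X w ≡ true → ¬ (u ≡ v) → ¬ (w ≡ v) → adj G u w ≡ false)
    (Y-independent : ∀ u w → X u ≡ false → X w ≡ false → adj G u w ≡ false)
    (v-degree : ∑ (λ w → Triangles.a G v w * 𝟙 (X w)) ≡ h) where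
  open Triangles G
  open Range rg

  X⁻ Y A B : Fin n → Bool
  X⁻ u = if ⌊ u ≟ v ⌋ then false else X u
  Y  u = not (X u)
  A  u = adj G v u ∧ X u
  B  u = adj G v u ∧ Y u

  _∖_ : (S C : Fin n → Bool) → Fin n → Bool
  (S ∖ C) u = S u ∧ not (C u)

  size : (Fin n → Bool) → ℕ
  size S = ∑ (λ u → 𝟙 (S u))

  into : (Fin n → Bool) → Fin n → ℕ
  into S u = ∑ (λ w → a u w * 𝟙 (S w))

  contains : ∀ b c → (c ≡ true → b ≡ true) → 𝟙 b ≡ 𝟙 c + 𝟙 (b ∧ not c)
  contains true  true  _ = refl
  contains true  false _ = refl
  contains false false _ = refl
  contains false true  p with p refl
  ... | ()

  size-split : ∀ {S C} → (∀ u → C u ≡ true → S u ≡ true) → size S ≡ size C + size (S ∖ C)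
  size-split {S} {C} p = trans (∑-cong (λ u → contains (S u) (C u) (p u))) (∑-+ (λ u → 𝟙 (C u)) (λ u → 𝟙 ((S ∖ C) u)))

  into-split : ∀ {S C} → (∀ u → C u ≡ true → S u ≡ true) → ∀ u → into S u ≡ into C u + into (S ∖ C) u
  into-split {S} {C} p u = trans
    (∑-cong (λ w → trans (cong (a u w *_) (contains (S w) (C w) (p w))) (*-distribˡ-+ (a u w) (𝟙 (C w)) _)))
    (∑-+ (λ w → a u w * 𝟙 (C w)) (λ w → a u w * 𝟙 ((S ∖ C) w)))

  edge≤ : ∀ (S : Fin n → Bool) u w → a u w * 𝟙 (S w) ≤ 𝟙 (S w)
  edge≤ S u w = ≤-trans (*-monoˡ-≤ (𝟙 (S w)) (𝟙≤1 (adj G u w))) (≤-reflexive (*-identityˡ _))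

  into≤size : ∀ S u → into S u ≤ size S
  into≤size S u = ∑-mono (edge≤ S u)

  missing+into : ∀ S u → ∑ (λ w → 𝟙 (S w ∧ not (adj G u w))) + into S u ≡ size S
  missing+into S u = trans (sym (∑-+ (λ w → 𝟙 (S w ∧ not (adj G u w))) (λ w → a u w * 𝟙 (S w))))
    (∑-cong (λ w → bool-≡ 2 (λ { (x ∷ y ∷ []) → 𝟙 (y ∧ not x) + 𝟙 x * 𝟙 y }) (λ { (x ∷ y ∷ []) → 𝟙 y }) (adj G u w ∷ S w ∷ [])))

  into-full : ∀ S u → (∀ w → S w ≡ true → adj G u w ≡ true) → into S u ≡ size S
  into-full S u p = ∑-cong (λ w → all w (S w) (p w))
    where
    all : ∀ w b → (b ≡ true → adj G u w ≡ true) → a u w * 𝟙 b ≡ 𝟙 b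
    all w true  p rewrite p refl = refl
    all w false p = *-zeroʳ (a u w)

  full : ∀ S u → size S ≤ into S u → ∀ w → S w ≡ true → adj G u w ≡ true
  full S u le w p = 𝟙≡1 (adj G u w) (sym (begin
    1                  ≡⟨ cong 𝟙 p ⟨
    𝟙 (S w)            ≡⟨ ∑-tight (λ w → 𝟙 (S w)) (λ w → a u w * 𝟙 (S w)) (edge≤ S u) le w ⟩
    a u w * 𝟙 (S w)    ≡⟨ cong (λ b → a u w * 𝟙 b) p ⟩
    a u w * 1          ≡⟨ *-identityʳ (a u w) ⟩
    a u w ∎))
    where open ≡-Reasoning

  -- Both (X⁻ , A , Y , B) and (Y , B , X⁻ , A) are instances.
  module Half (S C S′ C′ : Fin n → Bool)
      (C′⊆S′ : ∀ u → C′ u ≡ true → S′ u ≡ true) (|S′| : size S′ ≡ q) (|C| : size C ≡ h) (|C′| : size C′ ≡ h)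
      (C-degree : ∀ u → C u ≡ true → into S′ u + 1 ≡ k)
      (rest-degree : ∀ u → S u ≡ true → C u ≡ false → into S′ u ≡ k) where

    |S′∖C′| : size (S′ ∖ C′) + h ≡ q
    |S′∖C′| = trans (trans (cong (size (S′ ∖ C′) +_) (sym |C′|)) (+-comm _ (size C′))) (trans (sym (size-split C′⊆S′)) |S′|)

    C-total : ∀ u → C u ≡ true → into C′ u + into (S′ ∖ C′) u + 1 ≡ k
    C-total u p = trans (cong (_+ 1) (sym (into-split C′⊆S′ u))) (C-degree u p)

    e≤into-C′ : ∀ u → C u ≡ true → e ≤ into C′ u
    e≤into-C′ u p = e≤into k h q e (into C′ u) _ _ k≡ e≡ (C-total u p) |S′∖C′| (into≤size (S′ ∖ C′) u)

    edges : ℕ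
    edges = ∑ (λ u → 𝟙 (C u) * into C′ u)

    -- The edges between the neighbours of `v` on the two sides correspond to triangles through `v`,
    -- so this is the lower bound on the number of triangles.
    h*e≤edges : h * e ≤ edges
    h*e≤edges = ≤-trans (≤-reflexive (trans (cong (_* e) (sym |C|)) (sym (∑-*ʳ e (λ u → 𝟙 (C u))))))
      (∑-mono (λ u → 𝟙-*≤ (C u) (e≤into-C′ u)))

    module Tight (tight : edges ≤ h * e) where

      into-C′≡e : ∀ u → C u ≡ true → into C′ u ≡ e
      into-C′≡e u p = begin
        into C′ u               ≡⟨ *-identityˡ _ ⟨
        1 * into C′ u           ≡⟨ cong (λ b → 𝟙 b * into C′ u) p ⟨
        𝟙 (C u) * into C′ u     ≡⟨ ∑-tight (λ u → 𝟙 (C u) * into C′ u) (λ u → 𝟙 (C u) * e) (λ u → 𝟙-*≤ (C u) (e≤into-C′ u))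
                                     (≤-trans tight (≤-reflexive (trans (cong (_* e) (sym |C|)) (sym (∑-*ʳ e (λ u → 𝟙 (C u))))))) u ⟩
        𝟙 (C u) * e             ≡⟨ cong (λ b → 𝟙 b * e) p ⟩
        1 * e                   ≡⟨ *-identityˡ e ⟩
        e ∎
        where open ≡-Reasoning

      C-full : ∀ u w → C u ≡ true → (S′ ∖ C′) w ≡ true → adj G u w ≡ true
      C-full u w p = full (S′ ∖ C′) u (full-arith k h q e (into C′ u) _ _ k≡ e≡ (C-total u p) |S′∖C′| (into-C′≡e u p)) w

      -- Exactly h - e edges are absent at `u`, and h - e = q + 1 - 2h is (n - 2k + 1)/2, the degree
      -- of the first factor.
      C-missing : ∀ u → C u ≡ true → ∑ (λ w → 𝟙 (C′ w ∧ not (adj G u w))) + 2 * h ≡ q + 1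
      C-missing u p = ≤-antisym (same-total h q e _ total e≡) (same-total′ h q e _ total e≡)
        where
        total : ∑ (λ w → 𝟙 (C′ w ∧ not (adj G u w))) + e ≡ h
        total = trans (cong (_ +_) (sym (into-C′≡e u p))) (trans (missing+into C′ u) |C′|)

      -- Tightness of the opposite half joins `u` to all `h` vertices of `C′`. Its other `h`
      -- neighbours lie among the q - h remaining vertices, so q - 2h = (n - 2k - 1)/2 are missed.
      rest-missing : (∀ u w → C′ u ≡ true → (S ∖ C) w ≡ true → adj G u w ≡ true) →
        ∀ u → (S ∖ C) u ≡ true → ∑ (λ w → 𝟙 ((S′ ∖ C′) w ∧ not (adj G u w))) + 2 * h ≡ q
      rest-missing C′-full u p = ≤-antisym
        (rest-into  k h q (into C′ u) _ _ _ k≡ total whole |S′∖C′| (missing+into (S′ ∖ C′) u))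
        (rest-into′ k h q (into C′ u) _ _ _ k≡ total whole |S′∖C′| (missing+into (S′ ∖ C′) u))
        where
        total : into C′ u + into (S′ ∖ C′) u ≡ k
        total = trans (sym (into-split C′⊆S′ u)) (rest-degree u (proj₁ (∧-true p)) (not-true (proj₂ (∧-true {S u} p))))
        whole : into C′ u ≡ h
        whole = trans (into-full C′ u (λ w q → trans (adj-sym G u w) (C′-full w u q p))) |C′|

  |Y| : size Y ≡ q
  |Y| = ≤-antisym (Y-size n q _ _ n≡ (∑𝟙+∑𝟙not X) |X|≡) (Y-size′ n q _ _ n≡ (∑𝟙+∑𝟙not X) |X|≡)

  not-v : ∀ b u → (⌊ u ≟ v ⌋ ≡ true → b ≡ true) → 𝟙 (if ⌊ u ≟ v ⌋ then false else b) + 𝟙 ⌊ u ≟ v ⌋ * 1 ≡ 𝟙 b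
  not-v b u p with u ≟ v
  ... | yes _ rewrite p refl = refl
  ... | no _  = +-identityʳ (𝟙 b)

  at-v : ∀ u → ⌊ u ≟ v ⌋ ≡ true → X u ≡ true
  at-v u p with u ≟ v
  ... | yes refl = Xv

  |X⁻| : size X⁻ ≡ q
  |X⁻| = ≤-antisym (X⁻-size q _ _ |X|≡ total) (X⁻-size′ q _ _ |X|≡ total)
    where
    total : size X⁻ + 1 ≡ size X
    total = trans (cong (size X⁻ +_) (sym (∑-single v (λ _ → 1))))
      (trans (sym (∑-+ (λ u → 𝟙 (X⁻ u)) (λ u → 𝟙 ⌊ u ≟ v ⌋ * 1))) (∑-cong (λ u → not-v (X u) u (at-v u))))

  into-Y-v : into Y v ≡ h
  into-Y-v = ≤-antisym (other-half k h _ _ k≡ total v-degree) (other-half′ k h _ _ k≡ total v-degree)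
    where
    total : into X v + into Y v ≡ k
    total = trans (sym (∑-+ (λ w → a v w * 𝟙 (X w)) (λ w → a v w * 𝟙 (Y w))))
      (trans (∑-cong (λ w → bool-≡ 2 (λ { (x ∷ y ∷ []) → 𝟙 x * 𝟙 y + 𝟙 x * 𝟙 (not y) }) (λ { (x ∷ y ∷ []) → 𝟙 x })
               (adj G v w ∷ X w ∷ []))) (reg v))

  |A| : size A ≡ h
  |A| = trans (∑-cong (λ w → 𝟙-∧ (adj G v w) (X w))) v-degree

  |B| : size B ≡ h
  |B| = trans (∑-cong (λ w → 𝟙-∧ (adj G v w) (Y w))) into-Y-v

  X⁻⇒ : ∀ {u} → X⁻ u ≡ true → X u ≡ true × ¬ (u ≡ v)
  X⁻⇒ {u} p with u ≟ v
  ... | no u≢v = p , u≢v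

  A⊆X⁻ : ∀ u → A u ≡ true → X⁻ u ≡ true
  A⊆X⁻ u p with u ≟ v
  ... | no _ = proj₂ (∧-true {adj G v u} p)
  ... | yes refl with trans (sym (proj₁ (∧-true p))) (adj-irrefl G v)
  ...   | ()

  B⊆Y : ∀ u → B u ≡ true → Y u ≡ true
  B⊆Y u p = proj₂ (∧-true {adj G v u} p)

  total-degree : ∀ u → a u v + into X⁻ u + into Y u ≡ k
  total-degree u = begin
    a u v + into X⁻ u + into Y u
      ≡⟨ cong (λ x → x + into X⁻ u + into Y u) (∑-single v (a u)) ⟨
    ∑ (λ w → 𝟙 ⌊ w ≟ v ⌋ * a u w) + into X⁻ u + into Y u
      ≡⟨ trans (∑-+ _ (λ w → a u w * 𝟙 (Y w))) (cong (_+ into Y u) (∑-+ (λ w → 𝟙 ⌊ w ≟ v ⌋ * a u w) (λ w → a u w * 𝟙 (X⁻ w)))) ⟨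
    ∑ (λ w → 𝟙 ⌊ w ≟ v ⌋ * a u w + a u w * 𝟙 (X⁻ w) + a u w * 𝟙 (Y w))
      ≡⟨ ∑-cong cell ⟩
    ∑ (a u)
      ≡⟨ reg u ⟩
    k ∎
    where
    open ≡-Reasoning
    cell : ∀ w → 𝟙 ⌊ w ≟ v ⌋ * a u w + a u w * 𝟙 (X⁻ w) + a u w * 𝟙 (Y w) ≡ a u w
    cell w with w ≟ v
    ... | yes refl rewrite Xv = bool-≡ 1 (λ { (x ∷ []) → 1 * 𝟙 x + 𝟙 x * 0 + 𝟙 x * 0 }) (λ { (x ∷ []) → 𝟙 x }) (adj G u v ∷ [])
    ... | no _ = bool-≡ 2 (λ { (x ∷ y ∷ []) → 0 + 𝟙 x * 𝟙 y + 𝟙 x * 𝟙 (not y) }) (λ { (x ∷ y ∷ []) → 𝟙 x }) (adj G u w ∷ X w ∷ [])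

  into-none : ∀ S u → (∀ w → S w ≡ true → adj G u w ≡ false) → into S u ≡ 0
  into-none S u p = trans (∑-cong (λ w → none w (S w) (p w))) (∑-0 n)
    where
    none : ∀ w b → (b ≡ true → adj G u w ≡ false) → a u w * 𝟙 b ≡ 0
    none w true  p rewrite p refl = refl
    none w false p = *-zeroʳ (a u w)

  X⁻-degree : ∀ u → X⁻ u ≡ true → into Y u + a u v ≡ k
  X⁻-degree u p = trans (+-comm (into Y u) (a u v)) (trans (cong (_+ into Y u) (sym (trans (cong (a u v +_)
    (into-none X⁻ u (λ w q → X-independent u w (proj₁ (X⁻⇒ p)) (proj₁ (X⁻⇒ q)) (proj₂ (X⁻⇒ p)) (proj₂ (X⁻⇒ q))))) (+-identityʳ _)))) (total-degree u))

  Y-degree : ∀ u → Y u ≡ true → into X⁻ u + a u v ≡ k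
  Y-degree u p = trans (+-comm (into X⁻ u) (a u v)) (trans (sym (trans (cong (a u v + into X⁻ u +_)
    (into-none Y u (λ w q → Y-independent u w (not-true p) (not-true q)))) (+-identityʳ _))) (total-degree u))

  v-adjacent : ∀ u b → adj G v u ≡ b → a u v ≡ 𝟙 b
  v-adjacent u b p = cong 𝟙 (trans (adj-sym G u v) p)

  ∧-left-false : ∀ {b c} → c ≡ true → b ∧ c ≡ false → b ≡ false
  ∧-left-false {false} _    _ = refl
  ∧-left-false {true}  refl ()

  module HalfX = Half X⁻ A Y B B⊆Y |Y| |A| |B|
    (λ u p → trans (cong (into Y u +_) (sym (v-adjacent u true (proj₁ (∧-true p))))) (X⁻-degree u (A⊆X⁻ u p)))
    (λ u p q → trans (sym (trans (cong (into Y u +_) (v-adjacent u false (∧-left-false (proj₁ (X⁻⇒ p)) q))) (+-identityʳ _))) (X⁻-degree u p))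

  module HalfY = Half Y B X⁻ A A⊆X⁻ |X⁻| |B| |A|
    (λ u p → trans (cong (into X⁻ u +_) (sym (v-adjacent u true (proj₁ (∧-true p))))) (Y-degree u (B⊆Y u p)))
    (λ u p q → trans (sym (trans (cong (into X⁻ u +_) (v-adjacent u false (∧-left-false p q))) (+-identityʳ _))) (Y-degree u p))

  edges-symmetric : HalfY.edges ≡ HalfX.edges
  edges-symmetric = trans (∑-cong (λ u → sym (∑-*ˡ (𝟙 (B u)) (λ w → a u w * 𝟙 (A w)))))
    (trans (∑-swap (λ u w → 𝟙 (B u) * (a u w * 𝟙 (A w))))
    (trans (∑∑-cong (λ w u → trans (cong (λ x → 𝟙 (B u) * (x * 𝟙 (A w))) (a-sym u w))
             (bool-≡ 3 (λ { (x ∷ y ∷ z ∷ []) → 𝟙 y * (𝟙 x * 𝟙 z) }) (λ { (x ∷ y ∷ z ∷ []) → 𝟙 z * (𝟙 x * 𝟙 y) })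
               (adj G w u ∷ B u ∷ A w ∷ []))))
           (∑-cong (λ w → ∑-*ˡ (𝟙 (A w)) (λ u → a w u * 𝟙 (B u))))))

  module Family (tight : HalfX.edges ≤ h * e) where
    module TX = HalfX.Tight tight
    module TY = HalfY.Tight (≤-trans (≤-reflexive edges-symmetric) tight)

    disjoint₁ : ∀ i → A i ∧ B i ≡ false
    disjoint₁ i with adj G v i | X i
    ... | true  | true  = refl
    ... | true  | false = refl
    ... | false | _     = refl

    disjoint₂ : ∀ i → (X⁻ ∖ A) i ∧ (Y ∖ B) i ≡ false
    disjoint₂ i with i ≟ v
    ... | yes _ = refl
    ... | no _ with adj G v i | X i
    ...   | true  | true  = refl
    ...   | true  | false = refl
    ...   | false | true  = refl
    ...   | false | false = refl

    H₁ H₂ : Graph n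
    H₁ = removed G A B disjoint₁
    H₂ = removed G (X⁻ ∖ A) (Y ∖ B) disjoint₂

    removed-degree : ∀ S U d i r → (S i ≡ true → ∑ (λ w → 𝟙 (U w ∧ not (adj G i w))) ≡ r) →
      (U i ≡ true → ∑ (λ w → 𝟙 (S w ∧ not (adj G i w))) ≡ r) → S i ∨ U i ≡ true → degree (removed G S U d) i ≡ r
    removed-degree S U d i r p q c with S i | U i | d i
    ... | true  | false | _ = trans (count≡∑ _) (trans (∑-cong (λ w → cong (λ b → 𝟙 (b ∧ not (adj G i w))) (∨-identityʳ (U w)))) (p refl))
    ... | false | true  | _ = trans (count≡∑ _) (q refl)

    factor-H₁ : IsBipFactor A B (((n ∸ 2 * k) + 1) / 2) H₁
    factor-H₁ = (λ i j p → proj₁ (∧-true p)) , λ i → removed-degree A B disjoint₁ i _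
      (λ p → sym (factor₁ {h = h} n≡ k≡ 2h≤q (TX.C-missing i p))) (λ p → sym (factor₁ {h = h} n≡ k≡ 2h≤q (TY.C-missing i p)))

    factor-H₂ : IsBipFactor (X⁻ ∖ A) (Y ∖ B) ((n ∸ 2 * k ∸ 1) / 2) H₂
    factor-H₂ = (λ i j p → proj₁ (∧-true p)) , λ i → removed-degree (X⁻ ∖ A) (Y ∖ B) disjoint₂ i _
      (λ p → sym (factor₂ {h = h} n≡ k≡ (TX.rest-missing TY.C-full i p))) (λ p → sym (factor₂ {h = h} n≡ k≡ (TY.rest-missing TX.C-full i p)))

    same-side : ∀ i j → ¬ (i ≡ v) → ¬ (j ≡ v) → agree (X i) (X j) ≡ true → adj G i j ≡ false
    same-side i j i≢v j≢v p with X i in xi | X j in xj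
    ... | true  | true  = X-independent i j xi xj i≢v j≢v
    ... | false | false = Y-independent i j xi xj

    X⁻-intro : ∀ {i} → ¬ (i ≡ v) → X i ≡ true → X⁻ i ≡ true
    X⁻-intro {i} i≢v p with i ≟ v
    ... | yes e = ⊥-elim (i≢v e)
    ... | no _  = p

    opposite-sides : ∀ i j → ¬ (i ≡ v) → ¬ (j ≡ v) → agree (X i) (X j) ≡ false →
      agree (adj G v i) (adj G v j) ≡ false → adj G i j ≡ true
    opposite-sides i j i≢v j≢v p r with X i in xi | X j in xj | adj G v i in vi | adj G v j in vj
    ... | true  | false | true  | false = TX.C-full i j (cong₂ _∧_ vi xi) (cong₂ (λ x y → not x ∧ not (y ∧ not x)) xj vj)
    ... | true  | false | false | true  = trans (adj-sym G i j) (TY.C-full j i (cong₂ (λ x y → x ∧ not y) vj xj)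
      (cong₂ _∧_ (X⁻-intro i≢v xi) (cong₂ (λ x y → not (y ∧ x)) xi vi)))
    ... | false | true  | true  | false = TY.C-full i j (cong₂ (λ x y → x ∧ not y) vi xi)
      (cong₂ _∧_ (X⁻-intro j≢v xj) (cong₂ (λ x y → not (y ∧ x)) xj vj))
    ... | false | true  | false | true  = trans (adj-sym G i j) (TX.C-full j i (cong₂ _∧_ vj xj) (cong₂ (λ x y → not x ∧ not (y ∧ not x)) xi vi))

    either : ∀ b c → b ≡ (b ∧ c) ∨ (b ∧ not c)
    either true  true  = refl
    either true  false = refl
    either false _     = refl

    adj≡built : ∀ i j → adj G i j ≡ builtAdj v X⁻ Y A B H₁ H₂ i j
    adj≡built i j with i ≟ v | j ≟ v
    ... | yes refl | _ = either (adj G v j) (X j)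
    ... | no _ | yes refl = trans (adj-sym G i v) (either (adj G v i) (X i))
    ... | no i≢v | no j≢v = built (X i) (X j) (adj G v i) (adj G v j) (adj G i j)
      (same-side i j i≢v j≢v) (opposite-sides i j i≢v j≢v)

    sides : ∀ i → (i ≡ v → ⊥) → (X⁻ i ∨ Y i ≡ true) × (X⁻ i ∧ Y i ≡ false)
    sides i i≢v with i ≟ v
    ... | yes e = ⊥-elim (i≢v e)
    ... | no _ with X i
    ...   | true  = refl , refl
    ...   | false = refl , refl

    X⁻v : X⁻ v ≡ false
    X⁻v with v ≟ v
    ... | yes _ = refl
    ... | no v≢v = ⊥-elim (v≢v refl)

    in-family : InFamily n k G
    in-family = v , X⁻ , Y , A , B , H₁ , H₂ , X⁻v , cong not Xv , sides
      , trans (count≡∑ X⁻) (trans |X⁻| (sym (half-n n≡))) , trans (count≡∑ Y) (trans |Y| (sym (half-n n≡)))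
      , A⊆X⁻ , B⊆Y
      , trans (count≡∑ A) (trans |A| (sym (half-k k≡))) , trans (count≡∑ B) (trans |B| (sym (half-k k≡)))
      , factor-H₁ , factor-H₂ , adj≡built

-- From the vanishing excess to the extremal family.

X-size : ∀ n q x y → n ≡ 1 + 2 * q → x + y ≡ n → q ≤ y → x ≤ q + 1
X-size n q x y p₁ p₂ p₃ =
  certify (n ∷ q ∷ x ∷ y ∷ []) 0
  (# 2) (# 1 ⊕ con 1)
   ((con 1 · # 0 ≼ con 1 ⊕ con 2 ⊗ # 1)
  ∷ (con 1 · # 2 ⊕ # 3 ≼ # 0)
  ∷ (con 1 · # 1 ≼ # 3) ∷ [])
  (≤-reflexive p₁ , ≤-reflexive p₂ , p₃ , tt)
X-size′ : ∀ n q x y → n ≡ 1 + 2 * q → x + y ≡ n → y ≤ q → q + 1 ≤ x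
X-size′ n q x y p₁ p₂ p₃ =
  certify (n ∷ q ∷ x ∷ y ∷ []) 0
  (# 1 ⊕ con 1) (# 2)
   ((con 1 · con 1 ⊕ con 2 ⊗ # 1 ≼ # 0)
  ∷ (con 1 · # 0 ≼ # 2 ⊕ # 3)
  ∷ (con 1 · # 3 ≼ # 1) ∷ [])
  (≤-reflexive (sym p₁) , ≤-reflexive (sym p₂) , p₃ , tt)
nothing-left : ∀ h V R S d → V ≡ 2 * h + R → V ≡ d + S + d → h ≤ d → R ≤ 0 → S ≤ 0
nothing-left h V R S d p₁ p₂ p₃ p₄ =
  certify (h ∷ V ∷ R ∷ S ∷ d ∷ []) 0
  (# 3) (con 0)
   ((con 1 · # 1 ≼ con 2 ⊗ # 0 ⊕ # 2)
  ∷ (con 1 · # 4 ⊕ # 3 ⊕ # 4 ≼ # 1)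
  ∷ (con 2 · # 0 ≼ # 4)
  ∷ (con 1 · # 2 ≼ con 0) ∷ [])
  (≤-reflexive p₁ , ≤-reflexive (sym p₂) , p₃ , p₄ , tt)
h*j-zero : ∀ h j c → c + 4 * (h * j) ≤ 0 → h * j ≤ 0
h*j-zero h j c p₁ =
  certify (h ∷ j ∷ c ∷ []) 3
  (# 0 ⊗ # 1) (con 0)
   ((con 1 · # 2 ⊕ con 4 ⊗ (# 0 ⊗ # 1) ≼ con 0) ∷ [])
  (p₁ , tt)
c-zero : ∀ c x → c + 4 * x ≤ 0 → c ≤ 0
c-zero c x p₁ =
  certify (c ∷ x ∷ []) 0
  (# 0) (con 0)
   ((con 1 · # 0 ⊕ con 4 ⊗ # 1 ≼ con 0) ∷ [])
  (p₁ , tt)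
R-zero : ∀ R p → R + p ≤ 0 → R ≤ 0
R-zero R p p₁ =
  certify (R ∷ p ∷ []) 0
  (# 0) (con 0)
   ((con 1 · # 0 ⊕ # 1 ≼ con 0) ∷ [])
  (p₁ , tt)
p-zero : ∀ R p → R + p ≤ 0 → p ≤ 0
p-zero R p p₁ =
  certify (R ∷ p ∷ []) 0
  (# 1) (con 0)
   ((con 1 · # 0 ⊕ # 1 ≼ con 0) ∷ [])
  (p₁ , tt)
half-TT : ∀ r TT x → r + r ≤ TT → TT ≤ 2 * x → r ≤ x
half-TT r TT x p₁ p₂ =
  certify (r ∷ TT ∷ x ∷ []) 1
  (# 0) (# 2)
   ((con 1 · # 0 ⊕ # 0 ≼ # 1)
  ∷ (con 1 · # 1 ≼ con 2 ⊗ # 2) ∷ [])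
  (p₁ , p₂ , tt)
six-times : ∀ r TT S x → r + r ≤ TT → TT + TT + TT ≤ S → x ≤ r → 6 * x ≤ S
six-times r TT S x p₁ p₂ p₃ =
  certify (r ∷ TT ∷ S ∷ x ∷ []) 0
  (con 6 ⊗ # 3) (# 2)
   ((con 3 · # 0 ⊕ # 0 ≼ # 1)
  ∷ (con 1 · # 1 ⊕ # 1 ⊕ # 1 ≼ # 2)
  ∷ (con 6 · # 3 ≼ # 0) ∷ [])
  (p₁ , p₂ , p₃ , tt)
h-positive : ∀ h → 200000000 ≤ h → 1 ≤ h
h-positive h p₁ =
  certify (h ∷ []) 199999999
  (con 1) (# 0)
   ((con 1 · con 200000000 ≼ # 0) ∷ [])
  (p₁ , tt)

module Conclusion {n k q h e} (G : Graph n) (rg : Range n k q h e) (reg : ∀ i → ∑ (Triangles.a G i) ≡ k)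
    (few : ∑³ (Triangles.tri G) ≤ 6 * (h * e)) (X : Fin n → Bool)
    (major : q + 1 ≤ ∑ (λ u → 𝟙 (X u)))
    (stable : ∀ u → X u ≡ true → ∑ (λ w → Triangles.a G u w * 𝟙 (X w)) ≤ h)
    (sparse : Degrees.volume (induced G X) ≤ n * 375375) (v : Fin n)
    (max : ∀ u → Degrees.deg (induced G X) u ≤ Degrees.deg (induced G X) v) where
  open Triangles G
  open Range rg
  open Majority G rg reg few X major stable sparse
  open Triangles Gˣ using () renaming (a to aˣ)
  open Degrees Gˣ using () renaming (deg to D; volume to V)
  open Maximum v max

  0<h : 1 ≤ h
  0<h = h-positive h (h-large n q h n≡ 2q<5h large)

  R≤0 : R ≤ 0
  R≤0 = R-zero R (h ∸ D v) R+p≤0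

  h≤Dv : h ≤ D v
  h≤Dv = m∸n≡0⇒m≤n (n≤0⇒n≡0 (p-zero R (h ∸ D v) R+p≤0))

  Xv : X v ≡ true
  Xv = inside (X v) (≤-trans 0<h (≤-trans h≤Dv (≤-reflexive (D≡ v))))
    where
    inside : ∀ b {d} → 1 ≤ 𝟙 b * d → b ≡ true
    inside true  _ = refl
    inside false ()

  v-degree : dˣ v ≡ h
  v-degree = trans (sym (D≡dˣ Xv)) (≤-antisym (D≤h v) h≤Dv)

  q≤|Y| : q ≤ |Y|
  q≤|Y| = m∸n≡0⇒m≤n (zero-factor h j 0<h (h*j-zero h j Vʸ R≤0))
    where
    zero-factor : ∀ h j → 1 ≤ h → h * j ≤ 0 → j ≡ 0
    zero-factor (suc h) zero    _ _ = refl

  |X|≡ : |X| ≡ q + 1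
  |X|≡ = ≤-antisym (X-size n q |X| |Y| n≡ |X|+|Y| q≤|Y|) (X-size′ n q |X| |Y| n≡ |X|+|Y| |Y|≤q)

  -- The volume of `X` is now exactly 2h, and the star at `v` with `h` edges already uses it up.
  X-independent : ∀ u w → X u ≡ true → X w ≡ true → ¬ (u ≡ v) → ¬ (w ≡ v) → adj G u w ≡ false
  X-independent u w xu xw u≢v w≢v = absent (adj G u w) (cong₂ _∧_ (sym xu) (sym xw)) (cong₂ (λ b c → not b ∧ not c) (differ u u≢v) (differ w w≢v))
    (∑≡0 (Del.T⁻.a u) (∑≡0 Del.D⁻.deg (n≤0⇒n≡0 (nothing-left h V R Del.D⁻.volume (D v) V≡ Del.volume-split h≤Dv R≤0)) u) w)
    where
    differ : ∀ u → ¬ (u ≡ v) → ⌊ u ≟ v ⌋ ≡ false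
    differ u u≢v with u ≟ v
    ... | yes p = ⊥-elim (u≢v p)
    ... | no _  = refl
    absent : ∀ x {b c} → true ≡ b → c ≡ true → 𝟙 ((x ∧ b) ∧ c) ≡ 0 → x ≡ false
    absent false _    _    _ = refl
    absent true  refl refl ()

  Y-independent : ∀ u w → X u ≡ false → X w ≡ false → adj G u w ≡ false
  Y-independent u w xu xw = absent (adj G u w) xw (∑≡0 (λ w → a u w * 𝟙 (Y w)) (factor (X u) xu
      (∑≡0 (λ u → 𝟙 (Y u) * dʸ u) (n≤0⇒n≡0 (c-zero Vʸ (h * j) R≤0)) u)) w)
    where
    factor : ∀ b {d} → b ≡ false → 𝟙 (not b) * d ≡ 0 → d ≡ 0
    factor false {d} refl p = trans (sym (*-identityˡ d)) p
    absent : ∀ x {b} → b ≡ false → 𝟙 x * 𝟙 (not b) ≡ 0 → x ≡ false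
    absent false _    _ = refl
    absent true  refl ()

  open Extremal G rg reg X v Xv |X|≡ X-independent Y-independent v-degree using (A; B; into; module HalfX; module Family)

  row : ℕ
  row = ∑ (λ u → aˣ v u * tʸ v u)

  row≡edges : row ≡ HalfX.edges
  row≡edges = ∑-cong (λ u → cong₂ _*_ (cong 𝟙 (cong (λ b → adj G v u ∧ b ∧ X u) Xv))
    (∑-cong (λ z → bool-≡ 3 (λ { (x ∷ y ∷ s ∷ []) → 𝟙 x * 𝟙 y * 𝟙 s }) (λ { (x ∷ y ∷ s ∷ []) → 𝟙 y * 𝟙 (x ∧ s) })
      (adj G v z ∷ adj G u z ∷ Y z ∷ []))))

  row+row≤TT : row + row ≤ TT
  row+row≤TT = begin
    row + row
      ≡⟨ cong₂ _+_ (trans (∑-cong (λ u → ∑-*ˡ (𝟙 ⌊ u ≟ v ⌋) (f u))) (∑-single v (λ u → ∑ (f u))))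
                   (trans (∑-cong (λ u → ∑-single v (f u))) (∑-cong (λ u → f-sym u v))) ⟨
    ∑ (λ u → ∑ (λ w → 𝟙 ⌊ u ≟ v ⌋ * f u w)) + ∑ (λ u → ∑ (λ w → 𝟙 ⌊ w ≟ v ⌋ * f u w))
      ≡⟨ ∑∑-+ (λ u w → 𝟙 ⌊ u ≟ v ⌋ * f u w) (λ u w → 𝟙 ⌊ w ≟ v ⌋ * f u w) ⟨
    ∑ (λ u → ∑ (λ w → 𝟙 ⌊ u ≟ v ⌋ * f u w + 𝟙 ⌊ w ≟ v ⌋ * f u w))
      ≤⟨ ∑∑-mono bound ⟩
    TT ∎
    where
    open ≤-Reasoning
    f : Fin n → Fin n → ℕ
    f u w = aˣ u w * tʸ u w
    f-sym : ∀ u w → f u w ≡ f w u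
    f-sym u w = cong₂ _*_ (Triangles.a-sym Gˣ u w) (∑-cong (λ z → cong (_* 𝟙 (Y z)) (*-comm (a u z) (a w z))))
    bound : ∀ u w → 𝟙 ⌊ u ≟ v ⌋ * f u w + 𝟙 ⌊ w ≟ v ⌋ * f u w ≤ f u w
    bound u w with u ≟ v | w ≟ v
    ... | yes refl | yes refl rewrite Triangles.a-irrefl Gˣ u = z≤n
    ... | yes _ | no _  = ≤-reflexive (trans (+-identityʳ _) (*-identityˡ (f u w)))
    ... | no _  | yes _ = ≤-reflexive (*-identityˡ (f u w))
    ... | no _  | no _  = z≤n

  six-he≤ : 6 * (h * e) ≤ ∑³ tri
  six-he≤ = six-times row TT (∑³ tri) (h * e) row+row≤TT 3TT≤ (≤-trans HalfX.h*e≤edges (≤-reflexive (sym row≡edges)))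

  -- Twice the number of edges between `A` and `B` is at most `TT`, hence at most 2he. This meets
  -- the lower bound `h*e≤edges` and makes it tight.
  in-family : InFamily n k G
  in-family = Family.in-family (≤-trans (≤-reflexive (sym row≡edges)) (half-TT row TT (h * e) row+row≤TT TT≤))

Extremality : ∀ {n} (k h e : ℕ) → Graph n → Set
Extremality {n} k h e G = 6 * (h * e) ≤ ∑³ (Triangles.tri G) × InFamily n k G

half-degree : ∀ k h d → k ≡ 2 * h → 2 * d ≤ k → d ≤ h
half-degree k h d p₁ p₂ =
  certify (k ∷ h ∷ d ∷ []) 1
  (# 2) (# 1)
   ((con 1 · # 0 ≼ con 2 ⊗ # 1)
  ∷ (con 1 · con 2 ⊗ # 2 ≼ # 0) ∷ [])
  (≤-reflexive p₁ , p₂ , tt)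
other-major : ∀ n q x y → n ≡ 1 + 2 * q → x + y ≡ n → x < q + 1 → q + 1 ≤ y
other-major n q x y p₁ p₂ p₃ =
  certify (n ∷ q ∷ x ∷ y ∷ []) 0
  (# 1 ⊕ con 1) (# 3)
   ((con 1 · con 1 ⊕ con 2 ⊗ # 1 ≼ # 0)
  ∷ (con 1 · # 0 ≼ # 2 ⊕ # 3)
  ∷ (con 1 · con 1 ⊕ # 2 ≼ # 1 ⊕ con 1) ∷ [])
  (≤-reflexive (sym p₁) , ≤-reflexive (sym p₂) , p₃ , tt)

few-triangles⇒extremal : ∀ {n k q h e} (G : Graph n) → Range n k q h e → (∀ i → ∑ (Triangles.a G i) ≡ k) →
  ∑³ (Triangles.tri G) ≤ 6 * (h * e) → Extremality k h e G
few-triangles⇒extremal {n} {k} {q} {h} {e} G rg reg few = from-cut (NearBipartite.stable-cut G rg reg few)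
  where
  open Range rg
  open Cut G reg
  open Triangles G

  from-side : (X : Fin n → Bool) → q + 1 ≤ ∑ (λ u → 𝟙 (X u)) →
    (∀ u → X u ≡ true → ∑ (λ w → a u w * 𝟙 (X w)) ≤ h) → Degrees.volume (induced G X) ≤ n * 375375 → Extremality k h e G
  from-side X major stable sparse = from-max (maximum n refl (Degrees.deg (induced G X)))
    where
    from-max : (∃ λ v → ∀ u → Degrees.deg (induced G X) u ≤ Degrees.deg (induced G X) v) → Extremality k h e G
    from-max (v , max) = six-he≤ , in-family
      where open Conclusion G rg reg few X major stable sparse v max
    maximum : ∀ m → m ≡ n → (f : Fin m → ℕ) → ∃ λ v → ∀ u → f u ≤ f v
    maximum (suc m) _ f = argmax f
    maximum zero    p f with subst (1000000000 ≤_) (sym p) large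
    ... | ()

  from-cut : (∃ λ s → in-edges s ≤ n * 375375 × Stable s) → Extremality k h e G
  from-cut (s , le , st) with q + 1 ≤? ∑ (λ u → 𝟙 (s u))
  ... | yes major = from-side s major
    (λ u p → half-degree k h _ k≡ (≤-trans (*-monoʳ-≤ 2 (∑-mono (λ w → same (adj G u w) (s w) p))) (st u)))
    (≤-trans (∑∑-mono (λ u w → bool-≤ 3 (λ { (x ∷ y ∷ z ∷ []) → 𝟙 (x ∧ y ∧ z) }) (λ { (x ∷ y ∷ z ∷ []) → 𝟙 x * 𝟙 (agree y z) })
      (adj G u w ∷ s u ∷ s w ∷ []))) le)
    where
    same : ∀ x c {b} → b ≡ true → 𝟙 x * 𝟙 c ≤ 𝟙 x * 𝟙 (agree b c)
    same x c refl = ≤-refl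
  ... | no minor = from-side (not ∘ s) (other-major n q (∑ (λ u → 𝟙 (s u))) _ n≡ (∑𝟙+∑𝟙not s) (≰⇒> minor))
    (λ u p → half-degree k h _ k≡ (≤-trans (*-monoʳ-≤ 2 (∑-mono (λ w → same (adj G u w) (s w) (not-true p)))) (st u)))
    (≤-trans (∑∑-mono (λ u w → bool-≤ 3 (λ { (x ∷ y ∷ z ∷ []) → 𝟙 (x ∧ not y ∧ not z) }) (λ { (x ∷ y ∷ z ∷ []) → 𝟙 x * 𝟙 (agree y z) })
      (adj G u w ∷ s u ∷ s w ∷ []))) le)
    where
    same : ∀ x c {b} → b ≡ false → 𝟙 x * 𝟙 (not c) ≤ 𝟙 x * 𝟙 (agree b c)
    same x c refl = ≤-refl

-- A graph attaining the bound

∑-++ : ∀ m {n} (f : Fin (m + n) → ℕ) → ∑ f ≡ ∑ (λ i → f (i ↑ˡ n)) + ∑ (λ j → f (m ↑ʳ j))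
∑-++ zero    f = cong (_+ ∑ f) (sym (∑-nil _))
∑-++ (suc m) {n} f rewrite ∑-suc f | ∑-suc {m} (λ i → f (i ↑ˡ n)) =
  trans (cong (f zero +_) (∑-++ m (f ∘ suc))) (sym (+-assoc (f zero) _ _))

∑-last : ∀ m (f : ℕ → ℕ) → ∑ {suc m} (f ∘ toℕ) ≡ ∑ {m} (f ∘ toℕ) + f m
∑-last zero    f = trans (∑-suc {0} (f ∘ toℕ)) (trans (cong (f 0 +_) (∑-nil _)) (trans (+-identityʳ (f 0)) (cong (_+ f 0) (sym (∑-nil _)))))
∑-last (suc m) f rewrite ∑-suc {suc m} (f ∘ toℕ) | ∑-suc {m} (f ∘ toℕ) =
  trans (cong (f 0 +_) (∑-last m (f ∘ suc))) (sym (+-assoc (f 0) _ _))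

∑-shift : ∀ m (f : ℕ → ℕ) → (∀ x → f (x + m) ≡ f x) → ∀ x → ∑ {m} (λ j → f (x + toℕ j)) ≡ ∑ {m} (f ∘ toℕ)
∑-shift m f periodic zero    = refl
∑-shift m f periodic (suc x) = trans (+-cancelˡ-≡ (f x) _ _ (begin
  f x + ∑ {m} (λ j → f (suc x + toℕ j))
    ≡⟨ cong₂ _+_ (cong f (sym (+-identityʳ x))) (∑-cong {m} (λ j → cong f (sym (+-suc x (toℕ j))))) ⟩
  f (x + 0) + ∑ {m} (λ j → f (x + suc (toℕ j)))
    ≡⟨ ∑-suc {m} (λ j → f (x + toℕ j)) ⟨
  ∑ {suc m} (λ j → f (x + toℕ j))
    ≡⟨ ∑-last m (λ y → f (x + y)) ⟩
  ∑ {m} (λ j → f (x + toℕ j)) + f (x + m)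
    ≡⟨ cong (∑ {m} (λ j → f (x + toℕ j)) +_) (periodic x) ⟩
  ∑ {m} (λ j → f (x + toℕ j)) + f x
    ≡⟨ +-comm _ (f x) ⟩
  f x + ∑ {m} (λ j → f (x + toℕ j)) ∎)) (∑-shift m f periodic x)
  where open ≡-Reasoning

∑-initial : ∀ m r → r ≤ m → ∑ {m} (λ j → 𝟙 (toℕ j <ᵇ r)) ≡ r
∑-initial m       zero    _        = ∑-0 m
∑-initial (suc m) (suc r) (s≤s le) = trans (∑-suc {m} (λ j → 𝟙 (toℕ j <ᵇ suc r))) (cong suc (∑-initial m r le))

-- For fixed x the sums x + j run once through all residues. The pattern `(i + j) % m <ᵇ r` is thus
-- r-regular, and symmetric in i and j, which lets both sides of the construction share one rule.
∑-cyclic : ∀ m .{{_ : NonZero m}} r → r ≤ m → ∀ x → ∑ {m} (λ j → 𝟙 ((x + toℕ j) % m <ᵇ r)) ≡ r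
∑-cyclic m r le x = trans (∑-shift m (λ y → 𝟙 (y % m <ᵇ r)) (λ y → cong (λ z → 𝟙 (z <ᵇ r)) ([m+n]%n≡m%n y m)) x)
  (trans (∑-cong (λ j → cong (λ z → 𝟙 (z <ᵇ r)) (m<n⇒m%n≡m (toℕ<n j)))) (∑-initial m r le))

-- Each side consists of `h` neighbours of the apex and `l = q - h` other vertices. The hypothesis
-- `sum` is the degree of a neighbour of the apex: the apex itself, `e` opposite neighbours of the
-- apex, and all `l` other opposite vertices.
module Construction (h l e : ℕ) .{{_ : NonZero h}} .{{_ : NonZero l}} (e≤h : e ≤ h) (h≤l : h ≤ l) (sum : 1 + (e + l) ≡ 2 * h) where

  Point : Set
  Point = Fin h ⊎ Fin l

  -- Points of Fin h on the two sides form A and B, points of Fin l the remainders of X and Y.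
  data Kind : Set where
    apex   : Kind
    vertex : Bool → Point → Kind

  link : Point → Point → Bool
  link (inj₁ i) (inj₁ j) = (toℕ i + toℕ j) % h <ᵇ e
  link (inj₁ _) (inj₂ _) = true
  link (inj₂ _) (inj₁ _) = true
  link (inj₂ i) (inj₂ j) = (toℕ i + toℕ j) % l <ᵇ h

  near : Point → Bool
  near (inj₁ _) = true
  near (inj₂ _) = false

  joined : Kind → Kind → Bool
  joined apex         apex         = false
  joined apex         (vertex _ y) = near y
  joined (vertex _ x) apex         = near x
  joined (vertex s x) (vertex t y) = if agree s t then false else link x y

  joined-sym : ∀ x y → joined x y ≡ joined y x
  joined-sym apex         apex         = refl
  joined-sym apex         (vertex _ _) = refl
  joined-sym (vertex _ _) apex         = refl
  joined-sym (vertex s x) (vertex t y) = cong₂ (λ b c → if b then false else c) (agree-sym s t) (link-sym x y)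
    where
    link-sym : ∀ x y → link x y ≡ link y x
    link-sym (inj₁ i) (inj₁ j) = cong (λ z → z % h <ᵇ e) (+-comm (toℕ i) (toℕ j))
    link-sym (inj₁ _) (inj₂ _) = refl
    link-sym (inj₂ _) (inj₁ _) = refl
    link-sym (inj₂ i) (inj₂ j) = cong (λ z → z % l <ᵇ h) (+-comm (toℕ i) (toℕ j))

  joined-irrefl : ∀ x → joined x x ≡ false
  joined-irrefl apex             = refl
  joined-irrefl (vertex true _)  = refl
  joined-irrefl (vertex false _) = refl

  order : ℕ
  order = suc ((h + l) + (h + l))

  kind : Fin order → Kind
  kind zero    = apex
  kind (suc i) = [ vertex true ∘ splitAt h , vertex false ∘ splitAt h ]′ (splitAt (h + l) i)

  ∑ᴾ : (Point → ℕ) → ℕ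
  ∑ᴾ f = ∑ (f ∘ inj₁) + ∑ (f ∘ inj₂)

  ∑-points : ∀ (f : Point → ℕ) → ∑ {h + l} (f ∘ splitAt h) ≡ ∑ᴾ f
  ∑-points f = trans (∑-++ h (f ∘ splitAt h))
    (cong₂ _+_ (∑-cong (λ i → cong f (splitAt-↑ˡ h i l))) (∑-cong (λ j → cong f (splitAt-↑ʳ h l j))))

  ∑-kinds : ∀ (f : Kind → ℕ) → ∑ (f ∘ kind) ≡ f apex + (∑ᴾ (f ∘ vertex true) + ∑ᴾ (f ∘ vertex false))
  ∑-kinds f = trans (∑-suc (f ∘ kind)) (cong (f apex +_) (trans (∑-++ (h + l) (f ∘ kind ∘ suc)) (cong₂ _+_
    (trans (∑-cong (λ i → cong (f ∘ [ vertex true ∘ splitAt h , vertex false ∘ splitAt h ]′) (splitAt-↑ˡ (h + l) i (h + l)))) (∑-points (f ∘ vertex true)))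
    (trans (∑-cong (λ i → cong (f ∘ [ vertex true ∘ splitAt h , vertex false ∘ splitAt h ]′) (splitAt-↑ʳ (h + l) (h + l) i))) (∑-points (f ∘ vertex false))))))

  Γ : Graph order
  Γ = record { adj = λ i j → joined (kind i) (kind j) ; sym = λ i j → joined-sym (kind i) (kind j) ; irrefl = λ i → joined-irrefl (kind i) }

  open Triangles Γ

  ∑-ones : ∀ m → ∑ {m} (λ _ → 1) ≡ m
  ∑-ones m = trans (∑-const m 1) (*-identityʳ m)

  link-degree : ∀ x → 𝟙 (near x) + ∑ᴾ (λ y → 𝟙 (link x y)) ≡ 2 * h
  link-degree (inj₁ i) = trans (cong suc (cong₂ _+_ (∑-cyclic h e e≤h (toℕ i)) (∑-ones l))) sum
  link-degree (inj₂ i) = trans (cong₂ _+_ (∑-ones h) (∑-cyclic l h h≤l (toℕ i))) (cong (h +_) (sym (+-identityʳ h)))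

  ∑ᴾ-0 : ∑ᴾ (λ _ → 0) ≡ 0
  ∑ᴾ-0 = cong₂ _+_ (∑-0 h) (∑-0 l)

  ∑ᴾ-near : ∑ᴾ (λ y → 𝟙 (near y)) ≡ h
  ∑ᴾ-near = trans (cong₂ _+_ (∑-ones h) (∑-0 l)) (+-identityʳ h)

  kind-degree : ∀ x → 𝟙 (joined x apex) + (∑ᴾ (λ y → 𝟙 (joined x (vertex true y))) + ∑ᴾ (λ y → 𝟙 (joined x (vertex false y)))) ≡ 2 * h
  kind-degree apex             = cong₂ _+_ ∑ᴾ-near (trans ∑ᴾ-near (sym (+-identityʳ h)))
  kind-degree (vertex true x)  = trans (cong (λ z → 𝟙 (near x) + (z + ∑ᴾ (λ y → 𝟙 (link x y)))) ∑ᴾ-0) (link-degree x)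
  kind-degree (vertex false x) = trans (cong (𝟙 (near x) +_) (trans (cong (∑ᴾ (λ y → 𝟙 (link x y)) +_) ∑ᴾ-0) (+-identityʳ _))) (link-degree x)

  Γ-degree : ∀ i → ∑ (a i) ≡ 2 * h
  Γ-degree i = trans (∑-kinds (λ y → 𝟙 (joined (kind i) y))) (kind-degree (kind i))

  apex-codegree : ∀ x → joined apex x ≡ true → ∑ (λ z → 𝟙 (joined apex (kind z)) * 𝟙 (joined x (kind z))) ≡ e
  apex-codegree (vertex s (inj₁ i)) _ = trans (∑-kinds (λ z → 𝟙 (joined apex z) * 𝟙 (joined (vertex s (inj₁ i)) z))) (by-side s)
    where
    opposite : ∑ᴾ (λ y → 𝟙 (near y) * 𝟙 (link (inj₁ i) y)) ≡ e
    opposite = trans (cong₂ _+_ (trans (∑-cong (λ j → *-identityˡ (𝟙 (link (inj₁ i) (inj₁ j))))) (∑-cyclic h e e≤h (toℕ i))) (∑-0 l)) (+-identityʳ e)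
    same : ∑ᴾ (λ y → 𝟙 (near y) * 0) ≡ 0
    same = cong₂ _+_ (∑-0 h) (∑-0 l)
    by-side : ∀ s → ∑ᴾ (λ y → 𝟙 (near y) * 𝟙 (joined (vertex s (inj₁ i)) (vertex true y)))
                  + ∑ᴾ (λ y → 𝟙 (near y) * 𝟙 (joined (vertex s (inj₁ i)) (vertex false y))) ≡ e
    by-side true  = cong₂ _+_ same opposite
    by-side false = trans (cong₂ _+_ opposite same) (+-identityʳ e)

  through-apex : ∑ (λ j → ∑ (tri zero j)) ≡ 2 * h * e
  through-apex = trans (∑-cong (λ j → trans (∑-*ˡ (a zero j) (λ z → a zero z * a j z)) (row (kind j))))
    (trans (∑-*ʳ e (a zero)) (cong (_* e) (Γ-degree zero)))
    where
    row : ∀ x → 𝟙 (joined apex x) * ∑ (λ z → 𝟙 (joined apex (kind z)) * 𝟙 (joined x (kind z))) ≡ 𝟙 (joined apex x) * e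
    row x with joined apex x in eq
    ... | true  = cong (1 *_) (apex-codegree x eq)
    ... | false = refl

  triᴷ : Kind → Kind → Kind → ℕ
  triᴷ x y z = 𝟙 (joined x y) * (𝟙 (joined x z) * 𝟙 (joined y z))

  is-apex : Kind → Bool
  is-apex apex         = true
  is-apex (vertex _ _) = false

  is-apex-zero : ∀ i → is-apex (kind i) ≡ true → i ≡ zero
  is-apex-zero zero    _ = refl
  is-apex-zero (suc i) p with splitAt (h + l) i
  is-apex-zero (suc i) () | inj₁ _
  is-apex-zero (suc i) () | inj₂ _

  -- Without the apex the graph is bipartite: of three vertices, two lie on the same side and are
  -- not joined.
  meets-apex : ∀ x y z → triᴷ x y z ≤ 𝟙 (is-apex x) * triᴷ x y z + 𝟙 (is-apex y) * triᴷ x y z + 𝟙 (is-apex z) * triᴷ x y z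
  meets-apex apex y z = ≤-trans (≤-reflexive (sym (*-identityˡ _))) (≤-trans (m≤m+n _ _) (m≤m+n _ _))
  meets-apex (vertex s x) apex z = ≤-trans (≤-reflexive (sym (*-identityˡ _))) (m≤m+n _ _)
  meets-apex (vertex s x) (vertex t y) apex = ≤-reflexive (sym (*-identityˡ _))
  meets-apex (vertex true x)  (vertex true y)  (vertex _ z)     = z≤n
  meets-apex (vertex false x) (vertex false y) (vertex _ z)     = z≤n
  meets-apex (vertex true x)  (vertex false y) (vertex true z)  = ≤-reflexive (*-zeroʳ (𝟙 (link x y)))
  meets-apex (vertex true x)  (vertex false y) (vertex false z) rewrite *-zeroʳ (𝟙 (link x z)) = ≤-reflexive (*-zeroʳ (𝟙 (link x y)))
  meets-apex (vertex false x) (vertex true y)  (vertex false z) = ≤-reflexive (*-zeroʳ (𝟙 (link x y)))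
  meets-apex (vertex false x) (vertex true y)  (vertex true z)  rewrite *-zeroʳ (𝟙 (link x z)) = ≤-reflexive (*-zeroʳ (𝟙 (link x y)))

  apex≤ : ∀ i → 𝟙 (is-apex (kind i)) ≤ 𝟙 ⌊ i ≟ zero ⌋
  apex≤ i with is-apex (kind i) in eq
  ... | false = z≤n
  ... | true  rewrite is-apex-zero i eq = ≤-refl

  meets-zero : ∀ i j l → tri i j l ≤ 𝟙 ⌊ i ≟ zero ⌋ * tri i j l + 𝟙 ⌊ j ≟ zero ⌋ * tri i j l + 𝟙 ⌊ l ≟ zero ⌋ * tri i j l
  meets-zero i j l = ≤-trans (meets-apex (kind i) (kind j) (kind l))
    (+-mono-≤ (+-mono-≤ (*-monoˡ-≤ (tri i j l) (apex≤ i)) (*-monoˡ-≤ (tri i j l) (apex≤ j))) (*-monoˡ-≤ (tri i j l) (apex≤ l)))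

  -- All triangles pass through the apex, whose 2h neighbours have codegree `e` with it. Equality is
  -- not computed here; it follows from the lower bound for all regular graphs.
  Γ-triangles : ∑³ tri ≤ 6 * (h * e)
  Γ-triangles = begin
    ∑³ tri
      ≤⟨ ∑³-mono meets-zero ⟩
    ∑³ (λ i j l → f₁ i j l + f₂ i j l + f₃ i j l)
      ≡⟨ trans (∑³-+ _ f₃) (cong (_+ ∑³ f₃) (∑³-+ f₁ f₂)) ⟩
    ∑³ f₁ + ∑³ f₂ + ∑³ f₃
      ≡⟨ cong₂ _+_ (cong₂ _+_ e₁ e₂) e₃ ⟩
    2 * h * e + 2 * h * e + 2 * h * e
      ≤⟨ certify (h ∷ e ∷ []) 0 (con 2 ⊗ # 0 ⊗ # 1 ⊕ con 2 ⊗ # 0 ⊗ # 1 ⊕ con 2 ⊗ # 0 ⊗ # 1) (con 6 ⊗ (# 0 ⊗ # 1)) [] tt ⟩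
    6 * (h * e) ∎
    where
    open ≤-Reasoning
    f₁ f₂ f₃ : Fin order → Fin order → Fin order → ℕ
    f₁ i j l = 𝟙 ⌊ i ≟ zero ⌋ * tri i j l
    f₂ i j l = 𝟙 ⌊ j ≟ zero ⌋ * tri i j l
    f₃ i j l = 𝟙 ⌊ l ≟ zero ⌋ * tri i j l
    e₁ : ∑³ f₁ ≡ 2 * h * e
    e₁ = trans (∑-cong (λ i → trans (∑-cong (λ j → ∑-*ˡ (𝟙 ⌊ i ≟ zero ⌋) (tri i j))) (∑-*ˡ (𝟙 ⌊ i ≟ zero ⌋) (λ j → ∑ (tri i j)))))
      (trans (∑-single zero (λ i → ∑ (λ j → ∑ (tri i j)))) through-apex)
    e₂ : ∑³ f₂ ≡ 2 * h * e
    e₂ = trans (∑³-cong (λ i j l → cong (𝟙 ⌊ j ≟ zero ⌋ *_) (tri-swap₁₂ i j l))) (trans (∑³-swap₁₂ f₁) e₁)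
    e₃ : ∑³ f₃ ≡ 2 * h * e
    e₃ = trans (∑³-cong (λ i j l → cong (𝟙 ⌊ l ≟ zero ⌋ *_) (tri-swap₂₃ i j l))) (trans (∑³-swap₂₃ f₂) e₂)

-- Translation of the parameters and the theorem.

range-e : ∀ n k q h → n ≡ 1 + 2 * q → k ≡ 2 * h → 2 * n < 5 * k → 2 * k < n → q + 1 ≤ 3 * h
range-e n k q h p₁ p₂ p₃ p₄ =
  certify (n ∷ k ∷ q ∷ h ∷ []) 5
  (# 2 ⊕ con 1) (con 3 ⊗ # 3)
   ((con 3 · con 1 ⊕ con 2 ⊗ # 2 ≼ # 0)
  ∷ (con 8 · # 1 ≼ con 2 ⊗ # 3)
  ∷ (con 2 · con 1 ⊕ con 2 ⊗ # 0 ≼ con 5 ⊗ # 1)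
  ∷ (con 1 · con 1 ⊕ con 2 ⊗ # 1 ≼ # 0) ∷ [])
  (≤-reflexive (sym p₁) , ≤-reflexive p₂ , p₃ , p₄ , tt)
range-upper : ∀ n k q h → n ≡ 1 + 2 * q → k ≡ 2 * h → 2 * k < n → 2 * (2 * h) ≤ 2 * q
range-upper n k q h p₁ p₂ p₃ =
  certify (n ∷ k ∷ q ∷ h ∷ []) 0
  (con 2 ⊗ (con 2 ⊗ # 3)) (con 2 ⊗ # 2)
   ((con 1 · # 0 ≼ con 1 ⊕ con 2 ⊗ # 2)
  ∷ (con 2 · con 2 ⊗ # 3 ≼ # 1)
  ∷ (con 1 · con 1 ⊕ con 2 ⊗ # 1 ≼ # 0) ∷ [])
  (≤-reflexive p₁ , ≤-reflexive (sym p₂) , p₃ , tt)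
range-lower : ∀ n k q h → n ≡ 1 + 2 * q → k ≡ 2 * h → 2 * n < 5 * k →
  2 * (2 * q + 1) < 2 * (5 * h)
range-lower n k q h p₁ p₂ p₃ =
  certify (n ∷ k ∷ q ∷ h ∷ []) 0
  (con 1 ⊕ con 2 ⊗ (con 2 ⊗ # 2 ⊕ con 1)) (con 2 ⊗ (con 5 ⊗ # 3))
   ((con 2 · con 1 ⊕ con 2 ⊗ # 2 ≼ # 0)
  ∷ (con 5 · # 1 ≼ con 2 ⊗ # 3)
  ∷ (con 1 · con 1 ⊕ con 2 ⊗ # 0 ≼ con 5 ⊗ # 1) ∷ [])
  (≤-reflexive (sym p₁) , ≤-reflexive p₂ , p₃ , tt)
bounds-e : ∀ q h e → 3 * h ≡ q + 1 + e → 2 * h ≤ q → e ≤ h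
bounds-e q h e p₁ p₂ =
  certify (q ∷ h ∷ e ∷ []) 0
  (# 2) (# 1)
   ((con 1 · # 0 ⊕ con 1 ⊕ # 2 ≼ con 3 ⊗ # 1)
  ∷ (con 1 · con 2 ⊗ # 1 ≼ # 0) ∷ [])
  (≤-reflexive (sym p₁) , p₂ , tt)
bounds-l : ∀ q h l → h + l ≡ q → 2 * h ≤ q → h ≤ l
bounds-l q h l p₁ p₂ =
  certify (q ∷ h ∷ l ∷ []) 0
  (# 1) (# 2)
   ((con 1 · # 0 ≼ # 1 ⊕ # 2)
  ∷ (con 1 · con 2 ⊗ # 1 ≼ # 0) ∷ [])
  (≤-reflexive (sym p₁) , p₂ , tt)
degree-up : ∀ q h e l → h + l ≡ q → 3 * h ≡ q + 1 + e → 1 + (e + l) ≤ 2 * h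
degree-up q h e l p₁ p₂ =
  certify (q ∷ h ∷ e ∷ l ∷ []) 0
  (con 1 ⊕ (# 2 ⊕ # 3)) (con 2 ⊗ # 1)
   ((con 1 · # 1 ⊕ # 3 ≼ # 0)
  ∷ (con 1 · # 0 ⊕ con 1 ⊕ # 2 ≼ con 3 ⊗ # 1) ∷ [])
  (≤-reflexive p₁ , ≤-reflexive (sym p₂) , tt)
degree-down : ∀ q h e l → h + l ≡ q → 3 * h ≡ q + 1 + e → 2 * h ≤ 1 + (e + l)
degree-down q h e l p₁ p₂ =
  certify (q ∷ h ∷ e ∷ l ∷ []) 0
  (con 2 ⊗ # 1) (con 1 ⊕ (# 2 ⊕ # 3))
   ((con 1 · # 0 ≼ # 1 ⊕ # 3)
  ∷ (con 1 · con 3 ⊗ # 1 ≼ # 0 ⊕ con 1 ⊕ # 2) ∷ [])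
  (≤-reflexive (sym p₁) , ≤-reflexive p₂ , tt)
l-positive : ∀ q h l → h + l ≡ q → 2 * h ≤ q → 1 ≤ h → 1 ≤ l
l-positive q h l p₁ p₂ p₃ =
  certify (q ∷ h ∷ l ∷ []) 0
  (con 1) (# 2)
   ((con 1 · # 0 ≼ # 1 ⊕ # 2)
  ∷ (con 1 · con 2 ⊗ # 1 ≼ # 0)
  ∷ (con 1 · con 1 ≼ # 1) ∷ [])
  (≤-reflexive (sym p₁) , p₂ , p₃ , tt)

parameters : ∀ n k → 1000000000 ≤ n → n % 2 ≡ 1 → k % 2 ≡ 0 → 2 * n < 5 * k → 2 * k < n →
  ∃ λ q → ∃ λ h → ∃ λ e → Range n k q h e
parameters n k large odd even 2n<5k 2k<n = n / 2 , k / 2 , 3 * (k / 2) ∸ (n / 2 + 1) , record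
  { n≡ = n≡ ; k≡ = k≡ ; e≡ = sym (m+[n∸m]≡n (range-e n k (n / 2) (k / 2) n≡ k≡ 2n<5k 2k<n))
  ; 2h≤q = *-cancelˡ-≤ 2 (range-upper n k (n / 2) (k / 2) n≡ k≡ 2k<n)
  ; 2q<5h = ≤-trans (≤-reflexive (+-suc (2 * (n / 2)) 1))
      (*-cancelˡ-< 2 (2 * (n / 2) + 1) (5 * (k / 2)) (range-lower n k (n / 2) (k / 2) n≡ k≡ 2n<5k))
  ; large = large }
  where
  n≡ : n ≡ 1 + 2 * (n / 2)
  n≡ = trans (m≡m%n+[m/n]*n n 2) (cong₂ _+_ odd (*-comm (n / 2) 2))
  k≡ : k ≡ 2 * (k / 2)
  k≡ = trans (m≡m%n+[m/n]*n k 2) (cong₂ _+_ even (*-comm (k / 2) 2))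

-- Since 3k - n - 1 is exactly 2e, neither the truncated subtraction nor the division by 4 loses
-- anything.
minimum≡ : ∀ {n k q h e} → Range n k q h e → (k * (3 * k ∸ n ∸ 1)) / 4 ≡ h * e
minimum≡ {n} {k} {q} {h} {e} rg = trans (cong (_/ 4) product) (m*n/n≡m (h * e) 4)
  where
  open Range rg
  3k-up : ∀ n k q h e → n ≡ 1 + 2 * q → k ≡ 2 * h → 3 * h ≡ q + 1 + e → 3 * k ≤ 2 * e + (1 + n)
  3k-up n k q h e p₁ p₂ p₃ =
    certify (n ∷ k ∷ q ∷ h ∷ e ∷ []) 0
    (con 3 ⊗ # 1) (con 2 ⊗ # 4 ⊕ (con 1 ⊕ # 0))
     ((con 1 · con 1 ⊕ con 2 ⊗ # 2 ≼ # 0)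
    ∷ (con 3 · # 1 ≼ con 2 ⊗ # 3)
    ∷ (con 2 · con 3 ⊗ # 3 ≼ # 2 ⊕ con 1 ⊕ # 4) ∷ [])
    (≤-reflexive (sym p₁) , ≤-reflexive p₂ , ≤-reflexive p₃ , tt)
  3k-down : ∀ n k q h e → n ≡ 1 + 2 * q → k ≡ 2 * h → 3 * h ≡ q + 1 + e → 2 * e + (1 + n) ≤ 3 * k
  3k-down n k q h e p₁ p₂ p₃ =
    certify (n ∷ k ∷ q ∷ h ∷ e ∷ []) 0
    (con 2 ⊗ # 4 ⊕ (con 1 ⊕ # 0)) (con 3 ⊗ # 1)
     ((con 1 · # 0 ≼ con 1 ⊕ con 2 ⊗ # 2)
    ∷ (con 3 · con 2 ⊗ # 3 ≼ # 1)
    ∷ (con 2 · # 2 ⊕ con 1 ⊕ # 4 ≼ con 3 ⊗ # 3) ∷ [])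
    (≤-reflexive p₁ , ≤-reflexive (sym p₂) , ≤-reflexive (sym p₃) , tt)
  product-up : ∀ k h e → k ≡ 2 * h → k * (2 * e) ≤ h * e * 4
  product-up k h e p₁ =
    certify (k ∷ h ∷ e ∷ []) 0
    (# 0 ⊗ (con 2 ⊗ # 2)) (# 1 ⊗ # 2 ⊗ con 4)
     ((con 2 ⊗ # 2 · # 0 ≼ con 2 ⊗ # 1) ∷ [])
    (≤-reflexive p₁ , tt)
  product-down : ∀ k h e → k ≡ 2 * h → h * e * 4 ≤ k * (2 * e)
  product-down k h e p₁ =
    certify (k ∷ h ∷ e ∷ []) 0
    (# 1 ⊗ # 2 ⊗ con 4) (# 0 ⊗ (con 2 ⊗ # 2))
     ((con 2 ⊗ # 2 · con 2 ⊗ # 1 ≼ # 0) ∷ [])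
    (≤-reflexive (sym p₁) , tt)
  difference : 3 * k ∸ n ∸ 1 ≡ 2 * e
  difference = begin
    3 * k ∸ n ∸ 1              ≡⟨ ∸-+-assoc (3 * k) n 1 ⟩
    3 * k ∸ (n + 1)            ≡⟨ cong₂ _∸_ (≤-antisym (3k-up n k q h e n≡ k≡ e≡) (3k-down n k q h e n≡ k≡ e≡)) (+-comm n 1) ⟩
    2 * e + (1 + n) ∸ (1 + n)  ≡⟨ m+n∸n≡m (2 * e) (1 + n) ⟩
    2 * e ∎
    where open ≡-Reasoning
  product : k * (3 * k ∸ n ∸ 1) ≡ h * e * 4
  product = trans (cong (k *_) difference) (≤-antisym (product-up k h e k≡) (product-down k h e k≡))

regular-sum : ∀ {n k} (G : Graph n) → Regular k G → ∀ i → ∑ (Triangles.a G i) ≡ k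
regular-sum G reg i = trans (sym (count≡∑ (adj G i))) (reg i)

few⇒extremal : ∀ {n k q h e} → Range n k q h e → (G : Graph n) → Regular k G → triangles G ≤ h * e →
  h * e ≤ triangles G × InFamily n k G
few⇒extremal {n} {k} {h = h} {e} rg G reg le = conclude (few-triangles⇒extremal G rg (regular-sum G reg)
    (≤-trans (≤-reflexive (Triangles.∑tri≡6*triangles G)) (*-monoʳ-≤ 6 le)))
  where
  conclude : Extremality k h e G → h * e ≤ triangles G × InFamily n k G
  conclude (lower , family) = *-cancelˡ-≤ 6 (≤-trans lower (≤-reflexive (Triangles.∑tri≡6*triangles G))) , family

-- The structural analysis starts from an upper bound on the number of triangles, so it is invoked
-- only when the graph has at most `h * e` of them; otherwise nothing is left to prove.
he≤triangles : ∀ {n k q h e} → Range n k q h e → (G : Graph n) → Regular k G → h * e ≤ triangles G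
he≤triangles {h = h} {e} rg G reg = decide (≤-total (h * e) (triangles G))
  where
  decide : h * e ≤ triangles G ⊎ triangles G ≤ h * e → h * e ≤ triangles G
  decide (inj₁ le) = le
  decide (inj₂ le) = proj₁ (few⇒extremal rg G reg le)

construction : ∀ {n k q h e} → Range n k q h e → ∃ λ (G : Graph n) → Regular k G × triangles G ≤ h * e
construction {n} {k} {q} {h} {e} rg = subst (λ m → ∃ λ (G : Graph m) → Regular k G × triangles G ≤ h * e) order≡n
  (Γ , (λ i → trans (count≡∑ (adj Γ i)) (trans (Γ-degree i) (sym k≡)))
     , *-cancelˡ-≤ 6 (≤-trans (≤-reflexive (sym (Triangles.∑tri≡6*triangles Γ))) Γ-triangles))
  where
  open Range rg
  h≥1 : ∀ h → 200000000 ≤ h → 1 ≤ h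
  h≥1 h p₁ =
    certify (h ∷ []) 199999999
    (con 1) (# 0)
     ((con 1 · con 200000000 ≼ # 0) ∷ [])
    (p₁ , tt)
  h≤q : ∀ h q → 2 * h ≤ q → h ≤ q
  h≤q h q p₁ =
    certify (h ∷ q ∷ []) 1
    (# 0) (# 1)
     ((con 1 · con 2 ⊗ # 0 ≼ # 1) ∷ [])
    (p₁ , tt)
  l : ℕ
  l = q ∸ h
  h+l≡q : h + l ≡ q
  h+l≡q = m+[n∸m]≡n (h≤q h q 2h≤q)
  0<h : 1 ≤ h
  0<h = h≥1 h (h-large n q h n≡ 2q<5h large)
  instance
    h≢0 : NonZero h
    h≢0 = >-nonZero 0<h
    l≢0 : NonZero l
    l≢0 = >-nonZero (l-positive q h l h+l≡q 2h≤q 0<h)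
  open Construction h l e (bounds-e q h e e≡ 2h≤q) (bounds-l q h l h+l≡q 2h≤q)
    (≤-antisym (degree-up q h e l h+l≡q e≡) (degree-down q h e l h+l≡q e≡))
  order≡n : order ≡ n
  order≡n = trans (cong (λ x → suc (x + x)) h+l≡q) (trans (cong (λ x → suc (q + x)) (sym (+-identityʳ q))) (sym n≡))

theorem1p3 : (n k : ℕ) → 10 ^ 9 ≤ n → n % 2 ≡ 1 → k % 2 ≡ 0
    → 2 * n < 5 * k → 2 * k < n
    → IsMinTriangles n k ((k * (3 * k ∸ n ∸ 1)) / 4)
    × (∀ (G : Graph n) → Regular k G
    → triangles G ≡ (k * (3 * k ∸ n ∸ 1)) / 4 → InFamily n k G)
theorem1p3 n k large odd even 2n<5k 2k<n = conclude (parameters n k large odd even 2n<5k 2k<n)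
  where
  conclude : (∃ λ q → ∃ λ h → ∃ λ e → Range n k q h e) →
    IsMinTriangles n k ((k * (3 * k ∸ n ∸ 1)) / 4)
    × (∀ (G : Graph n) → Regular k G → triangles G ≡ (k * (3 * k ∸ n ∸ 1)) / 4 → InFamily n k G)
  conclude (q , h , e , rg) = (attained (construction rg) , λ G reg → ≤-trans (≤-reflexive (minimum≡ rg)) (he≤triangles rg G reg))
    , λ G reg eq → proj₂ (few⇒extremal rg G reg (≤-reflexive (trans eq (minimum≡ rg))))
    where
    attained : (∃ λ (G : Graph n) → Regular k G × triangles G ≤ h * e) →
      Σ (Graph n) λ G → Regular k G × triangles G ≡ (k * (3 * k ∸ n ∸ 1)) / 4
    attained (G , reg , le) = G , reg , trans (≤-antisym le (he≤triangles rg G reg)) (sym (minimum≡ rg))
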